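{- Given a set $X\subset\mathbb{R}^d$ of $n$ points, let $f(S^*)$ be the optimal value of the unconstrained $k$-means problem, i.e. the minimum of $f(S)=\sum_{x\in X}\min_{c\in S}\|x-c\|^2$ over sets $S\subset\mathbb{R}^d$ subject to $|S|\le k$. For $\varepsilon>0$, one can find in time $O(n^2dk\log(1/\varepsilon))$ a set $S\subset\mathbb{R}^d$ of size $|S|=O(k)+k\log(1/\varepsilon)$ such that $f(S)\le(2+\varepsilon)f(S^*)$.
   Context: $\|\cdot\|$ is the Euclidean norm on $\mathbb{R}^d$. In the unconstrained $k$-means problem the centers may be arbitrary points of $\mathbb{R}^d$. -}

module Defs where

open import Algebra.Bundles using (CommutativeRing; Semiring)
import Algebra.Construct.NaturalChoice.Min as Min
import Algebra.Construct.NaturalChoice.Max as Max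
import Algebra.Definitions.RawSemiring as RawSemiringDefs
open import Axiom.ExcludedMiddle using (ExcludedMiddle)
open import Data.Bool.Base using (if_then_else_)
open import Data.Fin.Base using (toℕ; fromℕ<)
open import Data.List.Base as List using (List)
open import Data.Maybe.Base using (Maybe; just; nothing)
open import Data.Nat.Base as ℕ using (ℕ; suc; NonZero; _∸_; _!)
import Data.Nat.Properties as ℕ
open import Data.Product.Base using (∃; _×_; proj₁)
open import Data.Vec.Functional as Vector using (Vector)
import Data.Vec.Functional.Relation.Binary.Equality.Setoid as VectorEquality
open import Function.Definitions using (Injective)
open import Level using (0ℓ) renaming (suc to lsuc)
open import Relation.Binary.Bundles using (TotalOrder)
open import Relation.Binary.Core using (Rel)
open import Relation.Binary.Structures using (IsTotalOrder)
open import Relation.Binary.PropositionalEquality.Core using (_≡_)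
import Relation.Binary.Construct.NonStrictToStrict as ToStrict
open import Relation.Nullary.Decidable.Core using (does; yes; no)
open import Relation.Nullary.Negation.Core using (¬_)
open import Relation.Unary using (Pred)

-- A Dedekind-complete ordered field.  Together with excluded middle (which is
-- always assumed alongside it below) these axioms determine the real numbers
-- up to a unique isomorphism.

record Reals : Set (lsuc 0ℓ) where
  field
    commutativeRing : CommutativeRing 0ℓ 0ℓ

  open CommutativeRing commutativeRing public

  infix 4 _≤_ _<_

  field
    _≤_          : Rel Carrier 0ℓ
    isTotalOrder : IsTotalOrder _≈_ _≤_
    0≉1          : ¬ 0# ≈ 1#
    inverse      : ∀ x → ¬ x ≈ 0# → ∃ λ y → x * y ≈ 1#
    +-monoˡ-≤    : ∀ z {x y} → x ≤ y → x + z ≤ y + z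
    *-nonNeg     : ∀ {x y} → 0# ≤ x → 0# ≤ y → 0# ≤ x * y

  UpperBound : Pred Carrier 0ℓ → Carrier → Set
  UpperBound P u = ∀ x → P x → x ≤ u

  field
    supremum : ∀ (P : Pred Carrier 0ℓ) → ∃ P → ∃ (UpperBound P) →
               ∃ λ s → UpperBound P s × (∀ u → UpperBound P u → s ≤ u)

  _<_ : Rel Carrier 0ℓ
  _<_ = ToStrict._<_ _≈_ _≤_

  totalOrder : TotalOrder 0ℓ 0ℓ 0ℓ
  totalOrder = record { isTotalOrder = isTotalOrder }

  open Min totalOrder public using (_⊓_)
  open Max totalOrder public using (_⊔_)
  open Semiring semiring public using (rawSemiring)
  open RawSemiringDefs rawSemiring public using (_^_; sum)

  fromℕ : ℕ → Carrier
  fromℕ n = RawSemiringDefs._×_ rawSemiring n 1#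

-- Programs of a real RAM.  The machine has a memory N of natural numbers
-- (sizes, indices and addresses) and a memory R of real numbers, both indexed
-- by ℕ.  Naturals support only addition, truncated subtraction and comparison;
-- 1 is the only real constant, and reals are never converted to naturals.

data Instruction : Set where
  setℕ    : (a c : ℕ) → Instruction      -- N[a] := c
  addℕ    : (a b c : ℕ) → Instruction    -- N[a] := N[b] + N[c]
  subℕ    : (a b c : ℕ) → Instruction    -- N[a] := N[b] ∸ N[c]
  loadℕ   : (a b : ℕ) → Instruction      -- N[a] := N[N[b]]
  storeℕ  : (a b : ℕ) → Instruction      -- N[N[a]] := N[b]
  oneᴿ    : (a : ℕ) → Instruction        -- R[a] := 1
  addᴿ    : (a b c : ℕ) → Instruction    -- R[a] := R[b] + R[c]
  subᴿ    : (a b c : ℕ) → Instruction    -- R[a] := R[b] - R[c]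
  mulᴿ    : (a b c : ℕ) → Instruction    -- R[a] := R[b] * R[c]
  divᴿ    : (a b c : ℕ) → Instruction    -- R[a] := R[b] / R[c]
  loadᴿ   : (a b : ℕ) → Instruction      -- R[a] := R[N[b]]
  storeᴿ  : (a b : ℕ) → Instruction      -- R[N[a]] := R[b]
  jump≤ℕ  : (a b l : ℕ) → Instruction    -- if N[a] ≤ N[b] go to line l
  jump≤ᴿ  : (a b l : ℕ) → Instruction    -- if R[a] ≤ R[b] go to line l

Program : Set
Program = List Instruction

module KMeans (em : ExcludedMiddle 0ℓ) (ℝ : Reals) where

  open Reals ℝ public

  infix 8 _⁻¹

  -- 0 ⁻¹ is 0 by convention.
  _⁻¹ : Carrier → Carrier
  x ⁻¹ with em {x ≈ 0#}
  ... | yes _   = 0#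
  ... | no  x≉0 = proj₁ (inverse x x≉0)

  expPartialSum : Carrier → ℕ → Carrier
  expPartialSum x m = sum {m} λ i → x ^ toℕ i * fromℕ (toℕ i !) ⁻¹

  infix 4 _⟶_

  _⟶_ : (ℕ → Carrier) → Carrier → Set
  s ⟶ y = ∀ δ → 0# < δ → ∃ λ M → ∀ m → M ℕ.≤ m → y - δ < s m × s m < y + δ

  -- IsLog y l : the natural logarithm of y is l, that is, exp l = y.
  IsLog : Carrier → Carrier → Set
  IsLog y l = expPartialSum l ⟶ y

  Point : ℕ → Set
  Point d = Vector Carrier d

  ‖_‖² : ∀ {d} → Point d → Carrier
  ‖ x ‖² = sum λ i → x i * x i

  infixl 6 _-ᵥ_

  _-ᵥ_ : ∀ {d} → Point d → Point d → Point d
  _-ᵥ_ = Vector.zipWith _-_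

  -- Nonempty finite subsets of ℝᵈ, listed without repetition; minima over the
  -- empty set are thereby excluded.
  record PointSet (d : ℕ) : Set where
    open VectorEquality setoid using (_≋_)
    field
      card       : ℕ
      {{nonZero}} : NonZero card
      point      : Vector (Point d) card
      distinct   : Injective _≡_ _≋_ point

  open PointSet public using (card; point)

  minimum : ∀ {m} .{{_ : NonZero m}} → Vector Carrier m → Carrier
  minimum {suc _} v = Vector.foldr _⊓_ (Vector.head v) (Vector.tail v)

  cost : ∀ {d} → PointSet d → PointSet d → Carrier
  cost X S = sum λ i → minimum {{PointSet.nonZero S}} λ j → ‖ point X i -ᵥ point S j ‖²

  IsOptimal : ∀ {d} → PointSet d → ℕ → PointSet d → Set
  IsOptimal X k S* =
    card S* ℕ.≤ k × (∀ S → card S ℕ.≤ k → cost X S* ≤ cost X S)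

  record Configuration : Set where
    constructor ⟨_,_,_⟩
    field
      pc : ℕ
      N  : ℕ → ℕ
      R  : ℕ → Carrier

  open Configuration public

  _[_≔_] : ∀ {A : Set} → (ℕ → A) → ℕ → A → ℕ → A
  (f [ a ≔ v ]) b = if a ℕ.≡ᵇ b then v else f b

  execute : Instruction → Configuration → Configuration
  execute (setℕ a c)     ⟨ p , n , r ⟩ = ⟨ suc p , n [ a ≔ c ] , r ⟩
  execute (addℕ a b c)   ⟨ p , n , r ⟩ = ⟨ suc p , n [ a ≔ n b ℕ.+ n c ] , r ⟩
  execute (subℕ a b c)   ⟨ p , n , r ⟩ = ⟨ suc p , n [ a ≔ n b ∸ n c ] , r ⟩
  execute (loadℕ a b)    ⟨ p , n , r ⟩ = ⟨ suc p , n [ a ≔ n (n b) ] , r ⟩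
  execute (storeℕ a b)   ⟨ p , n , r ⟩ = ⟨ suc p , n [ n a ≔ n b ] , r ⟩
  execute (oneᴿ a)       ⟨ p , n , r ⟩ = ⟨ suc p , n , r [ a ≔ 1# ] ⟩
  execute (addᴿ a b c)   ⟨ p , n , r ⟩ = ⟨ suc p , n , r [ a ≔ r b + r c ] ⟩
  execute (subᴿ a b c)   ⟨ p , n , r ⟩ = ⟨ suc p , n , r [ a ≔ r b - r c ] ⟩
  execute (mulᴿ a b c)   ⟨ p , n , r ⟩ = ⟨ suc p , n , r [ a ≔ r b * r c ] ⟩
  execute (divᴿ a b c)   ⟨ p , n , r ⟩ = ⟨ suc p , n , r [ a ≔ r b * (r c) ⁻¹ ] ⟩
  execute (loadᴿ a b)    ⟨ p , n , r ⟩ = ⟨ suc p , n , r [ a ≔ r (n b) ] ⟩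
  execute (storeᴿ a b)   ⟨ p , n , r ⟩ = ⟨ suc p , n , r [ n a ≔ r b ] ⟩
  execute (jump≤ℕ a b l) ⟨ p , n , r ⟩ =
    ⟨ (if n a ℕ.≤ᵇ n b then l else suc p) , n , r ⟩
  execute (jump≤ᴿ a b l) ⟨ p , n , r ⟩ =
    ⟨ (if does (em {r a ≤ r b}) then l else suc p) , n , r ⟩

  fetch : Program → ℕ → Maybe Instruction
  fetch P p = List.head (List.drop p P)

  -- The machine halts when the program counter leaves the program, and every
  -- instruction takes unit time: P ⊢ c ⇓[ t ] c′ says that P, started in c,
  -- halts in c′ after exactly t instructions.
  data _⊢_⇓[_]_ (P : Program) : Configuration → ℕ → Configuration → Set where
    halt : ∀ {c} → fetch P (pc c) ≡ nothing → P ⊢ c ⇓[ 0 ] c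
    next : ∀ {c c′ i t} → fetch P (pc c) ≡ just i →
           P ⊢ execute i c ⇓[ t ] c′ → P ⊢ c ⇓[ suc t ] c′

  -- N starts as |X|, d, k, 0, 0, … and R starts as ε followed by the
  -- coordinates of the points of X (point after point), followed by zeros.
  input : ∀ {d} → PointSet d → ℕ → Carrier → Configuration
  input {d} X k ε = ⟨ 0 , n₀ , r₀ ⟩
    where
    n₀ : ℕ → ℕ
    n₀ 0 = card X
    n₀ 1 = d
    n₀ 2 = k
    n₀ _ = 0

    r₀ : ℕ → Carrier
    r₀ 0 = ε
    r₀ (suc a) with a ℕ.<? card X ℕ.* d
    ... | yes a<nd = Vector.concat (point X) (fromℕ< a<nd)
    ... | no  _    = 0#

  -- On output N[0] is |S|, and R starts with the coordinates of the points of S.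
  Outputs : ∀ {d} → Configuration → PointSet d → Set
  Outputs c S =
    N c 0 ≡ card S × (∀ a → R c (toℕ a) ≈ Vector.concat (point S) a)

{-# OPTIONS --safe #-}
module Submission where

open import Defs
import Algebra.Construct.NaturalChoice.Max as Max
import Algebra.Construct.NaturalChoice.Min as Min
import Algebra.Properties.CommutativeSemiring.Exp as CommutativeSemiringExp
import Algebra.Properties.Monoid.Mult as MonoidMult
import Algebra.Properties.Ring as RingProperties
import Algebra.Properties.Semiring.Exp as SemiringExp
import Algebra.Properties.Semiring.Mult as SemiringMult
import Algebra.Solver.Ring as RingSolver
open import Algebra.Solver.Ring.AlmostCommutativeRing using (fromCommutativeRing; _-Raw-AlmostCommutative⟶_)
open import Axiom.ExcludedMiddle using (ExcludedMiddle)
open import Data.Bool.Base as Bool using (Bool; true; false; _∧_; _∨_; T)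
open import Data.Bool.ListAction using (all)
open import Data.Empty using (⊥-elim)
open import Data.Fin.Base as Fin using (Fin; toℕ)
import Data.Fin.Properties as Fin
open import Data.Integer.Base as ℤ using (ℤ; +_; -[1+_])
import Data.Integer.Properties as ℤ
open import Data.List.Base as List using (List; []; _∷_; _++_; length)
import Data.List.Properties as List
open import Data.Maybe.Base using (Maybe; just; nothing)
open import Data.Nat.Base as ℕ using (ℕ; NonZero; zero; suc; z≤n; s≤s; _!)
import Data.Nat.Induction as ℕ
import Data.Nat.Properties as ℕ
open import Data.Nat.Solver using () renaming (module +-*-Solver to ℕ-Solver)
open import Data.Product.Base using (∃; ∃-syntax; _×_; _,_; proj₁; proj₂)
open import Data.Sum.Base using (_⊎_; inj₁; inj₂)
open import Data.Unit.Base using (tt)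
open import Data.Vec.Functional as Vector using (Vector)
open import Function.Base using (_∘_; _⟨_⟩_)
open import Level using (0ℓ)
open import Relation.Binary.Bundles using (TotalOrder)
open import Relation.Binary.Definitions using (tri<; tri≈; tri>)
open import Relation.Binary.PropositionalEquality.Core as ≡ using (_≡_)
import Relation.Binary.Reasoning.Setoid as SetoidReasoning
import Relation.Nullary.Decidable.Core as Dec
open import Relation.Nullary.Decidable.Core using (yes; no)
open import Relation.Nullary.Negation.Core using (¬_; contradiction)

-- The algorithm only opens points of X as centres and maintains D y, the squared distance from
-- y to the nearest centre.  A first phase of 4 k steps reaches a constant factor.  Each step
-- takes the point x with the heaviest isolated ball, of squared radius ρ = D x / K, and opens the
-- best 1-median z of the points near x.  Let U be the value of the heaviest ball left at the end.
-- Later balls near an earlier one are much smaller, so the balls form a forest; a ball with at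
-- most one child either has an optimal centre nearby that no later ball is close to, or contains
-- points paying at least U in the optimum that no later ball contains.  Counting children gives
-- 4 k U ≤ 2 (k U + opt), hence k U ≤ opt, and a total cost of at most 3 K opt.
--
-- A second phase opens greedily the point that decreases the cost most.  Since
-- Σ_{x,y ∈ A} |x - y|² ≤ 2 |A| Σ_{x ∈ A} |x - c|² for a cluster A with centre c, a step shrinks
-- cost - 2 opt by the factor 1 - 1/k, so stopping when 4 K (1 - 1/k)ⁱ ≤ ε yields 2 + ε; the bound
-- (1 - 1/k)ⁱ Σ_{j<m} (i/k)ʲ/j! ≤ 1 shows that this takes at most k (34 + max(1, log(1/ε))) + 1 steps.

-- The number of greedy steps needed from an arbitrary start depends on the ratio between the
-- starting cost and the optimum; the first phase exists to make that ratio a constant, so that only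
-- `log (1/ε)` remains. The obstacle in the first phase is a long chain of nested balls, each with a
-- single child: it could use up many steps without meeting a new optimal centre. Opening the median
-- `z` rather than `x` excludes this. The ball of the only child lies in the region over which `z`
-- was chosen, yet `z` stays far from it and serves it at a loss of about `K/2` times its value. The
-- median inequality forces distant points of the region to make up for the loss, and these either
-- pay in the optimum or lie near an optimal centre that later balls cannot reach. Squared distances
-- obey the triangle inequality only up to a factor 2, so every comparison multiplies constants; `K`
-- is so large that the radii along a chain shrink fast enough to absorb them. The machine has no
-- logarithm: it compares multiples of powers of `1 - 1/k` with `ε`, and `exp` enters only the
-- analysis, through its partial sums.

module OrderedField (em : ExcludedMiddle 0ℓ) (ℝ : Reals) where

  open KMeans em ℝ
  open RingProperties ring using (-‿distribˡ-*; -‿distribʳ-*; -‿involutive; -0#≈0#; -‿+-comm)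
  open SemiringMult semiring using (×1-homo-*)
  open MonoidMult +-monoid using (×-homo-+)
  private module Tot = TotalOrder totalOrder

  -- Numerals and the coefficient map of the ring solver

  opaque
    -- Opaque because conversion checking could otherwise unfold a numeral such as 2³² into a sum of
    -- that many ones; the lemmas of this block are the interface.
    num : ℕ → Carrier
    num = fromℕ

    num≡fromℕ : ∀ n → num n ≡ fromℕ n
    num≡fromℕ n = ≡.refl

    num-0 : num 0 ≈ 0#
    num-0 = refl

    num-1 : num 1 ≈ 1#
    num-1 = +-identityʳ 1#

    num-suc : ∀ n → num (suc n) ≈ 1# + num n
    num-suc n = refl

    num-+ : ∀ m n → num (m ℕ.+ n) ≈ num m + num n
    num-+ m n = ×-homo-+ 1# m n

    num-* : ∀ m n → num (m ℕ.* n) ≈ num m * num n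
    num-* m n = ×1-homo-* m n

  -- Zero and one are kept apart so that they appear in the goals of the solver as 0# and 1#.
  lit : ℕ → Carrier
  lit 0             = 0#
  lit 1             = 1#
  lit (suc (suc n)) = num (suc (suc n))

  lit≈num : ∀ n → lit n ≈ num n
  lit≈num 0             = sym num-0
  lit≈num 1             = sym num-1
  lit≈num (suc (suc n)) = refl

  int : ℤ → Carrier
  int (+ n)      = lit n
  int (-[1+ n ]) = - num (suc n)

  module _ where
    open SetoidReasoning setoid
    private
      int-neg : ∀ i → int (ℤ.- i) ≈ - int i
      int-neg (+ zero)  = sym -0#≈0#
      int-neg (+ suc n) = -‿cong (sym (lit≈num (suc n)))
      int-neg -[1+ n ]  = trans (lit≈num (suc n)) (sym (-‿involutive _))

      shift : ∀ a x y → a + x - (a + y) ≈ x - y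
      shift a x y = begin
        a + x - (a + y)       ≈⟨ +-cong (+-comm a x) (sym (-‿+-comm a y)) ⟩
        x + a + (- a + - y)   ≈⟨ +-assoc x a _ ⟩
        x + (a + (- a + - y)) ≈⟨ +-congˡ (sym (+-assoc a (- a) (- y))) ⟩
        x + (a + - a + - y)   ≈⟨ +-congˡ (trans (+-congʳ (-‿inverseʳ a)) (+-identityˡ _)) ⟩
        x - y                 ∎

      int-⊖ : ∀ m n → int (m ℤ.⊖ n) ≈ num m - num n
      int-⊖ m zero = begin
        lit m        ≈⟨ trans (lit≈num m) (sym (+-identityʳ _)) ⟩
        num m + 0#   ≈⟨ +-congˡ (trans (sym -0#≈0#) (-‿cong (sym num-0))) ⟩
        num m - num 0 ∎
      int-⊖ zero (suc n) = begin
        - num (suc n)         ≈⟨ sym (+-identityˡ _) ⟩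
        0# - num (suc n)      ≈⟨ +-congʳ (sym num-0) ⟩
        num 0 - num (suc n)   ∎
      int-⊖ (suc m) (suc n) = begin
        int (suc m ℤ.⊖ suc n)           ≡⟨ ≡.cong int (ℤ.[1+m]⊖[1+n]≡m⊖n m n) ⟩
        int (m ℤ.⊖ n)                   ≈⟨ int-⊖ m n ⟩
        num m - num n                   ≈⟨ sym (shift 1# _ _) ⟩
        1# + num m - (1# + num n)       ≈⟨ +-cong (sym (num-suc m)) (-‿cong (sym (num-suc n))) ⟩
        num (suc m) - num (suc n)       ∎

      int-+ : ∀ i j → int (i ℤ.+ j) ≈ int i + int j
      int-+ (+ m) (+ n)           = trans (lit≈num (m ℕ.+ n)) (trans (num-+ m n) (sym (+-cong (lit≈num m) (lit≈num n))))
      int-+ (+ m) (-[1+ n ])      = trans (int-⊖ m (suc n)) (+-congʳ (sym (lit≈num m)))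
      int-+ (-[1+ m ]) (+ n)      = trans (int-⊖ n (suc m)) (trans (+-congʳ (sym (lit≈num n))) (+-comm _ _))
      int-+ (-[1+ m ]) (-[1+ n ]) = begin
        - num (suc (suc (m ℕ.+ n)))        ≡⟨ ≡.cong (λ i → - num (suc i)) (≡.sym (ℕ.+-suc m n)) ⟩
        - num (suc m ℕ.+ suc n)            ≈⟨ -‿cong (num-+ (suc m) (suc n)) ⟩
        - (num (suc m) + num (suc n))      ≈⟨ sym (-‿+-comm _ _) ⟩
        - num (suc m) - num (suc n)        ∎

      int-* : ∀ i j → int (i ℤ.* j) ≈ int i * int j
      int-* (+ m) (+ n) = begin
        int (+ m ℤ.* + n)    ≡⟨ ≡.cong int (≡.sym (ℤ.pos-* m n)) ⟩
        lit (m ℕ.* n)        ≈⟨ trans (lit≈num (m ℕ.* n)) (num-* m n) ⟩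
        num m * num n        ≈⟨ *-cong (sym (lit≈num m)) (sym (lit≈num n)) ⟩
        lit m * lit n        ∎
      int-* (+ m) (-[1+ n ]) = begin
        int (+ m ℤ.* -[1+ n ])         ≡⟨ ≡.cong int (≡.sym (ℤ.neg-distribʳ-* (+ m) (+ suc n))) ⟩
        int (ℤ.- (+ m ℤ.* + suc n))    ≈⟨ int-neg (+ m ℤ.* + suc n) ⟩
        - int (+ m ℤ.* + suc n)        ≈⟨ -‿cong (int-* (+ m) (+ suc n)) ⟩
        - (lit m * lit (suc n))        ≈⟨ -‿distribʳ-* _ _ ⟩
        lit m * - lit (suc n)          ≈⟨ *-congˡ (-‿cong (lit≈num (suc n))) ⟩
        lit m * - num (suc n)          ∎
      int-* (-[1+ m ]) (+ n) = begin
        int (-[1+ m ] ℤ.* + n)         ≡⟨ ≡.cong int (≡.sym (ℤ.neg-distribˡ-* (+ suc m) (+ n))) ⟩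
        int (ℤ.- (+ suc m ℤ.* + n))    ≈⟨ int-neg (+ suc m ℤ.* + n) ⟩
        - int (+ suc m ℤ.* + n)        ≈⟨ -‿cong (int-* (+ suc m) (+ n)) ⟩
        - (lit (suc m) * lit n)        ≈⟨ -‿distribˡ-* _ _ ⟩
        - lit (suc m) * lit n          ≈⟨ *-congʳ (-‿cong (lit≈num (suc m))) ⟩
        - num (suc m) * lit n          ∎
      int-* (-[1+ m ]) (-[1+ n ]) = begin
        lit (suc m ℕ.* suc n)           ≈⟨ trans (lit≈num (suc m ℕ.* suc n)) (num-* (suc m) (suc n)) ⟩
        num (suc m) * num (suc n)       ≈⟨ sym (-‿involutive _) ⟩
        - - (num (suc m) * num (suc n)) ≈⟨ -‿cong (-‿distribˡ-* _ _) ⟩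
        - (- num (suc m) * num (suc n)) ≈⟨ -‿distribʳ-* _ _ ⟩
        - num (suc m) * - num (suc n)   ∎

    morphism : ℤ.+-*-rawRing -Raw-AlmostCommutative⟶ fromCommutativeRing commutativeRing
    morphism = record
      { ⟦_⟧ = int ; +-homo = int-+ ; *-homo = int-* ; -‿homo = int-neg
      ; 0-homo = refl ; 1-homo = refl }

  private
    _int≟_ : ∀ i j → Maybe (int i ≈ int j)
    i int≟ j with i ℤ.≟ j
    ... | yes eq = just (reflexive (≡.cong int eq))
    ... | no  _  = nothing

  module Solver = RingSolver ℤ.+-*-rawRing (fromCommutativeRing commutativeRing) morphism _int≟_
  open Solver using (solve; _:=_; _:+_; _:*_; _:-_; :-_)

  infix 9 #_

  #_ : ∀ {m} → ℕ → Solver.Polynomial m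
  # n = Solver.con (+ n)

  -- Order and arithmetic of an ordered field

  open Tot public using () renaming
    (refl to ≤-refl; trans to ≤-trans; antisym to ≤-antisym; reflexive to ≤-reflexive; total to ≤-total)

  ≰⇒≥ : ∀ {x y} → ¬ x ≤ y → y ≤ x
  ≰⇒≥ {x} {y} x≰y with ≤-total x y
  ... | inj₁ x≤y = contradiction x≤y x≰y
  ... | inj₂ y≤x = y≤x

  ≤-resp : ∀ {x x′ y y′} → x ≈ x′ → y ≈ y′ → x ≤ y → x′ ≤ y′
  ≤-resp x≈x′ y≈y′ x≤y = ≤-trans (≤-reflexive (sym x≈x′)) (≤-trans x≤y (≤-reflexive y≈y′))

  +-mono-≤ : ∀ {x y u v} → x ≤ y → u ≤ v → x + u ≤ y + v
  +-mono-≤ {x} {y} {u} {v} x≤y u≤v =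
    ≤-trans (+-monoˡ-≤ u x≤y) (≤-resp (+-comm u y) (+-comm v y) (+-monoˡ-≤ y u≤v))

  -- The only rule for linear arithmetic: the conclusion follows from a sum of
  -- hypotheses x ≤ y, the equation being left to the ring solver.
  by : ∀ {x y a b} → x ≤ y → a + y ≈ b + x → a ≤ b
  by {x} {y} {a} {b} x≤y eq = ≤-resp (cancel a x) b≈ (+-monoˡ-≤ (- x) (+-mono-≤ (≤-refl {a}) x≤y))
    where
    cancel : ∀ a x → a + x - x ≈ a
    cancel = solve 2 (λ a x → a :+ x :- x := a) refl
    b≈ : a + y - x ≈ b
    b≈ = trans (+-congʳ eq) (cancel b x)

  0≤-by : ∀ {x a b} → 0# ≤ x → a + x ≈ b → a ≤ b
  0≤-by 0≤x eq = by 0≤x (trans eq (sym (+-identityʳ _)))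

  sub-nonneg : ∀ {x y} → x ≤ y → 0# ≤ y - x
  sub-nonneg {x} {y} x≤y = by x≤y (solve 2 (λ x y → # 0 :+ y := y :- x :+ x) refl x y)

  *-monoˡ-≤ : ∀ {c x y} → 0# ≤ c → x ≤ y → c * x ≤ c * y
  *-monoˡ-≤ {c} {x} {y} 0≤c x≤y =
    0≤-by (*-nonNeg 0≤c (sub-nonneg x≤y)) (solve 3 (λ c x y → c :* x :+ c :* (y :- x) := c :* y) refl c x y)

  open Max totalOrder public using (x≤x⊔y; x≤y⊔x; ⊔-lub)
  open Min totalOrder public using (x⊓y≤x; x⊓y≤y; ⊓-glb)

  0≤x² : ∀ x → 0# ≤ x * x
  0≤x² x with ≤-total 0# x
  ... | inj₁ 0≤x = *-nonNeg 0≤x 0≤x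
  ... | inj₂ x≤0 = ≤-resp refl (solve 1 (λ x → (:- x) :* (:- x) := x :* x) refl x) (*-nonNeg 0≤-x 0≤-x)
    where
    0≤-x : 0# ≤ - x
    0≤-x = by x≤0 (solve 1 (λ x → # 0 :+ # 0 := (:- x) :+ x) refl x)

  0≤1 : 0# ≤ 1#
  0≤1 = ≤-resp refl (*-identityˡ 1#) (0≤x² 1#)

  1≰0 : ¬ 1# ≤ 0#
  1≰0 1≤0 = 0≉1 (≤-antisym 0≤1 1≤0)

  0≤num : ∀ n → 0# ≤ num n
  0≤num zero    = ≤-reflexive (sym num-0)
  0≤num (suc n) = ≤-resp (+-identityˡ 0#) (sym (num-suc n)) (+-mono-≤ 0≤1 (0≤num n))

  num-mono : ∀ {m n} → m ℕ.≤ n → num m ≤ num n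
  num-mono {n = n} z≤n = ≤-resp (sym num-0) refl (0≤num n)
  num-mono (s≤s m≤n) = ≤-resp (sym (num-suc _)) (sym (num-suc _)) (+-mono-≤ ≤-refl (num-mono m≤n))

  1≤num : ∀ n → .{{NonZero n}} → 1# ≤ num n
  1≤num (suc n) = ≤-resp num-1 refl (num-mono {1} {suc n} (s≤s z≤n))

  num≰0 : ∀ n → .{{NonZero n}} → ¬ num n ≤ 0#
  num≰0 n n≤0 = 1≰0 (≤-trans (1≤num n) n≤0)

  ≰0⇒≉0 : ∀ {x} → ¬ x ≤ 0# → ¬ x ≈ 0#
  ≰0⇒≉0 x≰0 x≈0 = x≰0 (≤-reflexive x≈0)

  *-inverseʳ : ∀ {x} → ¬ x ≈ 0# → x * x ⁻¹ ≈ 1#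
  *-inverseʳ {x} x≉0 with em {x ≈ 0#}
  ... | yes x≈0  = contradiction x≈0 x≉0
  ... | no  x≉0′ = proj₂ (inverse x x≉0′)

  *-monoʳ-≤ : ∀ {c x y} → 0# ≤ c → x ≤ y → x * c ≤ y * c
  *-monoʳ-≤ {c} {x} {y} 0≤c x≤y = ≤-resp (*-comm c x) (*-comm c y) (*-monoˡ-≤ 0≤c x≤y)

  *-mono-≤ : ∀ {a b x y} → 0# ≤ a → 0# ≤ y → a ≤ b → x ≤ y → a * x ≤ b * y
  *-mono-≤ 0≤a 0≤y a≤b x≤y = ≤-trans (*-monoˡ-≤ 0≤a x≤y) (*-monoʳ-≤ 0≤y a≤b)

  *-cancelˡ-≈ : ∀ {c x y} → ¬ c ≈ 0# → c * x ≈ c * y → x ≈ y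
  *-cancelˡ-≈ {c} {x} {y} c≉0 eq = trans (sym (undo x)) (trans (*-congˡ eq) (undo y))
    where
    undo : ∀ x → c ⁻¹ * (c * x) ≈ x
    undo x = trans (solve 3 (λ i c x → i :* (c :* x) := c :* i :* x) refl (c ⁻¹) c x)
                   (trans (*-congʳ (*-inverseʳ c≉0)) (*-identityˡ x))

  *-cancelˡ-≤ : ∀ {c x y} → ¬ c ≤ 0# → c * x ≤ c * y → x ≤ y
  *-cancelˡ-≤ {c} {x} {y} c≰0 cx≤cy with ≤-total x y
  ... | inj₁ x≤y = x≤y
  ... | inj₂ y≤x = ≤-reflexive (*-cancelˡ-≈ (≰0⇒≉0 c≰0)
                     (≤-antisym cx≤cy (*-monoˡ-≤ (≰⇒≥ c≰0) y≤x)))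

  *-≰0 : ∀ {x y} → ¬ x ≤ 0# → ¬ y ≤ 0# → ¬ x * y ≤ 0#
  *-≰0 {x} {y} x≰0 y≰0 xy≤0 = y≰0 (*-cancelˡ-≤ x≰0 (≤-resp refl (sym (zeroʳ x)) xy≤0))

  ⁻¹≰0 : ∀ {x} → ¬ x ≤ 0# → ¬ x ⁻¹ ≤ 0#
  ⁻¹≰0 {x} x≰0 x⁻¹≤0 = 1≰0 (≤-resp (*-inverseʳ (≰0⇒≉0 x≰0)) (zeroʳ x) (*-monoˡ-≤ (≰⇒≥ x≰0) x⁻¹≤0))

  -- If no natural reached `x`, the naturals would have a supremum `s`; as `N + 1 ≤ s` for every
  -- `N`, `s - 1` would be a smaller upper bound.
  archimedean : ∀ x → ∃ λ N → x ≤ num N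
  archimedean x with em {∃ λ N → x ≤ num N}
  ... | yes p = p
  ... | no ¬p = ⊥-elim (1≰0 (by s≤s-1 (solve 1 (λ s → # 1 :+ (s :- # 1) := # 0 :+ s) refl s)))
    where
    Nat : Carrier → Set
    Nat y = ∃ λ N → y ≈ num N
    sup = supremum Nat (0# , 0 , sym num-0)
            (x , λ { y (N , y≈N) → ≤-trans (≤-reflexive y≈N) (≰⇒≥ λ x≤N → ¬p (N , x≤N)) })
    s = proj₁ sup
    s≤s-1 : s ≤ s - 1#
    s≤s-1 = proj₂ (proj₂ sup) (s - 1#) λ { y (N , y≈N) →
      by (proj₁ (proj₂ sup) (num (suc N)) (suc N , refl))
         (trans (+-congʳ y≈N) (trans (solve 2 (λ n s → n :+ s := (s :- # 1) :+ (# 1 :+ n)) refl (num N) s)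
                (+-congˡ (sym (num-suc N))))) }

  -- Finite sums and indicator functions

  ∑ : ℕ → (ℕ → Carrier) → Carrier
  ∑ zero    f = 0#
  ∑ (suc n) f = ∑ n f + f n

  ∑-cong : ∀ n {f g} → (∀ i → i ℕ.< n → f i ≈ g i) → ∑ n f ≈ ∑ n g
  ∑-cong zero    f≈g = refl
  ∑-cong (suc n) f≈g = +-cong (∑-cong n λ i i<n → f≈g i (ℕ.m<n⇒m<1+n i<n)) (f≈g n (ℕ.n<1+n n))

  ∑-mono : ∀ n {f g} → (∀ i → i ℕ.< n → f i ≤ g i) → ∑ n f ≤ ∑ n g
  ∑-mono zero    f≤g = ≤-refl
  ∑-mono (suc n) f≤g = +-mono-≤ (∑-mono n λ i i<n → f≤g i (ℕ.m<n⇒m<1+n i<n)) (f≤g n (ℕ.n<1+n n))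

  ∑-+ : ∀ n f g → ∑ n (λ i → f i + g i) ≈ ∑ n f + ∑ n g
  ∑-+ zero    f g = sym (+-identityˡ 0#)
  ∑-+ (suc n) f g = trans (+-congʳ (∑-+ n f g))
    (solve 4 (λ a b c d → a :+ b :+ (c :+ d) := a :+ c :+ (b :+ d)) refl (∑ n f) (∑ n g) (f n) (g n))

  ∑-*ˡ : ∀ n c f → ∑ n (λ i → c * f i) ≈ c * ∑ n f
  ∑-*ˡ zero    c f = sym (zeroʳ c)
  ∑-*ˡ (suc n) c f = trans (+-congʳ (∑-*ˡ n c f)) (sym (distribˡ c _ _))

  ∑-neg : ∀ n f → ∑ n (λ i → - f i) ≈ - ∑ n f
  ∑-neg zero    f = sym -0#≈0#
  ∑-neg (suc n) f = trans (+-congʳ (∑-neg n f)) (-‿+-comm _ _)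

  ∑-sub : ∀ n f g → ∑ n (λ i → f i - g i) ≈ ∑ n f - ∑ n g
  ∑-sub n f g = trans (∑-+ n f (λ i → - g i)) (+-congˡ (∑-neg n g))

  ∑-0 : ∀ n → ∑ n (λ _ → 0#) ≈ 0#
  ∑-0 zero    = refl
  ∑-0 (suc n) = trans (+-identityʳ _) (∑-0 n)

  ∑-const : ∀ n c → ∑ n (λ _ → c) ≈ num n * c
  ∑-const zero    c = sym (trans (*-congʳ num-0) (zeroˡ c))
  ∑-const (suc n) c = trans (+-congʳ (∑-const n c)) (trans
    (solve 2 (λ n c → n :* c :+ c := (# 1 :+ n) :* c) refl (num n) c) (*-congʳ (sym (num-suc n))))

  ∑-swap : ∀ m n (f : ℕ → ℕ → Carrier) → ∑ m (λ i → ∑ n (f i)) ≈ ∑ n (λ j → ∑ m (λ i → f i j))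
  ∑-swap zero    n f = sym (∑-0 n)
  ∑-swap (suc m) n f = trans (+-congʳ (∑-swap m n f)) (sym (∑-+ n (λ j → ∑ m (λ i → f i j)) (f m)))

  ∑-nonneg : ∀ n {f} → (∀ i → i ℕ.< n → 0# ≤ f i) → 0# ≤ ∑ n f
  ∑-nonneg n 0≤f = ≤-resp (∑-0 n) refl (∑-mono n 0≤f)

  ∑-head : ∀ n f → ∑ (suc n) f ≈ f 0 + ∑ n (f ∘ suc)
  ∑-head zero    f = +-comm _ _
  ∑-head (suc n) f = trans (+-congʳ (∑-head n f)) (+-assoc _ _ _)

  term≤∑ : ∀ n {f} → (∀ i → i ℕ.< n → 0# ≤ f i) → ∀ {j} → j ℕ.< n → f j ≤ ∑ n f
  term≤∑ (suc n) {f} 0≤f {j} j<1+n with j ℕ.≟ n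
  ... | yes ≡.refl = by (∑-nonneg n λ i i<n → 0≤f i (ℕ.m<n⇒m<1+n i<n))
                        (trans (+-comm (f n) (∑ n f)) (sym (+-identityʳ _)))
  ... | no j≢n = by (+-mono-≤ (0≤f n (ℕ.n<1+n n))
                       (term≤∑ n (λ i i<n → 0≤f i (ℕ.m<n⇒m<1+n i<n)) (ℕ.≤∧≢⇒< (ℕ.≤-pred j<1+n) j≢n)))
                    (solve 3 (λ a b s → a :+ (b :+ s) := s :+ b :+ (# 0 :+ a)) refl (f j) (f n) (∑ n f))

  two-terms≤∑ : ∀ n {f} → (∀ i → i ℕ.< n → 0# ≤ f i) →
                ∀ {j k} → j ℕ.< k → k ℕ.< n → f j + f k ≤ ∑ n f
  two-terms≤∑ (suc n) {f} 0≤f {j} {k} j<k k<1+n with k ℕ.≟ n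
  ... | yes ≡.refl = +-mono-≤ (term≤∑ n (λ i i<n → 0≤f i (ℕ.m<n⇒m<1+n i<n)) j<k) ≤-refl
  ... | no k≢n = by (+-mono-≤ (0≤f n (ℕ.n<1+n n))
                       (two-terms≤∑ n (λ i i<n → 0≤f i (ℕ.m<n⇒m<1+n i<n)) j<k (ℕ.≤∧≢⇒< (ℕ.≤-pred k<1+n) k≢n)))
                    (solve 3 (λ a b s → a :+ (b :+ s) := s :+ b :+ (# 0 :+ a)) refl (f j + f k) (f n) (∑ n f))

  sum≈∑ : ∀ n (f : Fin n → Carrier) (g : ℕ → Carrier) → (∀ i → f i ≈ g (toℕ i)) → sum f ≈ ∑ n g
  sum≈∑ zero    f g f≈g = refl
  sum≈∑ (suc n) f g f≈g = trans
    (+-cong (f≈g Fin.zero) (sum≈∑ n (f ∘ Fin.suc) (g ∘ suc) (f≈g ∘ Fin.suc))) (sym (∑-head n g))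

  χ : Set → Carrier
  χ P with em {P}
  ... | yes _ = 1#
  ... | no  _ = 0#

  χ-yes : ∀ {P} → P → χ P ≈ 1#
  χ-yes {P} p with em {P}
  ... | yes _ = refl
  ... | no ¬p = contradiction p ¬p

  χ-no : ∀ {P} → ¬ P → χ P ≈ 0#
  χ-no {P} ¬p with em {P}
  ... | yes p = contradiction p ¬p
  ... | no _  = refl

  0≤χ : ∀ P → 0# ≤ χ P
  0≤χ P with em {P}
  ... | yes _ = 0≤1
  ... | no  _ = ≤-refl

  -- The way disjointness enters the charging argument: what has at most one owner contributes at
  -- most 1 to a sum over all possible owners.
  ∑χ≤1 : ∀ n (P : ℕ → Set) → (∀ i j → i ℕ.< n → j ℕ.< n → P i → P j → i ≡ j) → ∑ n (χ ∘ P) ≤ 1#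
  ∑χ≤1 zero    P unique = 0≤1
  ∑χ≤1 (suc n) P unique with em {P n}
  ... | yes Pn = ≤-reflexive (trans (+-congʳ (trans (∑-cong n λ i i<n → χ-no λ Pi → ℕ.<⇒≢ i<n
                   (unique i n (ℕ.m<n⇒m<1+n i<n) (ℕ.n<1+n n) Pi Pn)) (∑-0 n))) (+-identityˡ 1#))
  ... | no ¬Pn = ≤-resp (sym (+-identityʳ _)) refl
                   (∑χ≤1 n P λ i j i<n j<n → unique i j (ℕ.m<n⇒m<1+n i<n) (ℕ.m<n⇒m<1+n j<n))

-- Partial sums of the exponential series and the number of greedy steps

module Exponential (em : ExcludedMiddle 0ℓ) (ℝ : Reals) where

  open KMeans em ℝ hiding (pc; N; R)
  open OrderedField em ℝ
  open Solver using (solve; _:=_; _:+_; _:*_; _:-_; :-_)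
  open SemiringExp semiring using (^-congˡ)
  open CommutativeSemiringExp commutativeSemiring using (^-distrib-*)

  0≤^ : ∀ {x} i → 0# ≤ x → 0# ≤ x ^ i
  0≤^ zero    0≤x = 0≤1
  0≤^ (suc i) 0≤x = *-nonNeg 0≤x (0≤^ i 0≤x)

  ^-mono-≤ : ∀ {x y} i → 0# ≤ x → x ≤ y → x ^ i ≤ y ^ i
  ^-mono-≤ zero    0≤x x≤y = ≤-refl
  ^-mono-≤ (suc i) 0≤x x≤y = *-mono-≤ 0≤x (0≤^ i (≤-trans 0≤x x≤y)) x≤y (^-mono-≤ i 0≤x x≤y)

  1^ : ∀ i → 1# ^ i ≈ 1#
  1^ zero    = refl
  1^ (suc i) = trans (*-identityˡ _) (1^ i)

  num-^ : ∀ m i → num m ^ i ≈ num (m ℕ.^ i)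
  num-^ m zero    = sym num-1
  num-^ m (suc i) = trans (*-congˡ (num-^ m i)) (sym (num-* m (m ℕ.^ i)))

  -- With `^-lower`, the mean value bounds for a power, the derivative being taken at the right and
  -- at the left end. Divided by a factorial they become the termwise form of `exp′ = exp`.
  ^-upper : ∀ {l x} i → 0# ≤ l → 0# ≤ x →
            (l + x) ^ suc i ≤ l ^ suc i + num (suc i) * (x * (l + x) ^ i)
  ^-upper {l} {x} zero 0≤l 0≤x = ≤-reflexive (trans
    (solve 2 (λ l x → (l :+ x) :* # 1 := l :* # 1 :+ # 1 :* (x :* # 1)) refl l x)
    (+-congˡ (*-congʳ (sym num-1))))
  ^-upper {l} {x} (suc i) 0≤l 0≤x =
    by (+-mono-≤ (*-monoˡ-≤ 0≤l (^-upper i 0≤l 0≤x))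
        (*-monoˡ-≤ (0≤num (suc i)) (*-nonNeg 0≤x (*-nonNeg 0≤x
        (0≤^ i (≤-resp (+-identityʳ 0#) refl (+-mono-≤ 0≤l 0≤x)))))))
       (trans (solve 5 (λ l x B C n → (l :+ x) :* ((l :+ x) :* B) :+
           (l :* (l :* C :+ n :* (x :* B)) :+ n :* (x :* (x :* B)))
                    := (l :* (l :* C) :+ (# 1 :+ n) :* (x :* ((l :+ x) :* B))) :+ (l :* ((l :+ x) :* B) :+ n :* # 0))
                    refl l x ((l + x) ^ i) (l ^ i) (num (suc i)))
              (+-congʳ (+-congˡ (*-congʳ (sym (num-suc (suc i)))))))

  ^-lower : ∀ {l x} i → 0# ≤ l → 0# ≤ x →
            l ^ suc i + num (suc i) * (x * l ^ i) ≤ (l + x) ^ suc i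
  ^-lower {l} {x} zero 0≤l 0≤x = ≤-reflexive (sym (trans
    (solve 2 (λ l x → (l :+ x) :* # 1 := l :* # 1 :+ # 1 :* (x :* # 1)) refl l x)
    (+-congˡ (*-congʳ (sym num-1)))))
  ^-lower {l} {x} (suc i) 0≤l 0≤x =
    by (+-mono-≤ (*-monoˡ-≤ (≤-resp (+-identityʳ 0#) refl (+-mono-≤ 0≤l 0≤x)) (^-lower i 0≤l 0≤x))
                 (*-monoˡ-≤ (0≤num (suc i)) (*-nonNeg 0≤x (*-nonNeg 0≤x (0≤^ i 0≤l)))))
       (trans (+-congʳ (+-congˡ (*-congʳ (num-suc (suc i)))))
        (solve 5 (λ l x B C n → (l :* (l :* C) :+ (# 1 :+ n) :* (x :* (l :* C))) :+
            ((l :+ x) :* ((l :+ x) :* B) :+ n :* (x :* (x :* C)))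
                    := (l :+ x) :* ((l :+ x) :* B) :+ ((l :+ x) :* (l :* C :+ n :* (x :* C)) :+ n :* # 0))
                    refl l x ((l + x) ^ i) (l ^ i) (num (suc i))))

  fact⁻¹ : ℕ → Carrier
  fact⁻¹ i = fromℕ (i !) ⁻¹

  private
    fact≰0 : ∀ i → ¬ num (i !) ≤ 0#
    fact≰0 i = num≰0 (i !) {{i ℕ.!≢0}}

    fact-inverse : ∀ i → num (i !) * fact⁻¹ i ≈ 1#
    fact-inverse i rewrite ≡.sym (num≡fromℕ (i !)) = *-inverseʳ (≰0⇒≉0 (fact≰0 i))

  0≤fact⁻¹ : ∀ i → 0# ≤ fact⁻¹ i
  0≤fact⁻¹ i rewrite ≡.sym (num≡fromℕ (i !)) = ≰⇒≥ (⁻¹≰0 (fact≰0 i))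

  fact⁻¹-0 : fact⁻¹ 0 ≈ 1#
  fact⁻¹-0 = trans (sym (*-identityˡ _)) (trans (*-congʳ (sym num-1)) (fact-inverse 0))

  fact⁻¹-suc : ∀ i → num (suc i) * fact⁻¹ (suc i) ≈ fact⁻¹ i
  fact⁻¹-suc i = *-cancelˡ-≈ (≰0⇒≉0 (fact≰0 i)) (begin
    num (i !) * (num (suc i) * fact⁻¹ (suc i)) ≈⟨ solve 3 (λ a b c → a :* (b :* c) := b :* a :* c) refl (num (i !))
        (num (suc i)) (fact⁻¹ (suc i)) ⟩
    num (suc i) * num (i !) * fact⁻¹ (suc i)   ≈⟨ *-congʳ (sym (num-* (suc i) (i !))) ⟩
    num (suc i !) * fact⁻¹ (suc i)             ≈⟨ fact-inverse (suc i) ⟩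
    1#                                         ≈⟨ sym (fact-inverse i) ⟩
    num (i !) * fact⁻¹ i                       ∎)
    where open SetoidReasoning setoid

  term : Carrier → ℕ → Carrier
  term x i = x ^ i * fact⁻¹ i

  E : ℕ → Carrier → Carrier
  E m x = ∑ m (term x)

  expPartialSum≈E : ∀ x m → expPartialSum x m ≈ E m x
  expPartialSum≈E x m = sum≈∑ m _ (term x) (λ i → refl)

  0≤term : ∀ {x} i → 0# ≤ x → 0# ≤ term x i
  0≤term i 0≤x = *-nonNeg (0≤^ i 0≤x) (0≤fact⁻¹ i)

  term-0 : ∀ x → term x 0 ≈ 1#
  term-0 x = trans (*-identityˡ _) fact⁻¹-0

  E-cong : ∀ m {x y} → x ≈ y → E m x ≈ E m y
  E-cong m x≈y = ∑-cong m λ i _ → *-congʳ (^-congˡ i x≈y)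

  0≤E : ∀ {x} m → 0# ≤ x → 0# ≤ E m x
  0≤E m 0≤x = ∑-nonneg m λ i _ → 0≤term i 0≤x

  E-mono : ∀ {x y} m → 0# ≤ x → x ≤ y → E m x ≤ E m y
  E-mono m 0≤x x≤y = ∑-mono m λ i _ → *-monoʳ-≤ (0≤fact⁻¹ i) (^-mono-≤ i 0≤x x≤y)

  E-suc : ∀ {x} m → 0# ≤ x → E m x ≤ E (suc m) x
  E-suc {x} m 0≤x = 0≤-by (0≤term m 0≤x) refl

  term-upper : ∀ {l x} i → 0# ≤ l → 0# ≤ x → term (l + x) (suc i) ≤ term l (suc i) + x * term (l + x) i
  term-upper {l} {x} i 0≤l 0≤x = ≤-resp refl (trans
    (solve 5 (λ a n x p f → (a :+ n :* (x :* p)) :* f := a :* f :+ x :* (p :* (n :* f))) refl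
       (l ^ suc i) (num (suc i)) x ((l + x) ^ i) (fact⁻¹ (suc i)))
    (+-congˡ (*-congˡ (*-congˡ (fact⁻¹-suc i))))) (*-monoʳ-≤ (0≤fact⁻¹ (suc i)) (^-upper i 0≤l 0≤x))

  term-lower : ∀ {l x} i → 0# ≤ l → 0# ≤ x → term l (suc i) + x * term l i ≤ term (l + x) (suc i)
  term-lower {l} {x} i 0≤l 0≤x = ≤-resp (trans
    (solve 5 (λ a n x p f → (a :+ n :* (x :* p)) :* f := a :* f :+ x :* (p :* (n :* f))) refl
       (l ^ suc i) (num (suc i)) x (l ^ i) (fact⁻¹ (suc i)))
    (+-congˡ (*-congˡ (*-congˡ (fact⁻¹-suc i))))) refl (*-monoʳ-≤ (0≤fact⁻¹ (suc i)) (^-lower i 0≤l 0≤x))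

  -- The counterpart of `1 - x ≤ exp (-x)`: over an interval of length `x` a partial sum increases
  -- by at most `x` times the preceding partial sum at the right end.
  E-upper : ∀ {l x} m → 0# ≤ l → 0# ≤ x → (1# - x) * E m (l + x) ≤ E m l
  E-upper zero 0≤l 0≤x = ≤-reflexive (zeroʳ _)
  E-upper {l} {x} (suc m) 0≤l 0≤x = by (+-mono-≤ sums
      (*-monoˡ-≤ 0≤x (E-suc m (≤-resp (+-identityʳ 0#) refl (+-mono-≤ 0≤l 0≤x)))))
    (solve 4 (λ x a l b → (# 1 :- x) :* a :+ ((l :+ x :* b) :+ x :* a) := l :+ (a :+ x :* b)) refl x
        (E (suc m) (l + x)) (E (suc m) l) (E m (l + x)))
    where
    head : ∀ y → 1# + ∑ m (term y ∘ suc) ≈ E (suc m) y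
    head y = trans (+-congʳ (sym (term-0 y))) (sym (∑-head m (term y)))
    sums : E (suc m) (l + x) ≤ E (suc m) l + x * E m (l + x)
    sums = ≤-resp (head _) (trans (+-congˡ (trans (∑-+ m _ _) (+-congˡ (∑-*ˡ m x _))))
        (trans (sym (+-assoc _ _ _)) (+-congʳ (head _))))
             (+-mono-≤ (≤-refl {1#}) (∑-mono m λ i _ → term-upper i 0≤l 0≤x))

  -- The counterpart of `2 ≤ exp 1`. The length grows by one because the increment of each term is
  -- bounded below by the term before it.
  E-double : ∀ {l} m → 0# ≤ l → num 2 * E m l ≤ E (suc m) (l + 1#)
  E-double {l} m 0≤l = ≤-trans
    (by (E-suc m 0≤l) (solve 2 (λ a b → # 2 :* a :+ b := (b :+ a) :+ a) refl (E m l) (E (suc m) l)))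
    (≤-resp (trans (+-congˡ (∑-+ m _ _)) (trans (sym (+-assoc _ _ _))
        (+-cong (trans (+-congʳ (sym (term-0 l))) (sym (∑-head m (term l)))) (trans (∑-*ˡ m 1# _) (*-identityˡ _)))))
      (trans (+-congʳ (sym (term-0 (l + 1#)))) (sym (∑-head m _)))
      (+-mono-≤ (≤-refl {1#}) (∑-mono m λ i _ → term-lower i 0≤l 0≤1)))

  -- Trades a factor `2 ^ a` for an increase of the exponent by `a`; with `a = 34` it absorbs the
  -- factor `4 K = 2³⁴` of the stopping test.
  E-double-^ : ∀ {l} m a → 0# ≤ l → num 2 ^ a * E m l ≤ E (a ℕ.+ m) (num a + l)
  E-double-^ {l} m zero 0≤l = ≤-reflexive (trans (*-identityˡ _)
      (E-cong m (trans (sym (+-identityˡ l)) (+-congʳ (sym num-0)))))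
  E-double-^ {l} m (suc a) 0≤l = ≤-trans
    (≤-resp (sym (*-assoc _ _ _)) refl (*-monoˡ-≤ (0≤num 2) (E-double-^ m a 0≤l)))
    (≤-resp refl (E-cong (suc a ℕ.+ m) (trans (solve 2 (λ a l → a :+ l :+ # 1 := # 1 :+ a :+ l) refl (num a) l)
        (+-congʳ (sym (num-suc a)))))
      (E-double (a ℕ.+ m) (≤-resp (+-identityʳ 0#) refl (+-mono-≤ (0≤num a) 0≤l))))

  E-0 : ∀ m {x} → x ≈ 0# → E m x ≤ 1#
  E-0 zero    x≈0 = 0≤1
  E-0 (suc m) {x} x≈0 = ≤-reflexive (trans (∑-head m _)
      (trans (+-cong (term-0 x) (trans (∑-cong m {g = λ _ → 0#} λ i _ →
    trans (*-congʳ (trans (*-congʳ x≈0) (zeroˡ _))) (zeroˡ _)) (∑-0 m))) (+-identityʳ 1#)))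

  -- Each factor `1 - x` pays, by `E-upper`, for moving the argument down by `x`, until `E m 0 ≤ 1`
  -- is reached.
  E-power : ∀ {x} m T → 0# ≤ x → x ≤ 1# → (1# - x) ^ T * E m (num T * x) ≤ 1#
  E-power {x} m zero 0≤x x≤1 = ≤-resp (sym (*-identityˡ _)) refl (E-0 m (trans (*-congʳ num-0) (zeroˡ x)))
  E-power {x} m (suc T) 0≤x x≤1 = ≤-trans (≤-resp
      (trans (solve 3 (λ a b c → b :* (a :* c) := a :* b :* c) refl (1# - x) ((1# - x) ^ T) (E m (num T * x + x)))
        (*-congˡ (E-cong m (trans (solve 2 (λ t x → t :* x :+ x := (# 1 :+ t) :* x) refl (num T) x)
            (*-congʳ (sym (num-suc T)))))))
      refl (*-monoˡ-≤ (0≤^ T (sub-nonneg x≤1)) (E-upper m (*-nonNeg (0≤num T) 0≤x) 0≤x)))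
    (E-power m T 0≤x x≤1)

  limit≤ : ∀ {s y b} M₀ → s ⟶ y → (∀ m → M₀ ℕ.≤ m → s m ≤ b) → y ≤ b
  limit≤ {s} {y} {b} M₀ s⟶y s≤b with em {y ≤ b}
  ... | yes y≤b = y≤b
  ... | no  y≰b = contradiction (≤-antisym (proj₁ near) (≤-resp refl b≈ (s≤b m (ℕ.m≤m⊔n M₀ _)))) (proj₂ near)
    where
    0<y-b : 0# < y - b
    0<y-b = sub-nonneg (≰⇒≥ y≰b) , λ 0≈ → y≰b (≤-reflexive
        (trans (solve 2 (λ y b → y := (y :- b) :+ b) refl y b) (trans (+-congʳ (sym 0≈)) (+-identityˡ b))))
    M = s⟶y (y - b) 0<y-b
    m = M₀ ℕ.⊔ proj₁ M
    near : y - (y - b) < s m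
    near = proj₁ (proj₂ M m (ℕ.m≤n⊔m M₀ _))
    b≈ : b ≈ y - (y - b)
    b≈ = solve 2 (λ y b → b := y :- (y :- b)) refl y b

  -- The coefficients of (1 + h x)ᴺ.
  coeff : Carrier → ℕ → ℕ → Carrier
  coeff h zero    zero    = 1#
  coeff h zero    (suc i) = 0#
  coeff h (suc N) zero    = 1#
  coeff h (suc N) (suc i) = coeff h N (suc i) + h * coeff h N i

  coeff-0 : ∀ h N → coeff h N 0 ≈ 1#
  coeff-0 h zero    = refl
  coeff-0 h (suc N) = refl

  coeff-> : ∀ h N i → N ℕ.< i → coeff h N i ≈ 0#
  coeff-> h zero    (suc i) _ = refl
  coeff-> h (suc N) (suc i) (s≤s N<i) = trans
    (+-cong (coeff-> h N (suc i) (ℕ.m<n⇒m<1+n N<i)) (trans (*-congˡ (coeff-> h N i N<i)) (zeroʳ h))) (+-identityʳ 0#)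

  -- The coefficients follow Pascal's rule, and `term-lower` says that the terms of the exponential
  -- series grow at least as fast along it.
  coeff≤term : ∀ {h} N i → 0# ≤ h → coeff h N i ≤ term (num N * h) i
  coeff≤term {h} N zero 0≤h = ≤-reflexive (trans (coeff-0 h N) (sym (term-0 (num N * h))))
  coeff≤term zero (suc i) 0≤h = 0≤term (suc i) (*-nonNeg (0≤num 0) 0≤h)
  coeff≤term {h} (suc N) (suc i) 0≤h = ≤-trans
    (+-mono-≤ (coeff≤term N (suc i) 0≤h) (*-monoˡ-≤ 0≤h (coeff≤term N i 0≤h)))
    (≤-resp refl (*-congʳ (^-congˡ (suc i) (trans (solve 2 (λ t x → t :* x :+ x := (# 1 :+ t) :* x) refl (num N) h)
        (*-congʳ (sym (num-suc N))))))
      (term-lower i (*-nonNeg (0≤num N) 0≤h) 0≤h))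

  ∑coeff : ∀ h x N m → N ℕ.< m → ∑ m (λ i → coeff h N i * x ^ i) ≈ (1# + h * x) ^ N
  ∑coeff h x zero (suc m) _ = trans (∑-head m _) (trans (+-cong (*-identityˡ 1#)
    (trans (∑-cong m {g = λ _ → 0#} λ i _ → zeroˡ _) (∑-0 m))) (+-identityʳ 1#))
  ∑coeff h x (suc N) (suc m) (s≤s N<m) = begin
    ∑ (suc m) (λ i → coeff h (suc N) i * x ^ i)  ≈⟨ ∑-head m _ ⟩
    1# * 1# + ∑ m (λ i → (b (suc i) + h * b i) * (x * x ^ i))
      ≈⟨ +-cong (*-congʳ (sym (coeff-0 h N))) (trans (∑-cong m λ i _ → solve 5 (λ b′ b h x p →
            (b′ :+ h :* b) :* (x :* p) := b′ :* (x :* p) :+ (h :* x) :* (b :* p)) refl (b (suc i)) (b i) h x (x ^ i))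
            (trans (∑-+ m _ _) (+-congˡ (∑-*ˡ m (h * x) _)))) ⟩
    b 0 * 1# + (∑ m (λ i → b (suc i) * x ^ suc i) + h * x * ∑ m (λ i → b i * x ^ i))
      ≈⟨ trans (sym (+-assoc _ _ _)) (+-congʳ (sym (∑-head m _))) ⟩
    ∑ (suc m) (λ i → b i * x ^ i) + h * x * ∑ m (λ i → b i * x ^ i)
      ≈⟨ +-cong (∑coeff h x N (suc m) (ℕ.m<n⇒m<1+n N<m)) (*-congˡ (∑coeff h x N m N<m)) ⟩
    (1# + h * x) ^ N + h * x * (1# + h * x) ^ N
      ≈⟨ solve 2 (λ u p → p :+ u :* p := (# 1 :+ u) :* p) refl (h * x) _ ⟩
    (1# + h * x) ^ suc N ∎
    where
    open SetoidReasoning setoid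
    b = coeff h N

  sign≤1 : ∀ i → (- 1#) ^ i ≤ 1# × - 1# ≤ (- 1#) ^ i
  sign≤1 zero = ≤-refl , by (+-mono-≤ 0≤1 0≤1) (solve 0 (:- # 1 :+ (# 1 :+ # 1) := # 1 :+ (# 0 :+ # 0)) refl)
  sign≤1 (suc i) with sign≤1 i
  ... | upper , lower =
    by lower (solve 1 (λ p → (:- # 1) :* p :+ p := # 1 :+ :- # 1) refl ((- 1#) ^ i)) ,
    by upper (solve 1 (λ p → :- # 1 :+ # 1 := (:- # 1) :* p :+ p) refl ((- 1#) ^ i))

  bernoulli : ∀ {u} N → 0# ≤ u → u ≤ 1# → 1# - num N * u ≤ (1# - u) ^ N
  bernoulli {u} zero 0≤u u≤1 = ≤-reflexive (trans (+-congˡ (-‿cong (trans (*-congʳ num-0) (zeroˡ u))))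
    (solve 0 (# 1 :- # 0 := # 1) refl))
  bernoulli {u} (suc N) 0≤u u≤1 = by
    (+-mono-≤ (*-monoˡ-≤ (sub-nonneg u≤1) (bernoulli N 0≤u u≤1)) (*-nonNeg (0≤num N) (0≤x² u)))
    (trans (+-congʳ (+-congˡ (-‿cong (*-congʳ (num-suc N)))))
      (solve 3 (λ u n p → (# 1 :- (# 1 :+ n) :* u) :+ ((# 1 :- u) :* p :+ n :* (u :* u)) :=
                     (# 1 :- u) :* p :+ ((# 1 :- u) :* (# 1 :- n :* u) :+ # 0)) refl u (num N) ((1# - u) ^ N)))

  -- |E(-l) - (1 - h)ᴺ| ≤ E(l) - (1 + h)ᴺ for l = N h, coefficient by coefficient.
  E-negative : ∀ {h} N m → N ℕ.< m → 0# ≤ h → h ≤ 1# →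
               E m (- (num N * h)) ≤ 1# + num N * h * (h * E m (num N * h))
  E-negative {h} N m N<m 0≤h h≤1 = ≤-trans compare bound
    where
    l = num N * h
    0≤l = *-nonNeg (0≤num N) 0≤h
    b = coeff h N
    sgn : ℕ → Carrier
    sgn i = (- 1#) ^ i
    E- : E m (- l) ≈ ∑ m (λ i → sgn i * term l i)
    E- = ∑-cong m λ i _ → trans (*-congʳ (trans (^-congˡ i (solve 1 (λ l → :- l := (:- # 1) :* l) refl l))
        (^-distrib-* _ _ i)))
           (*-assoc _ _ _)
    termwise : ∀ i → sgn i * term l i + b i * 1# ^ i ≤ term l i + b i * sgn i
    termwise i = by (*-monoʳ-≤ (sub-nonneg (coeff≤term N i 0≤h)) (proj₁ (sign≤1 i)))
      (trans (+-congʳ (+-congˡ (*-congˡ (1^ i)))) (solve 3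
          (λ s t b → (s :* t :+ b :* # 1) :+ # 1 :* (t :- b) := (t :+ b :* s) :+ s :* (t :- b)) refl
        (sgn i) (term l i) (b i)))
    both : E m (- l) + (1# + h * 1#) ^ N ≤ E m l + (1# + h * - 1#) ^ N
    both = ≤-resp (trans (∑-+ m _ _) (+-cong (sym E-) (∑coeff h 1# N m N<m)))
                  (trans (∑-+ m _ _) (+-congˡ (∑coeff h (- 1#) N m N<m)))
                  (∑-mono m λ i _ → termwise i)
    1+h = 1# + h * 1#
    1-h = 1# + h * - 1#
    1-h≈ : 1# - h ≈ 1-h
    1-h≈ = solve 1 (λ h → # 1 :- h := # 1 :+ h :* (:- # 1)) refl h
    0≤1+h : 0# ≤ 1+h
    0≤1+h = ≤-resp (+-identityʳ 0#) (+-congˡ (sym (*-identityʳ h))) (+-mono-≤ 0≤1 0≤h)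
    1-h≤1 : 1-h ^ N ≤ 1#
    1-h≤1 = ≤-resp refl (1^ N) (^-mono-≤ N (≤-resp refl 1-h≈ (sub-nonneg h≤1))
      (0≤-by 0≤h (solve 1 (λ h → # 1 :+ h :* (:- # 1) :+ h := # 1) refl h)))
    compare : E m (- l) ≤ 1# + E m l - 1+h ^ N
    compare = by (+-mono-≤ both 1-h≤1) (solve 4 (λ a b c d → a :+ ((b :+ c) :+ # 1) := (# 1 :+ b :- d) :+
        ((a :+ d) :+ c)) refl
                 (E m (- l)) (E m l) (1-h ^ N) (1+h ^ N))
    -- Since `(1 + h)ᴺ (1 - h)ᴺ = (1 - h²)ᴺ`, the bound of `E-power` on `(1 - h)ᴺ` turns into a
    -- lower bound on `(1 + h)ᴺ`; Bernoulli's inequality leaves an error of `N h²` times the partial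
    -- sum.
    squares : (1# - h * h) ^ N * E m l ≤ 1+h ^ N
    squares = ≤-resp (trans (sym (*-assoc _ _ _)) (*-congʳ (trans (sym (^-distrib-* _ _ N))
        (^-congˡ N (solve 1 (λ h → (# 1 :+ h :* # 1) :* (# 1 :- h) := # 1 :- h :* h) refl h)))))
      (*-identityʳ _) (*-monoˡ-≤ (0≤^ N 0≤1+h) (E-power m N 0≤h h≤1))
    h²≤1 : h * h ≤ 1#
    h²≤1 = ≤-resp refl (*-identityˡ 1#) (*-mono-≤ 0≤h 0≤1 h≤1 h≤1)
    bound : 1# + E m l - 1+h ^ N ≤ 1# + l * (h * E m l)
    bound = by (+-mono-≤ squares (*-monoʳ-≤ (0≤E m 0≤l) (bernoulli N (0≤x² h) h²≤1)))
      (solve 5 (λ e n h p q → (# 1 :+ e :- p) :+ (p :+ q :* e) :=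
         (# 1 :+ n :* h :* (h :* e)) :+ (q :* e :+ (# 1 :- n :* (h :* h)) :* e)) refl
         (E m l) (num N) h (1+h ^ N) ((1# - h * h) ^ N))

  ≤-fromNum : ∀ {x y} n → .{{NonZero n}} → num n * x ≤ num n * y → x ≤ y
  ≤-fromNum n = *-cancelˡ-≤ (num≰0 n)

  divide : ∀ x N → .{{NonZero N}} → ∃ λ h → num N * h ≈ x
  divide x N = num N ⁻¹ * x , trans (sym (*-assoc _ _ _))
      (trans (*-congʳ (*-inverseʳ (≰0⇒≉0 (num≰0 N)))) (*-identityˡ x))

  -- A negative `ℓ` makes the series alternate, so it cannot be compared term by term with one at a
  -- larger argument. Instead `-ℓ = N h` is subdivided: by `E-negative` the partial sums exceed 1 by
  -- at most an error that tends to 0 as `N` grows.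
  log≤0⇒≤1 : ∀ {y ℓ} → IsLog y ℓ → ℓ ≤ 0# → y ≤ 1#
  log≤0⇒≤1 {y} {ℓ} log ℓ≤0 with em {y ≤ 1#}
  ... | yes y≤1 = y≤1
  ... | no  y≰1 = contradiction δ≤0 δ≰0
    where
    l = - ℓ
    0≤l : 0# ≤ l
    0≤l = by ℓ≤0 (solve 1 (λ l → # 0 :+ # 0 := :- l :+ l) refl ℓ)
    half = divide (y - 1#) 2
    δ = proj₁ half
    δ≰0 : ¬ δ ≤ 0#
    δ≰0 δ≤0 = y≰1 (by (*-monoˡ-≤ (0≤num 2) δ≤0) (trans (+-congˡ (zeroʳ _)) (trans
      (solve 1 (λ y → y :+ # 0 := # 1 :+ (y :- # 1)) refl y) (+-congˡ (sym (proj₂ half))))))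
    -- A bound `B` on `E m l` that does not depend on `m`: with `l = (N₀ + 1) h₀`, `E-power` gives
    -- `1 / (1 - h₀)^(N₀ + 1)`, and `h₀ ≤ 1/2` keeps the denominator positive.
    N₀ = proj₁ (archimedean (num 2 * l))
    h₀ = proj₁ (divide l (suc N₀))
    eq₀ = proj₂ (divide l (suc N₀))
    0≤h₀ : 0# ≤ h₀
    0≤h₀ = ≤-fromNum (suc N₀) (≤-resp (sym (zeroʳ _)) (sym eq₀) 0≤l)
    2h₀≤1 : num 2 * h₀ ≤ 1#
    2h₀≤1 = ≤-fromNum (suc N₀) (≤-resp (trans (*-congˡ (sym eq₀))
        (solve 2 (λ n h → # 2 :* (n :* h) := n :* (# 2 :* h)) refl _ h₀))
               (sym (*-identityʳ _)) (≤-trans (proj₂ (archimedean (num 2 * l))) (num-mono (ℕ.n≤1+n N₀))))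
    1-h₀≰0 : ¬ 1# - h₀ ≤ 0#
    1-h₀≰0 p = 1≰0 (by (+-mono-≤ 2h₀≤1 (+-mono-≤ p p))
       (solve 1 (λ h → # 1 :+ (# 1 :+ (# 0 :+ # 0)) := # 0 :+ (# 2 :* h :+ ((# 1 :- h) :+ (# 1 :- h)))) refl h₀))
    h₀≤1 : h₀ ≤ 1#
    h₀≤1 = by (≰⇒≥ 1-h₀≰0) (solve 1 (λ h → h :+ (# 1 :- h) := # 1 :+ # 0) refl h₀)
    c = (1# - h₀) ^ suc N₀
    c≰0 : ¬ c ≤ 0#
    c≰0 = pow (suc N₀)
      where
      pow : ∀ i → ¬ (1# - h₀) ^ i ≤ 0#
      pow zero    = 1≰0
      pow (suc i) = *-≰0 1-h₀≰0 (pow i)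
    B = c ⁻¹
    E≤B : ∀ m → E m l ≤ B
    E≤B m = *-cancelˡ-≤ c≰0 (≤-resp (*-congˡ (E-cong m eq₀)) (sym (*-inverseʳ (≰0⇒≉0 c≰0)))
        (E-power m (suc N₀) 0≤h₀ h₀≤1))
    0≤B : 0# ≤ B
    0≤B = ≰⇒≥ (⁻¹≰0 c≰0)
    -- The subdivision must make the error `l (h B)`, where `h = l / N`, at most `δ`, and must also
    -- have `h ≤ 1`.
    arch = archimedean (l * (l * B) * δ ⁻¹)
    arch′ = archimedean l
    N = suc (proj₁ arch ℕ.+ proj₁ arch′)
    h = proj₁ (divide l N)
    eq = proj₂ (divide l N)
    0≤h : 0# ≤ h
    0≤h = ≤-fromNum N (≤-resp (sym (zeroʳ _)) (sym eq) 0≤l)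
    h≤1 : h ≤ 1#
    h≤1 = ≤-fromNum N (≤-resp (sym eq) (sym (*-identityʳ _))
        (≤-trans (proj₂ arch′) (num-mono (ℕ.m≤n⇒m≤1+n (ℕ.m≤n+m _ _)))))
    small : l * (h * B) ≤ δ
    small = ≤-fromNum N (≤-trans (≤-reflexive (trans
        (solve 4 (λ n l h B → n :* (l :* (h :* B)) := l :* (n :* h :* B)) refl (num N) l h B) (*-congˡ (*-congʳ eq))))
      (≤-resp (trans (*-assoc _ _ _) (trans (*-congˡ (trans (*-comm _ _) (*-inverseʳ (≰0⇒≉0 δ≰0))))
          (*-identityʳ _))) refl
        (*-monoʳ-≤ (≰⇒≥ δ≰0) (≤-trans (proj₂ arch) (num-mono (ℕ.m≤n⇒m≤1+n (ℕ.m≤m+n _ _)))))))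
    y≤1+δ : y ≤ 1# + δ
    y≤1+δ = limit≤ (suc N) log λ m N<m → ≤-trans (≤-reflexive (trans (expPartialSum≈E ℓ m)
        (E-cong m (trans (solve 1 (λ l → l := :- (:- l)) refl ℓ) (-‿cong (sym eq))))))
      (≤-trans (E-negative N m N<m 0≤h h≤1) (+-mono-≤ ≤-refl (≤-trans
        (*-mono-≤ (*-nonNeg (0≤num N) 0≤h) (*-nonNeg 0≤h 0≤B) (≤-reflexive eq)
            (*-monoˡ-≤ 0≤h (≤-trans (≤-reflexive (E-cong m eq)) (E≤B m)))) small)))
    δ≤0 : δ ≤ 0#
    δ≤0 = by y≤1+δ (trans (+-congˡ (solve 1 (λ d → # 1 :+ d := # 1 :+ d) refl δ)) (trans
      (solve 1 (λ d → d :+ (# 1 :+ d) := # 0 :+ (# 1 :+ # 2 :* d)) refl δ)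
      (+-congˡ (trans (+-congˡ (proj₂ half)) (solve 1 (λ y → # 1 :+ (y :- # 1) := y) refl y)))))

  -- Here `r` is `1/k`. For a larger `i`, `i r` is at least `a + max(1, ℓ)`, so `E-double-^` and
  -- `E-power` bound the quantity under test times every partial sum at `max(1, ℓ)` by 1. In the
  -- limit this product is at least that quantity divided by `ε`. For `ℓ ≤ 0` the limit is replaced
  -- by `ε ⁻¹ ≤ 1`.
  iterations-bound : ∀ {ε ℓ r} k a i → .{{NonZero k}} → 0# < ε → IsLog (ε ⁻¹) ℓ → num k * r ≈ 1# →
                     ¬ num 2 ^ a * (1# - r) ^ i ≤ ε → num i ≤ num k * (num a + (1# ⊔ ℓ))
  iterations-bound {ε} {ℓ} {r} k a i 0<ε log kr≈1 c≰ε with em {num i ≤ num k * (num a + (1# ⊔ ℓ))}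
  ... | yes i≤ = i≤
  ... | no  i≰ = contradiction c≤ε c≰ε
    where
    c = num 2 ^ a * (1# - r) ^ i
    ε≰0 : ¬ ε ≤ 0#
    ε≰0 ε≤0 = proj₂ 0<ε (≤-antisym (proj₁ 0<ε) ε≤0)
    c≰0 : ¬ c ≤ 0#
    c≰0 c≤0 = c≰ε (≤-trans c≤0 (proj₁ 0<ε))
    ℓ⁺ = 1# ⊔ ℓ
    0≤ℓ⁺ : 0# ≤ ℓ⁺
    0≤ℓ⁺ = ≤-trans 0≤1 (x≤x⊔y 1# ℓ)
    0≤r : 0# ≤ r
    0≤r = ≤-fromNum k (≤-resp (sym (zeroʳ _)) (sym kr≈1) 0≤1)
    r≤1 : r ≤ 1#
    r≤1 = ≤-fromNum k (≤-resp (sym kr≈1) (sym (*-identityʳ _)) (1≤num k))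
    exponent : num a + ℓ⁺ ≤ num i * r
    exponent = ≤-fromNum k (≤-resp refl (trans (sym (*-identityʳ _)) (trans (*-congˡ (sym kr≈1))
      (solve 3 (λ i k r → i :* (k :* r) := k :* (i :* r)) refl (num i) (num k) r))) (≰⇒≥ i≰))
    cE≤1 : ∀ m → c * E m ℓ⁺ ≤ 1#
    cE≤1 m = ≤-trans (≤-reflexive (solve 3 (λ a b c → a :* b :* c := b :* (a :* c)) refl (num 2 ^ a) ((1# - r) ^ i)
        (E m ℓ⁺)))
      (≤-trans (*-monoˡ-≤ (0≤^ i (sub-nonneg r≤1)) (≤-trans (E-double-^ m a 0≤ℓ⁺)
         (E-mono (a ℕ.+ m) (≤-resp (+-identityʳ 0#) refl (+-mono-≤ (0≤num a) 0≤ℓ⁺)) exponent)))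
      (E-power (a ℕ.+ m) i 0≤r r≤1))
    E≤c⁻¹ : ∀ m → E m ℓ⁺ ≤ c ⁻¹
    E≤c⁻¹ m = *-cancelˡ-≤ c≰0 (≤-resp refl (sym (*-inverseʳ (≰0⇒≉0 c≰0))) (cE≤1 m))
    y≤c⁻¹ : ε ⁻¹ ≤ c ⁻¹
    y≤c⁻¹ with ≤-total 0# ℓ
    ... | inj₁ 0≤ℓ = limit≤ 0 log λ m _ → ≤-trans (≤-reflexive (expPartialSum≈E ℓ m))
                       (≤-trans (E-mono m 0≤ℓ (x≤y⊔x 1# ℓ)) (E≤c⁻¹ m))
    ... | inj₂ ℓ≤0 = ≤-trans (log≤0⇒≤1 log ℓ≤0) (≤-resp (trans (+-identityˡ _) (term-0 ℓ⁺)) refl (E≤c⁻¹ 1))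
    c≤ε : c ≤ ε
    c≤ε = ≤-resp (trans (*-assoc _ _ _) (trans (*-congˡ (*-inverseʳ (≰0⇒≉0 ε≰0))) (*-identityʳ c)))
                 (trans (solve 3 (λ c e i → c :* e :* i := e :* (c :* i)) refl c ε (c ⁻¹))
                     (trans (*-congˡ (*-inverseʳ (≰0⇒≉0 c≰0))) (*-identityʳ ε)))
                 (*-monoˡ-≤ (*-nonNeg (≰⇒≥ c≰0) (proj₁ 0<ε)) y≤c⁻¹)

-- Last occurrences

module Latest (em : ExcludedMiddle 0ℓ) where

  -- Awards a contested object (a ball, an optimal centre, a point) to its last claimant, so that no
  -- object is charged twice. The range condition `t < τ` is carried separately.
  IsLatest : ℕ → (ℕ → Set) → ℕ → Set
  IsLatest τ Q t = Q t × ∀ s → t ℕ.< s → s ℕ.< τ → ¬ Q s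

  latest-unique : ∀ {τ Q s t} → s ℕ.< τ → t ℕ.< τ → IsLatest τ Q s → IsLatest τ Q t → s ≡ t
  latest-unique {s = s} {t} s<τ t<τ (Qs , s-last) (Qt , t-last) with ℕ.<-cmp s t
  ... | tri< s<t _ _ = contradiction Qt (s-last t s<t t<τ)
  ... | tri≈ _ s≡t _ = s≡t
  ... | tri> _ _ t<s = contradiction Qs (t-last s t<s s<τ)

  latest : ∀ τ {Q : ℕ → Set} {t} → t ℕ.< τ → Q t → ∃ λ v → t ℕ.≤ v × v ℕ.< τ × IsLatest τ Q v
  latest (suc τ) {Q} {t} t<1+τ Qt with em {Q τ}
  ... | yes QT = τ , ℕ.≤-pred t<1+τ , ℕ.n<1+n τ , QT , λ s τ<s s<1+τ _ → ℕ.<⇒≱ τ<s (ℕ.≤-pred s<1+τ)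
  ... | no ¬QT with t ℕ.≟ τ
  ...   | yes ≡.refl = contradiction Qt ¬QT
  ...   | no t≢τ with latest τ (ℕ.≤∧≢⇒< (ℕ.≤-pred t<1+τ) t≢τ) Qt
  ...     | v , t≤v , v<τ , Qv , v-last = v , t≤v , ℕ.m<n⇒m<1+n v<τ , Qv , last
    where
    last : ∀ s → v ℕ.< s → s ℕ.< suc τ → ¬ Q s
    last s v<s s<1+τ with s ℕ.≟ τ
    ... | yes ≡.refl = ¬QT
    ... | no s≢τ     = v-last s v<s (ℕ.≤∧≢⇒< (ℕ.≤-pred s<1+τ) s≢τ)

-- The forest of balls and the charging argument

module Packing (em : ExcludedMiddle 0ℓ) (ℝ : Reals) where

  open KMeans em ℝ hiding (pc; N; R)
  open OrderedField em ℝ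
  open Latest em
  open Solver using (solve; _:=_; _:+_; _:*_; _:-_; :-_)

  pos : Carrier → Carrier
  pos u = u ⊔ 0#

  0≤pos : ∀ u → 0# ≤ pos u
  0≤pos u = x≤y⊔x u 0#

  -- Opaque, so that no proof of a large numeral inequality is ever unfolded.
  opaque
    num-≤ : ∀ m n {_ : Bool.T (m ℕ.≤ᵇ n)} → num m ≤ num n
    num-≤ m n {m≤n} = num-mono (ℕ.≤ᵇ⇒≤ m n m≤n)

  -- The strongest demand on its size comes from `later-small`, about 10⁸. The value 2³² is five
  -- squarings away from 2 on the machine.
  K : ℕ
  K = 4294967296

  -- The balls tried by the first phase at the times t < τ: x t is the centre and
  -- ρ t the squared radius of the isolated ball, z t the point chosen near it, and
  -- c (a y) the centre serving pt y in the solution compared with.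
  record Run {A : Set} (q : A → A → Carrier) : Set where
    field
      0≤q    : ∀ a b → 0# ≤ q a b
      q-refl : ∀ a → q a a ≈ 0#
      q-sym  : ∀ a b → q a b ≈ q b a
      q-tri  : ∀ a b c → q a c ≤ num 2 * (q a b + q b c)
      n τ κ  : ℕ
      pt x z c : ℕ → A
      a      : ℕ → ℕ
      a<κ    : ∀ y → y ℕ.< n → a y ℕ.< κ
      ρ      : ℕ → Carrier
      U      : Carrier
      0≤ρ    : ∀ t → t ℕ.< τ → 0# ≤ ρ t
      sep    : ∀ s t → s ℕ.< t → t ℕ.< τ → num K * ρ t ≤ q (x t) (z s)
      near   : ∀ t → t ℕ.< τ → q (x t) (z t) ≤ num 1024 * ρ t
      U≰0    : ¬ U ≤ 0#
      value  : ∀ t → t ℕ.< τ → U ≤ ∑ n λ y → pos (ρ t - q (x t) (pt y))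

    M : ℕ → ℕ → Set
    M t y = q (x t) (pt y) ≤ num 256 * ρ t

    field
      median : ∀ t v → t ℕ.< τ → v ℕ.< τ →
               ∑ n (λ y → χ (M t y) * q (z t) (pt y)) ≤ ∑ n (λ y → χ (M t y) * q (x v) (pt y))

  module _ {A : Set} {q : A → A → Carrier} (run : Run q) where
    open Run run

    -- Each constant survives one more doubled triangle inequality: `P₀ = 2 α + 1`, `P = 2 P₀ + 1`
    -- and `β = 2 P + 1`, the extra 1 paying for the smaller of two balls. The source is
    -- `α = 2 · 256 + 550 / 2`, the distance from `x t` to the centre of a cheap far point in
    -- `only-child`.
    α P₀ P β : ℕ
    α  = 787
    P₀ = 1575
    P  = 3151
    β  = 6303

    payment : ℕ → Carrier
    payment y = q (pt y) (c (a y))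

    Child : ℕ → ℕ → Set
    Child t s = IsLatest s (λ u → u ℕ.< s × q (x s) (x u) ≤ num P * ρ u) t

    Private : ℕ → ℕ → Set
    Private t j = IsLatest τ (λ u → q (x u) (c j) ≤ num α * ρ u) t

    Pays : ℕ → ℕ → Set
    Pays t y = IsLatest τ (λ u → M u y) t

    -- Says that `s` is in the subtree of a child `v` of `t`, by its geometric traces: `x s` lies in
    -- a fixed enlargement of the ball of `v` and its radius is no larger.
    UnderChild : ℕ → ℕ → Set
    UnderChild t s = ∃ λ v → v ℕ.≤ s × Child t v × t ℕ.< v × q (x s) (x v) ≤ num β * ρ v × ρ s ≤ ρ v

    children centres payments : ℕ → Carrier
    children t = ∑ τ λ s → χ (Child t s)
    centres  t = ∑ κ λ j → χ (Private t j)
    payments t = ∑ n λ y → χ (Pays t y) * payment y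

    0≤U : 0# ≤ U
    0≤U = ≰⇒≥ U≰0

    0≤payments : ∀ t y → 0# ≤ χ (Pays t y) * payment y
    0≤payments t y = *-nonNeg (0≤χ _) (0≤q _ _)

    ∑children : ∑ τ children ≤ num τ
    ∑children = ≤-trans (≤-reflexive (∑-swap τ τ _)) (≤-trans (∑-mono τ {g = λ _ → 1#} λ s s<τ →
        ∑χ≤1 τ (λ t → Child t s) λ t t′ _ _ ch ch′ → latest-unique (proj₁ (proj₁ ch)) (proj₁ (proj₁ ch′)) ch ch′)
      (≤-reflexive (trans (∑-const τ 1#) (*-identityʳ _))))

    ∑centres : ∑ τ centres ≤ num κ
    ∑centres = ≤-trans (≤-reflexive (∑-swap τ κ _)) (≤-trans (∑-mono κ {g = λ _ → 1#} λ j _ →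
        ∑χ≤1 τ (λ t → Private t j) λ t t′ t<τ t′<τ → latest-unique t<τ t′<τ)
      (≤-reflexive (trans (∑-const κ 1#) (*-identityʳ _))))

    ∑payments : ∑ τ payments ≤ ∑ n payment
    ∑payments = ≤-trans (≤-reflexive (∑-swap τ n _)) (∑-mono n λ y _ →
      ≤-trans (≤-reflexive (trans (∑-cong τ λ t _ → *-comm _ _) (∑-*ˡ τ (payment y) _)))
        (≤-resp refl (*-identityʳ _) (*-monoˡ-≤ (0≤q _ _)
          (∑χ≤1 τ (λ t → Pays t y) λ t t′ t<τ t′<τ → latest-unique t<τ t′<τ))))

    opaque
      shrink : ∀ {r s} a b c .{{_ : NonZero b}} → 0# ≤ r → Bool.T (a ℕ.+ b ℕ.* c ℕ.≤ᵇ K) →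
               num K * r ≤ num a * r + num b * s → num c * r ≤ s
      shrink {r} {s} a b c 0≤r a+bc≤K Kr≤ = *-cancelˡ-≤ (num≰0 b)
        (by (+-mono-≤ (*-monoʳ-≤ 0≤r (num-mono (ℕ.≤ᵇ⇒≤ _ _ a+bc≤K))) Kr≤)
          (trans (solve 6 (λ a b c r s k → b :* (c :* r) :+ (k :* r :+ (a :* r :+ b :* s)) :=
                            b :* s :+ ((a :+ b :* c) :* r :+ k :* r)) refl (num a) (num b) (num c) r s (num K))
            (+-congˡ (+-congʳ (*-congʳ (sym (trans (num-+ a _) (+-congˡ (num-* b c)))))))))

      shrink⁰ : ∀ {r} c → 0# ≤ r → Bool.T (c ℕ.<ᵇ K) → num K * r ≤ num c * r → r ≤ 0#
      shrink⁰ {r} c 0≤r c<K Kr≤cr =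
        by (+-mono-≤ (*-monoʳ-≤ 0≤r (num-mono (ℕ.<ᵇ⇒< c K c<K))) Kr≤cr)
          (trans (solve 3 (λ c r k → r :+ (k :* r :+ c :* r) := # 0 :+ ((# 1 :+ c) :* r :+ k :* r)) refl (num c) r
              (num K))
             (+-congˡ (+-congʳ (*-congʳ (sym (num-suc c))))))

      -- `z t` was already open when `x u` was tried, so `K ρ u ≤ q (x u) (z t) ≤ 2 q (x u) (x t) +
      -- 2048 ρ t`. The boolean hypothesis says that `K` exceeds the coefficients collected in this
      -- way.
      later-small : ∀ {t u} a b c → t ℕ.< u → u ℕ.< τ → Bool.T (2 ℕ.* a ℕ.+ (2048 ℕ.+ 2 ℕ.* b) ℕ.* c ℕ.≤ᵇ K) →
                    q (x u) (x t) ≤ num a * ρ u + num b * ρ t → num c * ρ u ≤ ρ t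
      later-small {t} {u} a b c t<u u<τ fits q≤ =
        shrink (2 ℕ.* a) (2048 ℕ.+ 2 ℕ.* b) c (0≤ρ u u<τ) fits
          (by (+-mono-≤ (sep t u t<u u<τ) (+-mono-≤ (q-tri (x u) (x t) (z t)) (+-mono-≤ (*-monoˡ-≤ (0≤num 2) q≤)
                (*-monoˡ-≤ (0≤num 2) (near t (ℕ.<-trans t<u u<τ))))))
            (trans (solve 8 (λ a b k r s uz ut tz → k :* r :+
                (uz :+ (# 2 :* (ut :+ tz) :+ (# 2 :* (a :* r :+ b :* s) :+ # 2 :* (# 1024 :* s)))) :=
                 (# 2 :* a :* r :+ (# 2048 :+ # 2 :* b) :* s) :+ (k :* r :+ (uz :+ (# 2 :* ut :+ # 2 :* tz))))
                 refl (num a) (num b) (num K) (ρ u) (ρ t) (q (x u) (z t)) (q (x u) (x t)) (q (x t) (z t)))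
               (+-congʳ (+-cong (*-congʳ (sym (num-* 2 a))) (*-congʳ
                   (sym (trans (num-+ 2048 _) (+-congˡ (num-* 2 b)))))))))

    later-≤ : ∀ {t u} c .{{_ : NonZero c}} → u ℕ.< τ → num c * ρ u ≤ ρ t → ρ u ≤ ρ t
    later-≤ {t} {u} c u<τ cρ≤ = ≤-trans (≤-resp (*-identityˡ _) refl (*-monoʳ-≤ (0≤ρ u u<τ) (1≤num c))) cρ≤

    -- Climbs from `s` along parents until the parent is `t`. A parent cannot precede `t`, since
    -- `near-t` makes `t` itself a candidate. The bound `β` does not deteriorate: the radius grows
    -- at least 12606-fold at each step, which pays for the doubled distance accumulated so far.
    descend : ∀ {t s} u → t ℕ.< u → u ℕ.≤ s → s ℕ.< τ → q (x s) (x t) ≤ num P₀ * ρ t →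
              q (x s) (x u) ≤ num β * ρ u → ρ s ≤ ρ u →
              UnderChild t s
    descend {t} {s} = ℕ.<-rec _ step
      where
      step : ∀ u → (∀ {v} → v ℕ.< u → t ℕ.< v → v ℕ.≤ s → s ℕ.< τ → q (x s) (x t) ≤ num P₀ * ρ t →
              q (x s) (x v) ≤ num β * ρ v → ρ s ≤ ρ v →
              UnderChild t s) →
             t ℕ.< u → u ℕ.≤ s → s ℕ.< τ → q (x s) (x t) ≤ num P₀ * ρ t →
             q (x s) (x u) ≤ num β * ρ u → ρ s ≤ ρ u →
             UnderChild t s
      step u rec t<u u≤s s<τ st≤ su≤ ρs≤ρu =
        settle (latest u {λ w → w ℕ.< u × q (x u) (x w) ≤ num P * ρ w} t<u (t<u , near-t))
        where
        u<τ = ℕ.≤-<-trans u≤s s<τ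
        ut≤ : q (x u) (x t) ≤ num 12606 * ρ u + num 3150 * ρ t
        ut≤ = by (+-mono-≤ (q-tri (x u) (x s) (x t)) (+-mono-≤ (*-monoˡ-≤ (0≤num 2) st≤)
            (*-monoˡ-≤ (0≤num 2) (≤-trans (≤-reflexive (q-sym (x u) (x s))) su≤))))
          (solve 5 (λ ut us st ru rt → ut :+ (# 2 :* (us :+ st) :+ (# 2 :* (# 1575 :* rt) :+ # 2 :* (# 6303 :* ru))) :=
            (# 12606 :* ru :+ # 3150 :* rt) :+ (ut :+ (# 2 :* st :+ # 2 :* us))) refl
            (q (x u) (x t)) (q (x u) (x s)) (q (x s) (x t)) (ρ u) (ρ t))
        near-t : q (x u) (x t) ≤ num P * ρ t
        near-t = by (+-mono-≤ ut≤ (later-small 12606 3150 12606 t<u u<τ _ ut≤))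
          (solve 3 (λ ut ru rt → ut :+ ((# 12606 :* ru :+ # 3150 :* rt) :+ rt) := # 3151 :* rt :+ (ut :+ # 12606 :* ru))
             refl (q (x u) (x t)) (ρ u) (ρ t))
        settle : (∃ λ v → t ℕ.≤ v × v ℕ.< u × Child v u) →
               UnderChild t s
        settle (v , t≤v , v<u , latest-v) with t ℕ.≟ v
        ... | yes ≡.refl = u , u≤s , latest-v , t<u , su≤ , ρs≤ρu
        ... | no t≢v = rec v<u (ℕ.≤∧≢⇒< t≤v t≢v) (ℕ.≤-trans (ℕ.<⇒≤ v<u) u≤s) s<τ st≤
          (by (+-mono-≤ (q-tri (x s) (x u) (x v)) (+-mono-≤ (*-monoˡ-≤ (0≤num 2) su≤)
              (+-mono-≤ (*-monoˡ-≤ (0≤num 2) uv≤) small)))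
            (solve 5 (λ sv su uv ru rv → sv :+ (# 2 :* (su :+ uv) :+
                (# 2 :* (# 6303 :* ru) :+ (# 2 :* (# 3151 :* rv) :+ rv))) :=
               # 6303 :* rv :+ (sv :+ (# 2 :* su :+ (# 2 :* uv :+ # 12606 :* ru)))) refl
               (q (x s) (x v)) (q (x s) (x u)) (q (x u) (x v)) (ρ u) (ρ v)))
          (≤-trans ρs≤ρu (later-≤ 12606 u<τ small))
          where
          uv≤ : q (x u) (x v) ≤ num P * ρ v
          uv≤ = proj₂ (proj₁ latest-v)
          small : num 12606 * ρ u ≤ ρ v
          small = later-small 0 3151 12606 v<u u<τ _
            (≤-resp refl (solve 2 (λ u v → # 3151 :* v := # 0 :* u :+ # 3151 :* v) refl (ρ u) (ρ v) ⟨ trans ⟩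
                +-congʳ (*-congʳ (sym num-0))) uv≤)

    -- Opaque: with-abstraction over it would unfold the well-founded recursion.
    opaque
      child-near : ∀ {t s} → t ℕ.< s → s ℕ.< τ → q (x s) (x t) ≤ num P₀ * ρ t →
                   UnderChild t s
      child-near {t} {s} t<s s<τ st≤ = descend s t<s ℕ.≤-refl s<τ st≤
        (≤-resp (sym (q-refl (x s))) refl (*-nonNeg (0≤num β) (0≤ρ s s<τ))) ≤-refl

    centres≥1 : ∀ {t j} → j ℕ.< κ → Private t j → 1# ≤ centres t
    centres≥1 j<κ priv = ≤-resp (χ-yes priv) refl (term≤∑ κ (λ _ _ → 0≤χ _) j<κ)

    -- The threshold is `9 = 2 · 4 + 1`: a later ball near an optimal centre within `4 ρ t` would
    -- come within `9 ρ t` of `x t`. With no centre that close, a point at squared distance `p` from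
    -- `x t` pays at least `2 ρ t - p`.
    leaf : ∀ t → t ℕ.< τ → ¬ (∃ λ s → t ℕ.< s × s ℕ.< τ × q (x s) (x t) ≤ num 9 * ρ t) →
           1# ≤ centres t ⊎ U ≤ payments t
    leaf t t<τ none with em {∃ λ j → j ℕ.< κ × q (x t) (c j) ≤ num 4 * ρ t}
    ... | yes (j , j<κ , tc≤) = inj₁ (centres≥1 j<κ (≤-trans tc≤ (*-monoʳ-≤ (0≤ρ t t<τ) (num-≤ _ _)) , last))
      where
      last : ∀ s → t ℕ.< s → s ℕ.< τ → ¬ q (x s) (c j) ≤ num α * ρ s
      last s t<s s<τ sc≤ = none (s , t<s , s<τ , by (+-mono-≤ st≤ (later-small 1574 8 1574 t<s s<τ _ st≤))
          (solve 3 (λ st rs rt → st :+ ((# 1574 :* rs :+ # 8 :* rt) :+ rt) := # 9 :* rt :+ (st :+ # 1574 :* rs)) refl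
            (q (x s) (x t)) (ρ s) (ρ t)))
        where
        st≤ : q (x s) (x t) ≤ num 1574 * ρ s + num 8 * ρ t
        st≤ = by (+-mono-≤ (q-tri (x s) (c j) (x t)) (+-mono-≤ (*-monoˡ-≤ (0≤num 2) sc≤)
            (*-monoˡ-≤ (0≤num 2) (≤-trans (≤-reflexive (q-sym (c j) (x t))) tc≤))))
          (solve 5 (λ st sc ct rs rt → st :+ (# 2 :* (sc :+ ct) :+ (# 2 :* (# 787 :* rs) :+ # 2 :* (# 4 :* rt))) :=
            (# 1574 :* rs :+ # 8 :* rt) :+ (st :+ (# 2 :* sc :+ # 2 :* ct))) refl
            (q (x s) (x t)) (q (x s) (c j)) (q (c j) (x t)) (ρ s) (ρ t))
    ... | no far = inj₂ (≤-trans (value t t<τ) (∑-mono n termwise))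
      where
      termwise : ∀ y → y ℕ.< n → pos (ρ t - q (x t) (pt y)) ≤ χ (Pays t y) * payment y
      termwise y y<n = ⊔-lub inside (0≤payments t y)
        where
        pays : ¬ ρ t - q (x t) (pt y) ≤ 0# → Pays t y
        pays ρ-q≰0 = ≤-trans ty≤ (≤-resp (*-identityˡ _) refl (*-monoʳ-≤ (0≤ρ t t<τ) (1≤num 256))) , last
          where
          ty≤ : q (x t) (pt y) ≤ ρ t
          ty≤ = by (≰⇒≥ ρ-q≰0) (solve 2 (λ r p → p :+ (r :- p) := r :+ # 0) refl (ρ t) (q (x t) (pt y)))
          last : ∀ s → t ℕ.< s → s ℕ.< τ → ¬ M s y
          last s t<s s<τ sy≤ = none (s , t<s , s<τ , by
              (+-mono-≤ st≤ (+-mono-≤ (later-small 512 2 512 t<s s<τ _ st≤) (*-monoˡ-≤ (0≤num 6) (0≤ρ t t<τ))))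
              (solve 3 (λ st rs rt → st :+ ((# 512 :* rs :+ # 2 :* rt) :+ (rt :+ # 6 :* rt)) := # 9 :* rt :+
                  (st :+ (# 512 :* rs :+ # 6 :* # 0))) refl
                (q (x s) (x t)) (ρ s) (ρ t)))
            where
            st≤ : q (x s) (x t) ≤ num 512 * ρ s + num 2 * ρ t
            st≤ = by (+-mono-≤ (q-tri (x s) (pt y) (x t))
                (+-mono-≤ (*-monoˡ-≤ (0≤num 2) sy≤) (*-monoˡ-≤ (0≤num 2)
                (≤-trans (≤-reflexive (q-sym (pt y) (x t))) ty≤))))
              (solve 5 (λ st sc ct rs rt → st :+ (# 2 :* (sc :+ ct) :+ (# 2 :* (# 256 :* rs) :+ # 2 :* rt)) :=
                (# 512 :* rs :+ # 2 :* rt) :+ (st :+ (# 2 :* sc :+ # 2 :* ct))) refl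
                (q (x s) (x t)) (q (x s) (pt y)) (q (pt y) (x t)) (ρ s) (ρ t))
        inside : ρ t - q (x t) (pt y) ≤ χ (Pays t y) * payment y
        inside with em {ρ t - q (x t) (pt y) ≤ 0#}
        ... | yes ≤0 = ≤-trans ≤0 (0≤payments t y)
        ... | no  ≰0 = ≤-resp refl (sym (trans (*-congʳ (χ-yes (pays ≰0))) (*-identityˡ _)))
            (*-cancelˡ-≤ (num≰0 2) (by (+-mono-≤ 4ρ≤ (+-mono-≤ (q-tri (x t) (pt y) (c (a y)))
                (*-monoˡ-≤ (0≤num 2) (0≤ρ t t<τ))))
              (solve 4 (λ r p tc yc → # 2 :* (r :- p) :+ (tc :+ (# 2 :* (p :+ yc) :+ # 2 :* r)) :=
                # 2 :* yc :+ (# 4 :* r :+ (tc :+ # 2 :* # 0))) refl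
                (ρ t) (q (x t) (pt y)) (q (x t) (c (a y))) (q (pt y) (c (a y))))))
          where
          4ρ≤ : num 4 * ρ t ≤ q (x t) (c (a y))
          4ρ≤ = ≰⇒≥ λ tc≤ → far (a y , a<κ y y<n , tc≤)

    -- The loss rate of the child's ball when served by `z t`; half of `K` because of the factor 2
    -- in the triangle inequality.
    H : ℕ
    H = 2147483648

    K≈2H : num K ≈ num 2 * num H
    K≈2H = num-* 2 H

    -- Every later ball near `x t` lies under the single child `v`, hence within `β ρ v` of
    -- `w = x v`. Whatever is far from `w` on the scale of `ρ v` is therefore out of reach of all
    -- later balls and may be awarded to `t`.
    only-child : ∀ t → t ℕ.< τ → (∃ λ s → t ℕ.< s × s ℕ.< τ × q (x s) (x t) ≤ num 9 * ρ t) →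
                 (∀ u v → u ℕ.< τ → v ℕ.< τ → Child t u → Child t v → u ≡ v) →
                 1# ≤ centres t ⊎ U ≤ payments t
    only-child t t<τ (s₀ , t<s₀ , s₀<τ , s₀t≤) unique =
      helper (child-near t<s₀ s₀<τ (≤-trans s₀t≤ (*-monoʳ-≤ (0≤ρ t t<τ) (num-≤ _ _))))
      where
      helper : (UnderChild t s₀) →
               1# ≤ centres t ⊎ U ≤ payments t
      helper (v , v≤s₀ , child-v , t<v , s₀v≤ , _) = conclusion
        where
        v<τ = ℕ.≤-<-trans v≤s₀ s₀<τ
        w = x v
        vt≤′ : q w (x t) ≤ num 12606 * ρ v + num 18 * ρ t
        vt≤′ = by (+-mono-≤ (q-tri w (x s₀) (x t)) (+-mono-≤
            (*-monoˡ-≤ (0≤num 2) (≤-trans (≤-reflexive (q-sym w (x s₀))) s₀v≤)) (*-monoˡ-≤ (0≤num 2) s₀t≤)))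
          (solve 5 (λ st sc ct rs rt → st :+ (# 2 :* (sc :+ ct) :+ (# 2 :* (# 6303 :* rs) :+ # 2 :* (# 9 :* rt))) :=
                (# 12606 :* rs :+ # 18 :* rt) :+ (st :+ (# 2 :* sc :+ # 2 :* ct))) refl
            (q w (x t)) (q w (x s₀)) (q (x s₀) (x t)) (ρ v) (ρ t))
        small : num 12606 * ρ v ≤ ρ t
        small = later-small 12606 18 12606 t<v v<τ _ vt≤′
        vt≤ : q w (x t) ≤ num 19 * ρ t
        vt≤ = by (+-mono-≤ vt≤′ small) (solve 3 (λ st rs rt → st :+ ((# 12606 :* rs :+ # 18 :* rt) :+ rt) := # 19
            :* rt :+ (st :+ # 12606 :* rs)) refl
                (q w (x t)) (ρ v) (ρ t))
        ρv≤ρt : ρ v ≤ ρ t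
        ρv≤ρt = later-≤ 12606 v<τ small
        ρv≰0 : ¬ ρ v ≤ 0#
        ρv≰0 ρv≤0 = U≰0 (≤-trans (value v v<τ) (≤-resp refl (∑-0 n) (∑-mono n λ y _ → ⊔-lub
          (by (+-mono-≤ ρv≤0 (0≤q w (pt y))) (solve 2 (λ r p → (r :- p) :+ (# 0 :+ p) := # 0 :+ (r :+ # 0)) refl
              (ρ v) (q w (pt y)))) ≤-refl)))
        descendant : ∀ s → t ℕ.< s → s ℕ.< τ → q (x s) (x t) ≤ num P₀ * ρ t → q (x s) w ≤ num β * ρ v × ρ s ≤ ρ v
        descendant s t<s s<τ st≤ with child-near t<s s<τ st≤
        ... | v′ , v′≤s , child-v′ , _ , sv′≤ , ρs≤ with unique v′ v (ℕ.≤-<-trans v′≤s s<τ) v<τ child-v′ child-v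
        ...   | ≡.refl = sv′≤ , ρs≤
        ball⊆M : ∀ y → q w (pt y) ≤ ρ v → M t y
        ball⊆M y vy≤ = by (+-mono-≤ (q-tri (x t) w (pt y))
            (+-mono-≤ (*-monoˡ-≤ (0≤num 2) (≤-trans (≤-reflexive (q-sym (x t) w)) vt≤))
            (+-mono-≤ (*-monoˡ-≤ (0≤num 2) (≤-trans vy≤ ρv≤ρt)) (*-monoˡ-≤ (0≤num 216) (0≤ρ t t<τ)))))
          (solve 4 (λ ty tw wy r → ty :+ (# 2 :* (tw :+ wy) :+ (# 2 :* (# 19 :* r) :+ (# 2 :* r :+ # 216 :* r))) :=
              # 256 :* r :+ (ty :+ (# 2 :* tw :+ (# 2 :* wy :+ # 216 :* # 0)))) refl
            (q (x t) (pt y)) (q (x t) w) (q w (pt y)) (ρ t))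
        Far : ℕ → Set
        Far y = M t y × num K * ρ v ≤ num 4 * q w (pt y)
        -- A point gains from w to z t only if it is far from w, so the far points
        -- must make up for the loss of the ball around w.
        termwise : ∀ y → χ (M t y) * q w (pt y) + num H * pos (ρ v - q w (pt y)) ≤
                         χ (M t y) * q (z t) (pt y) + χ (Far y) * q w (pt y)
        termwise y with em {M t y}
        ... | no ¬M = ≤-trans (≤-reflexive (+-congʳ (zeroˡ _))) (≤-trans (≤-reflexive (+-identityˡ _)) (≤-trans
              (≤-resp refl (zeroʳ _) (*-monoˡ-≤ (0≤num H) (⊔-lub outside ≤-refl)))
              (≤-resp (+-identityʳ 0#) refl (+-mono-≤ (≤-reflexive (sym (zeroˡ _))) (*-nonNeg (0≤χ _) (0≤q _ _))))))
            where
            outside : ρ v - q w (pt y) ≤ 0#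
            outside = by (≰⇒≥ λ vy≤ → ¬M (ball⊆M y vy≤)) (solve 2 (λ r p → (r :- p) :+ p := # 0 :+ r) refl (ρ v)
                (q w (pt y)))
        ... | yes M-y with em {num K * ρ v ≤ num 4 * q w (pt y)}
        ...   | yes far = ≤-trans (+-mono-≤ (≤-reflexive (*-identityˡ _))
            (≤-resp refl (zeroʳ _) (*-monoˡ-≤ (0≤num H) (⊔-lub outside ≤-refl))))
                  (by (*-nonNeg 0≤1 (0≤q (z t) (pt y))) (trans
                    (solve 2 (λ w z → (w :+ # 0) :+ # 1 :* z := (# 1 :* z :+ # 1 :* w) :+ # 0) refl (q w (pt y))
                        (q (z t) (pt y)))
                    (+-congʳ (+-congˡ (*-congʳ (sym (χ-yes (M-y , far))))))))
            where
            outside : ρ v - q w (pt y) ≤ 0#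
            outside = *-cancelˡ-≤ (num≰0 4) (by (+-mono-≤ far (*-monoʳ-≤ (0≤ρ v v<τ) (num-≤ 4 K)))
              (solve 3 (λ k r p → # 4 :* (r :- p) :+ (# 4 :* p :+ k :* r) := # 4 :* # 0 :+ (k :* r :+ # 4 :* r))
                  refl (num K) (ρ v) (q w (pt y))))
        ...   | no close = ≤-trans (+-mono-≤ (≤-reflexive (*-identityˡ _))
            (≤-resp refl refl (*-monoˡ-≤ (0≤num H) ≤-refl)))
                  (≤-trans main (≤-trans (≤-reflexive (sym (trans (+-congʳ (*-identityˡ _)) (+-identityʳ _))))
                      (+-mono-≤ ≤-refl (*-nonNeg (0≤χ _) (0≤q _ _)))))
            where
            p = q w (pt y)
            4p≤ : num 4 * p ≤ num K * ρ v
            4p≤ = ≰⇒≥ close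
            wz : num K * ρ v ≤ num 2 * (p + q (z t) (pt y))
            wz = ≤-trans (sep t v t<v v<τ) (≤-trans (q-tri w (pt y) (z t))
                (≤-reflexive (*-congˡ (+-congˡ (q-sym (pt y) (z t))))))
            -- All rests on `K ρ v ≤ 2 (p + q (z t) (pt y))`. Outside the ball of `v`, closeness
            -- `4 p ≤ K ρ v` shows that `z t` is no nearer than `w`. Inside it the extra cost is at
            -- least `H ρ v - 2 p`, and `2 ≤ H`.
            gap : num H * pos (ρ v - p) ≤ q (z t) (pt y) - p
            gap with ≤-total (ρ v - p) 0#
            ... | inj₁ ≤0 = ≤-trans (*-monoˡ-≤ (0≤num H) (⊔-lub ≤0 ≤-refl)) (*-cancelˡ-≤ (num≰0 2) (by (+-mono-≤ 4p≤ wz)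
                    (solve 5 (λ k h r p zy → # 2 :* (h :* # 0) :+ (k :* r :+ # 2 :* (p :+ zy)) := # 2 :* (zy :- p)
                        :+ (# 4 :* p :+ k :* r)) refl (num K) (num H) (ρ v) p (q (z t) (pt y)))))
            ... | inj₂ 0≤ = ≤-trans (*-monoˡ-≤ (0≤num H) (⊔-lub ≤-refl 0≤))
                (*-cancelˡ-≤ (num≰0 2) (by (+-mono-≤ (≤-trans (≤-reflexive (*-congʳ (sym K≈2H))) wz)
                (≤-resp refl (*-congʳ K≈2H) (*-monoʳ-≤ (0≤q w (pt y)) (num-≤ 4 K))))
                    (solve 4 (λ h r p zy → # 2 :* (h :* (r :- p)) :+ (# 2 :* (p :+ zy) :+ # 2 :* h :* p) := # 2 :*
                        (zy :- p) :+ (# 2 :* h :* r :+ # 4 :* p)) refl (num H) (ρ v) p (q (z t) (pt y)))))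
            main : p + num H * pos (ρ v - p) ≤ q (z t) (pt y)
            main = by gap (solve 3 (λ p g zy → (p :+ g) :+ (zy :- p) := zy :+ g) refl p (num H * pos (ρ v - p))
                (q (z t) (pt y)))
        far-cost : num H * U ≤ ∑ n (λ y → χ (Far y) * q w (pt y))
        far-cost = ≤-trans (*-monoˡ-≤ (0≤num H) (value v v<τ)) (by (+-mono-≤
            (≤-resp (trans (∑-+ n _ _) (+-congˡ (∑-*ˡ n (num H) _))) (∑-+ n _ _) (∑-mono n λ y _ → termwise y))
                (median t v t<τ v<τ))
          (solve 4 (λ h a b c → h :+ ((a :+ b) :+ c) := b :+ ((c :+ h) :+ a)) refl (num H * ∑ n _) (∑ n _) (∑ n _)
              (∑ n _)))
        conclusion : 1# ≤ centres t ⊎ U ≤ payments t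
        conclusion with em {∃ λ y → y ℕ.< n × Far y × num 4 * payment y ≤ q w (pt y)}
        -- A far point that pays little: its optimal centre is near `x t`, and like the point itself
        -- it is far from `w`, so it becomes private to `t`.
        ... | yes (y , y<n , (M-y , far) , cheap) = inj₁ (centres≥1 (a<κ y y<n) (tc≤ , last))
          where
          cy = c (a y)
          wy≤ : q w (pt y) ≤ num 550 * ρ t
          wy≤ = by (+-mono-≤ (q-tri w (x t) (pt y)) (+-mono-≤ (*-monoˡ-≤ (0≤num 2) vt≤) (*-monoˡ-≤ (0≤num 2) M-y)))
            (solve 4 (λ wy wt ty r → wy :+ (# 2 :* (wt :+ ty) :+ (# 2 :* (# 19 :* r) :+ # 2 :* (# 256 :* r))) := #
                550 :* r :+ (wy :+ (# 2 :* wt :+ # 2 :* ty))) refl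
              (q w (pt y)) (q w (x t)) (q (x t) (pt y)) (ρ t))
          tc≤ : q (x t) cy ≤ num α * ρ t
          tc≤ = *-cancelˡ-≤ (num≰0 2) (by (+-mono-≤ (*-monoˡ-≤ (0≤num 2) (q-tri (x t) (pt y) cy))
              (+-mono-≤ (*-monoˡ-≤ (0≤num 4) M-y) (+-mono-≤ cheap wy≤)))
            (solve 5 (λ tc ty yc wy r → # 2 :* tc :+ (# 2 :* (# 2 :* (ty :+ yc)) :+
                (# 4 :* (# 256 :* r) :+ (wy :+ # 550 :* r))) :=
                # 2 :* (# 787 :* r) :+ (# 2 :* tc :+ (# 4 :* ty :+ (# 4 :* yc :+ wy)))) refl
              (q (x t) cy) (q (x t) (pt y)) (payment y) (q w (pt y)) (ρ t)))
          last : ∀ s → t ℕ.< s → s ℕ.< τ → ¬ q (x s) cy ≤ num α * ρ s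
          -- A later ball claiming the centre gives `q w cy ≤ 2 (β + α) ρ v = 14180 ρ v`. Cheapness
          -- then gives `q w (pt y) ≤ 4 · 14180 ρ v`, and being far gives `K ρ v ≤ 16 · 14180 ρ v`.
          -- The dear case closes likewise with `52472 = 8 (β + 256)`.
          last s t<s s<τ sc≤ = ρv≰0 (shrink⁰ 226880 (0≤ρ v v<τ) _ Kρ≤)
            where
            st≤ : q (x s) (x t) ≤ num 1574 * ρ s + num 1574 * ρ t
            st≤ = by (+-mono-≤ (q-tri (x s) cy (x t)) (+-mono-≤ (*-monoˡ-≤ (0≤num 2) sc≤)
                (*-monoˡ-≤ (0≤num 2) (≤-trans (≤-reflexive (q-sym cy (x t))) tc≤))))
              (solve 5 (λ st sc ct rs rt → st :+ (# 2 :* (sc :+ ct) :+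
                  (# 2 :* (# 787 :* rs) :+ # 2 :* (# 787 :* rt))) :=
                (# 1574 :* rs :+ # 1574 :* rt) :+ (st :+ (# 2 :* sc :+ # 2 :* ct))) refl
                (q (x s) (x t)) (q (x s) cy) (q cy (x t)) (ρ s) (ρ t))
            desc = descendant s t<s s<τ (by (+-mono-≤ st≤ (later-small 1574 1574 1574 t<s s<τ _ st≤))
              (solve 3 (λ st rs rt → st :+ ((# 1574 :* rs :+ # 1574 :* rt) :+ rt) := # 1575 :* rt :+
                  (st :+ # 1574 :* rs)) refl
                (q (x s) (x t)) (ρ s) (ρ t)))
            wc≤ : q w cy ≤ num 14180 * ρ v
            wc≤ = by (+-mono-≤ (q-tri w (x s) cy) (+-mono-≤
                (*-monoˡ-≤ (0≤num 2) (≤-trans (≤-reflexive (q-sym w (x s))) (proj₁ desc)))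
                (*-monoˡ-≤ (0≤num 2) (≤-trans sc≤ (*-monoˡ-≤ (0≤num α) (proj₂ desc))))))
              (solve 4 (λ wc ws sc r → wc :+ (# 2 :* (ws :+ sc) :+ (# 2 :* (# 6303 :* r) :+ # 2 :* (# 787 :* r)))
                  := # 14180 :* r :+ (wc :+ (# 2 :* ws :+ # 2 :* sc))) refl
                (q w cy) (q w (x s)) (q (x s) cy) (ρ v))
            Kρ≤ : num K * ρ v ≤ num 226880 * ρ v
            Kρ≤ = by (+-mono-≤ far (+-mono-≤ (*-monoˡ-≤ (0≤num 8)
                (≤-trans (q-tri w cy (pt y)) (≤-reflexive (*-congˡ (+-congˡ (q-sym cy (pt y)))))))
                (+-mono-≤ (*-monoˡ-≤ (0≤num 16) wc≤) (*-monoˡ-≤ (0≤num 4) cheap))))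
              (solve 5 (λ k wy wc yc r → k :+ (# 4 :* wy :+
                  (# 8 :* (# 2 :* (wc :+ yc)) :+ (# 16 :* (# 14180 :* r) :+ # 4 :* wy))) :=
                 # 226880 :* r :+ (k :+ (# 8 :* wy :+ (# 16 :* wc :+ # 4 :* (# 4 :* yc))))) refl
                 (num K * ρ v) (q w (pt y)) (q w cy) (payment y) (ρ v))
        -- Now every far point pays at least a quarter of its distance to `w`. Together they pay
        -- `H U / 4`, and `4 ≤ H`.
        ... | no dear = inj₂ (*-cancelˡ-≤ (num≰0 4) (≤-trans (*-monoʳ-≤ 0≤U (num-≤ 4 H))
              (≤-trans far-cost (≤-resp refl (∑-*ˡ n (num 4) _) (∑-mono n charge)))))
          where
          charge : ∀ y → y ℕ.< n → χ (Far y) * q w (pt y) ≤ num 4 * (χ (Pays t y) * payment y)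
          charge y y<n with em {Far y}
          ... | no _ = ≤-trans (≤-reflexive (zeroˡ _)) (*-nonNeg (0≤num 4) (0≤payments t y))
          ... | yes (M-y , far) = ≤-trans (≤-reflexive (*-identityˡ _))
              (≤-trans (≰⇒≥ λ cheap → dear (y , y<n , (M-y , far) , cheap))
                (≤-reflexive (*-congˡ (sym (trans (*-congʳ (χ-yes (M-y , last))) (*-identityˡ _))))))
            where
            last : ∀ s → t ℕ.< s → s ℕ.< τ → ¬ M s y
            last s t<s s<τ sy≤ = ρv≰0 (shrink⁰ 52472 (0≤ρ v v<τ) _ Kρ≤)
              where
              st≤ : q (x s) (x t) ≤ num 512 * ρ s + num 512 * ρ t
              st≤ = by (+-mono-≤ (q-tri (x s) (pt y) (x t))
                  (+-mono-≤ (*-monoˡ-≤ (0≤num 2) sy≤) (*-monoˡ-≤ (0≤num 2)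
                  (≤-trans (≤-reflexive (q-sym (pt y) (x t))) M-y))))
                (solve 5 (λ st sc ct rs rt → st :+ (# 2 :* (sc :+ ct) :+
                    (# 2 :* (# 256 :* rs) :+ # 2 :* (# 256 :* rt))) :=
                  (# 512 :* rs :+ # 512 :* rt) :+ (st :+ (# 2 :* sc :+ # 2 :* ct))) refl
                  (q (x s) (x t)) (q (x s) (pt y)) (q (pt y) (x t)) (ρ s) (ρ t))
              desc = descendant s t<s s<τ (by (+-mono-≤ st≤
                  (+-mono-≤ (later-small 512 512 512 t<s s<τ _ st≤) (*-monoˡ-≤ (0≤num 1062) (0≤ρ t t<τ))))
                (solve 3 (λ st rs rt → st :+ ((# 512 :* rs :+ # 512 :* rt) :+ (rt :+ # 1062 :* rt)) := # 1575 :* rt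
                    :+ (st :+ (# 512 :* rs :+ # 1062 :* # 0))) refl
                  (q (x s) (x t)) (ρ s) (ρ t)))
              Kρ≤ : num K * ρ v ≤ num 52472 * ρ v
              Kρ≤ = by (+-mono-≤ far (+-mono-≤ (*-monoˡ-≤ (0≤num 4) (q-tri w (x s) (pt y)))
                  (+-mono-≤ (*-monoˡ-≤ (0≤num 8) (≤-trans (≤-reflexive (q-sym w (x s))) (proj₁ desc)))
                  (*-monoˡ-≤ (0≤num 8) (≤-trans sy≤ (*-monoˡ-≤ (0≤num 256) (proj₂ desc)))))))
                (solve 5 (λ k wy ws sy r → k :+ (# 4 :* wy :+
                    (# 4 :* (# 2 :* (ws :+ sy)) :+ (# 8 :* (# 6303 :* r) :+ # 8 :* (# 256 :* r)))) :=
                   # 52472 :* r :+ (k :+ (# 4 :* wy :+ (# 8 :* ws :+ # 8 :* sy)))) refl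
                   (num K * ρ v) (q w (pt y)) (q w (x s)) (q (x s) (pt y)) (ρ v))

    -- Two children account for `2 U` by themselves; otherwise the ball earns `U` in the bracket,
    -- which is doubled. As there are at most `τ` parent links, summation leaves `τ U` to be paid by
    -- centres and points.
    charged : ∀ t → t ℕ.< τ → num 2 * U ≤ children t * U + num 2 * (centres t * U + payments t)
    charged t t<τ with em {∃ λ u → ∃ λ v → u ℕ.< v × v ℕ.< τ × Child t u × Child t v}
    ... | yes (u , v , u<v , v<τ , child-u , child-v) =
        ≤-trans (0≤-by (*-nonNeg (0≤num 2) 0≤rest) refl) (+-mono-≤ (*-monoʳ-≤ 0≤U two) ≤-refl)
      where
      0≤rest : 0# ≤ centres t * U + payments t
      0≤rest = ≤-resp (+-identityʳ 0#) refl (+-mono-≤ (*-nonNeg (∑-nonneg κ λ _ _ → 0≤χ _) 0≤U)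
          (∑-nonneg n λ y _ → 0≤payments t y))
      two : num 2 ≤ children t
      two = ≤-resp (trans (+-cong (χ-yes child-u) (χ-yes child-v)) (solve 0 (# 1 :+ # 1 := # 2) refl)) refl
              (two-terms≤∑ τ (λ _ _ → 0≤χ _) u<v v<τ)
    ... | no ¬two = ≤-trans (*-monoˡ-≤ (0≤num 2) (one private-or-pays))
          (0≤-by (*-nonNeg (∑-nonneg τ λ _ _ → 0≤χ _) 0≤U) (+-comm _ _))
      where
      unique : ∀ u v → u ℕ.< τ → v ℕ.< τ → Child t u → Child t v → u ≡ v
      unique u v u<τ v<τ child-u child-v with ℕ.<-cmp u v
      ... | tri< u<v _ _ = contradiction (u , v , u<v , v<τ , child-u , child-v) ¬two
      ... | tri≈ _ u≡v _ = u≡v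
      ... | tri> _ _ v<u = contradiction (v , u , v<u , u<τ , child-v , child-u) ¬two
      private-or-pays : 1# ≤ centres t ⊎ U ≤ payments t
      private-or-pays with em {∃ λ s → t ℕ.< s × s ℕ.< τ × q (x s) (x t) ≤ num 9 * ρ t}
      ... | yes some = only-child t t<τ some unique
      ... | no none  = leaf t t<τ none
      one : 1# ≤ centres t ⊎ U ≤ payments t → U ≤ centres t * U + payments t
      one (inj₁ 1≤) = ≤-resp (trans (+-identityʳ _) (*-identityˡ U)) refl
        (+-mono-≤ (*-monoʳ-≤ 0≤U 1≤) (∑-nonneg n λ y _ → 0≤payments t y))
      one (inj₂ U≤) = ≤-resp (+-identityˡ U) refl
        (+-mono-≤ (*-nonNeg (∑-nonneg κ λ _ _ → 0≤χ _) 0≤U) U≤)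

    packing-bound : num τ * U ≤ num 2 * (num κ * U + ∑ n payment)
    packing-bound = by (+-mono-≤ total (+-mono-≤ (*-monoʳ-≤ 0≤U ∑children)
        (*-monoˡ-≤ (0≤num 2) (+-mono-≤ (*-monoʳ-≤ 0≤U ∑centres) ∑payments))))
        (solve 7 (λ t u k f ch ce pa → t :* u :+ ((ch :* u :+ # 2 :* (ce :* u :+ pa)) :+
            (t :* u :+ # 2 :* (k :* u :+ f))) :=
           # 2 :* (k :* u :+ f) :+ (t :* (# 2 :* u) :+ (ch :* u :+ # 2 :* (ce :* u :+ pa)))) refl
           (num τ) U (num κ) (∑ n payment) (∑ τ children) (∑ τ centres) (∑ τ payments))
      where
      *ʳ : ∀ f → ∑ τ (λ t → f t * U) ≈ ∑ τ f * U
      *ʳ f = trans (∑-cong τ λ t _ → *-comm _ _) (trans (∑-*ˡ τ U f) (*-comm _ _))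
      total : num τ * (num 2 * U) ≤ ∑ τ children * U + num 2 * (∑ τ centres * U + ∑ τ payments)
      total = ≤-resp (∑-const τ _)
        (trans (∑-+ τ _ _) (+-cong (*ʳ children) (trans (∑-*ˡ τ (num 2) _)
            (*-congˡ (trans (∑-+ τ _ _) (+-congʳ (*ʳ centres)))))))
        (∑-mono τ charged)

-- Squared Euclidean distances and averaging over a cluster

module Clusters (em : ExcludedMiddle 0ℓ) (ℝ : Reals) where

  open KMeans em ℝ hiding (pc; N; R)
  open OrderedField em ℝ
  open Solver using (solve; _:=_; _:+_; _:*_; _:-_; :-_)

  dist : ∀ {d} → Point d → Point d → Carrier
  dist a b = ‖ a -ᵥ b ‖²

  0≤dist : ∀ {d} (a b : Point d) → 0# ≤ dist a b
  0≤dist {zero}  a b = ≤-refl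
  0≤dist {suc d} a b = ≤-resp (+-identityʳ 0#) refl (+-mono-≤ (0≤x² _) (0≤dist (a ∘ Fin.suc) (b ∘ Fin.suc)))

  dist-refl : ∀ {d} (a : Point d) → dist a a ≈ 0#
  dist-refl {zero}  a = refl
  dist-refl {suc d} a = trans (+-cong (solve 1 (λ a → (a :- a) :* (a :- a) := # 0) refl (a Fin.zero))
      (dist-refl (a ∘ Fin.suc))) (+-identityʳ 0#)

  dist-sym : ∀ {d} (a b : Point d) → dist a b ≈ dist b a
  dist-sym {zero}  a b = refl
  dist-sym {suc d} a b = +-cong (solve 2 (λ a b → (a :- b) :* (a :- b) := (b :- a) :* (b :- a)) refl (a Fin.zero)
      (b Fin.zero))
                                (dist-sym (a ∘ Fin.suc) (b ∘ Fin.suc))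

  -- In each coordinate the two sides differ by `(a + c - 2 b)²`.
  dist-tri : ∀ {d} (a b c : Point d) → dist a c ≤ num 2 * (dist a b + dist b c)
  dist-tri {zero}  a b c = ≤-reflexive (solve 0 (# 0 := # 2 :* (# 0 :+ # 0)) refl)
  dist-tri {suc d} a b c = by
    (+-mono-≤ (dist-tri (a ∘ Fin.suc) (b ∘ Fin.suc) (c ∘ Fin.suc))
        (0≤x² (a Fin.zero + c Fin.zero - num 2 * b Fin.zero)))
    (solve 6 (λ a b c ac ab bc → ((a :- c) :* (a :- c) :+ ac) :+
        (# 2 :* (ab :+ bc) :+ (a :+ c :- # 2 :* b) :* (a :+ c :- # 2 :* b)) :=
        # 2 :* (((a :- b) :* (a :- b) :+ ab) :+ ((b :- c) :* (b :- c) :+ bc)) :+ (ac :+ # 0)) refl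
      (a Fin.zero) (b Fin.zero) (c Fin.zero) (dist (a ∘ Fin.suc) (c ∘ Fin.suc)) (dist (a ∘ Fin.suc) (b ∘ Fin.suc))
          (dist (b ∘ Fin.suc) (c ∘ Fin.suc)))

  dist-cong : ∀ {d} {a a′ b b′ : Point d} → (∀ l → a l ≈ a′ l) → (∀ l → b l ≈ b′ l) → dist a b ≈ dist a′ b′
  dist-cong {zero}  a≈ b≈ = refl
  dist-cong {suc d} a≈ b≈ = +-cong (*-cong a-b≈ a-b≈) (dist-cong (a≈ ∘ Fin.suc) (b≈ ∘ Fin.suc))
    where a-b≈ = +-cong (a≈ Fin.zero) (-‿cong (b≈ Fin.zero))

  dist≈0 : ∀ {d} (a b : Point d) → dist a b ≈ 0# → ∀ l → a l ≈ b l
  dist≈0 {suc d} a b ab≈0 = λ where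
      Fin.zero    → trans (solve 2 (λ a b → a := (a :- b) :+ b) refl (a Fin.zero) (b Fin.zero))
                      (trans (+-congʳ head≈0) (+-identityˡ _))
      (Fin.suc l) → dist≈0 (a ∘ Fin.suc) (b ∘ Fin.suc) (≤-antisym tail≤0 (0≤dist (a ∘ Fin.suc) (b ∘ Fin.suc))) l
    where
    e = a Fin.zero - b Fin.zero
    tail≤0 : dist (a ∘ Fin.suc) (b ∘ Fin.suc) ≤ 0#
    tail≤0 = 0≤-by (0≤x² e) (trans (+-comm _ _) ab≈0)
    sq≈0 : e * e ≈ 0#
    sq≈0 = ≤-antisym (0≤-by (0≤dist (a ∘ Fin.suc) (b ∘ Fin.suc)) ab≈0) (0≤x² e)
    head≈0 : e ≈ 0#
    head≈0 with em {e ≈ 0#}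
    ... | yes e≈0 = e≈0
    ... | no  e≉0 = *-cancelˡ-≈ e≉0 (trans sq≈0 (sym (zeroʳ e)))

  module _ (n : ℕ) (w : ℕ → Carrier) where

    W : Carrier
    W = ∑ n w

    private
      ∑∑ : (ℕ → ℕ → Carrier) → Carrier
      ∑∑ g = ∑ n λ x → w x * ∑ n λ y → w y * g x y

      ∑∑-+ : ∀ f g → ∑∑ (λ x y → f x y + g x y) ≈ ∑∑ f + ∑∑ g
      ∑∑-+ f g = trans (∑-cong n λ x _ → trans (*-congˡ (trans (∑-cong n λ y _ → distribˡ _ _ _) (∑-+ n _ _)))
          (distribˡ _ _ _)) (∑-+ n _ _)

    weighted-left : ∀ (G : ℕ → Carrier) → ∑∑ (λ x y → G x) ≈ W * ∑ n (λ y → w y * G y)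
    weighted-left G = trans (∑-cong n λ x _ → trans (*-congˡ (trans (∑-cong n λ y _ → *-comm _ _) (∑-*ˡ n (G x) w)))
        (solve 3 (λ a g W → a :* (g :* W) := W :* (a :* g)) refl (w x) (G x) W)) (∑-*ˡ n W (λ x → w x * G x))

    weighted-right : ∀ (G : ℕ → Carrier) → ∑∑ (λ x y → G y) ≈ W * ∑ n (λ y → w y * G y)
    weighted-right G = trans (∑-cong n λ x _ → *-comm _ _) (trans (∑-*ˡ n (∑ n (λ y → w y * G y)) w) (*-comm _ _))

    private
      line : ∀ (p : ℕ → Carrier) c → ∑∑ (λ x y → (p x - p y) * (p x - p y)) ≤
             num 2 * (W * ∑ n (λ y → w y * ((p y - c) * (p y - c))))
      line p c = by (*-monoˡ-≤ (0≤num 2) (0≤x² B)) (trans (+-congʳ expand)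
          (solve 3 (λ W A B → (A :* W :+ (W :* A :- # 2 :* (B :* B))) :+ # 2 :* (B :* B) := # 2 :* (W :* A) :+ # 2
              :* # 0) refl W A B))
        where
        u : ℕ → Carrier
        u y = p y - c
        A = ∑ n λ y → w y * (u y * u y)
        B = ∑ n λ y → w y * u y
        inner : ∀ x → ∑ n (λ y → w y * ((p x - p y) * (p x - p y))) ≈ u x * u x * W + (A + (- num 2 * u x) * B)
        inner x = trans (∑-cong n λ y _ → solve 4 (λ w x y c → w :* ((x :- y) :* (x :- y)) :=
              (x :- c) :* (x :- c) :* w :+ (w :* ((y :- c) :* (y :- c)) :+ ((:- # 2) :* (x :- c)) :*
                  (w :* (y :- c)))) refl (w y) (p x) (p y) c)
            (trans (∑-+ n _ _) (+-cong (∑-*ˡ n _ w) (trans (∑-+ n _ _) (+-congˡ (∑-*ˡ n _ _)))))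
        expand : ∑∑ (λ x y → (p x - p y) * (p x - p y)) ≈ A * W + (W * A - num 2 * (B * B))
        expand = trans (∑-cong n λ x _ → trans (*-congˡ (inner x))
              (solve 5 (λ w u W A B → w :* (u :* u :* W :+ (A :+ ((:- # 2) :* u) :* B)) :=
                 W :* (w :* (u :* u)) :+ (A :* w :+ ((:- # 2) :* B) :* (w :* u))) refl (w x) (u x) W A B))
            (trans (∑-+ n _ _) (trans (+-cong (∑-*ˡ n W _) (trans (∑-+ n _ _) (+-cong (∑-*ˡ n A w) (∑-*ˡ n _ _))))
              (solve 3 (λ W A B → W :* A :+ (A :* W :+ ((:- # 2) :* B) :* B) := A :* W :+
                  (W :* A :- # 2 :* (B :* B))) refl W A B)))

    -- Σ w w |x - y|² = 2 W Σ w |x - c|² - 2 |Σ w (x - c)|².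
    pairwise≤ : ∀ {d} (p : ℕ → Point d) (c : Point d) →
                ∑∑ (λ x y → dist (p x) (p y)) ≤ num 2 * (W * ∑ n (λ y → w y * dist (p y) c))
    pairwise≤ {zero} p c = ≤-reflexive (trans (weighted-right (λ _ → 0#)) (trans (*-congˡ zeros) (trans (zeroʳ W)
        (sym (trans (*-congˡ (trans (*-congˡ zeros) (zeroʳ W))) (zeroʳ _))))))
      where
      zeros : ∑ n (λ y → w y * 0#) ≈ 0#
      zeros = trans (∑-cong n {g = λ _ → 0#} λ y _ → zeroʳ (w y)) (∑-0 n)
    pairwise≤ {suc d} p c = ≤-resp (sym (∑∑-+ _ _))
        (trans (solve 3 (λ W a b → # 2 :* (W :* a) :+ # 2 :* (W :* b) := # 2 :* (W :* (a :+ b))) refl W (∑ n _) (∑ n _))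
        (*-congˡ (*-congˡ (sym (trans (∑-cong n λ y _ → distribˡ _ _ _) (∑-+ n _ _))))))
      (+-mono-≤ (line (λ y → p y Fin.zero) (c Fin.zero)) (pairwise≤ (λ y → p y ∘ Fin.suc) (c ∘ Fin.suc)))

    -- Averages the hypothesis over a candidate `x` drawn from the weights themselves. The centre
    -- `c` is unknown to the algorithm, but by `pairwise≤` a random member of the cluster costs at
    -- most twice as much.
    average : ∀ {d} (p : ℕ → Point d) (c : Point d) (g : ℕ → ℕ → Carrier) (G Γ : Carrier) →
              (∀ y → y ℕ.< n → 0# ≤ w y) → ¬ W ≤ 0# → ∑∑ g ≈ W * G →
              (∀ x → x ℕ.< n → ∑ n (λ y → w y * (g x y - dist (p x) (p y))) ≤ Γ) →
              G ≤ Γ + num 2 * ∑ n (λ y → w y * dist (p y) c)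
    average p c g G Γ 0≤w W≰0 ∑∑g≈ bound = *-cancelˡ-≤ W≰0 (by (+-mono-≤ outer (pairwise≤ p c))
        (solve 5 (λ W G Γ f s → W :* G :+ (W :* Γ :+ # 2 :* (W :* f)) := W :* (Γ :+ # 2 :* f) :+
            ((W :* G :- s) :+ s)) refl W G Γ (∑ n _) (∑∑ (λ x y → dist (p x) (p y)))))
      where
      outer : W * G - ∑∑ (λ x y → dist (p x) (p y)) ≤ W * Γ
      outer = ≤-resp (trans (∑-cong n λ x _ → trans (*-congˡ (trans (∑-cong n λ y _ →
                  solve 3 (λ w a b → w :* (a :- b) := w :* a :- w :* b) refl (w y) (g x y) (dist (p x) (p y)))
                      (∑-sub n _ _)))
                  (solve 3 (λ w a b → w :* (a :- b) := w :* a :- w :* b) refl (w x) _ _))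
                (trans (∑-sub n _ _) (+-congʳ ∑∑g≈)))
              (trans (∑-cong n λ x _ → *-comm _ _) (trans (∑-*ˡ n Γ w) (*-comm _ _)))
              (∑-mono n λ x x<n → *-monoˡ-≤ (0≤w x x<n) (bound x x<n))

  module Assignment {d} (n κ : ℕ) (p c : ℕ → Point d) (a : ℕ → ℕ) (a<κ : ∀ y → y ℕ.< n → a y ℕ.< κ) where

    payment : ℕ → Carrier
    payment y = dist (p y) (c (a y))

    belongs : ℕ → ℕ → Carrier
    belongs j y = χ (a y ≡ j)

    ∑-clusters : ∀ F → ∑ κ (λ j → ∑ n λ y → belongs j y * F y) ≈ ∑ n F
    ∑-clusters F = trans (∑-swap κ n _) (∑-cong n λ y y<n → trans (∑-cong κ λ j _ → *-comm _ _)
        (trans (∑-*ˡ κ (F y) _) (trans (*-congˡ (≤-antisym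
          (∑χ≤1 κ (λ j → a y ≡ j) λ i j _ _ ay≡i ay≡j → ≡.trans (≡.sym ay≡i) ay≡j)
          (≤-resp (χ-yes ≡.refl) refl (term≤∑ κ (λ _ _ → 0≤χ _) (a<κ y y<n))))) (*-identityʳ _))))

    -- Serves both phases. With `g x y` the radius at `x` and `Γ = U` it bounds the cost left by the
    -- first phase; with `g x y = D y` and `Γ` the decrease of the cost it gives the progress of a
    -- greedy step.
    clustering-bound : ∀ (g : ℕ → ℕ → Carrier) (G : ℕ → Carrier) Γ → 0# ≤ Γ →
      (∀ j → ∑ n (λ x → belongs j x * ∑ n λ y → belongs j y * g x y) ≈ W n (belongs j) * ∑ n
          (λ y → belongs j y * G y)) →
      (∀ j x → x ℕ.< n → ∑ n (λ y → belongs j y * (g x y - dist (p x) (p y))) ≤ Γ) →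
      ∑ n G ≤ num κ * Γ + num 2 * ∑ n payment
    clustering-bound g G Γ 0≤Γ eq bound =
      ≤-resp (∑-clusters G) (trans (∑-+ κ _ _) (+-cong (∑-const κ Γ)
          (trans (∑-*ˡ κ (num 2) _) (*-congˡ (∑-clusters payment)))))
        (∑-mono κ λ j _ → cluster j)
      where
      own : ∀ j y → belongs j y * dist (p y) (c j) ≈ belongs j y * payment y
      own j y with em {a y ≡ j}
      ... | yes ≡.refl = refl
      ... | no  _      = trans (zeroˡ _) (sym (zeroˡ _))
      cluster : ∀ j → ∑ n (λ y → belongs j y * G y) ≤ Γ + num 2 * ∑ n (λ y → belongs j y * payment y)
      cluster j with em {∃ λ y → y ℕ.< n × a y ≡ j}
      ... | yes (y₀ , y₀<n , ay₀≡j) = ≤-resp refl (+-congˡ (*-congˡ (∑-cong n λ y _ → own j y)))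
              (average n (belongs j) p (c j) g _ Γ (λ _ _ → 0≤χ _)
                (λ W≤0 → 1≰0 (≤-trans (≤-resp (χ-yes ay₀≡j) refl (term≤∑ n (λ _ _ → 0≤χ _) y₀<n)) W≤0)) (eq j)
                    (bound j))
      -- An empty cluster has no member to average over; its sum vanishes and `0 ≤ Γ` covers it.
      ... | no empty = ≤-trans (≤-reflexive (trans (∑-cong n λ y y<n → trans
          (*-congʳ (χ-no λ ay≡j → empty (y , y<n , ay≡j))) (zeroˡ _)) (∑-0 n)))
              (≤-resp (+-identityʳ 0#) refl (+-mono-≤ 0≤Γ (*-nonNeg (0≤num 2)
                  (∑-nonneg n λ y _ → *-nonNeg (0≤χ (a y ≡ j)) (0≤dist (p y) (c (a y)))))))

-- Structured programs and their compilation

module StructuredPrograms (em : ExcludedMiddle 0ℓ) (ℝ : Reals) where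

  open KMeans em ℝ

  infix 4 _⊢_⇒[_]_
  infixr 5 _⨾_

  data Test : Set where
    leqℕ leqᴿ : (a b : ℕ) → Test

  -- A conditional jump is taken when `≤` holds. Guarding by `unless` and `until` lets it skip the
  -- body directly, with no negated test.
  data Cmd : Set where
    block  : List Instruction → Cmd
    _⨾_    : Cmd → Cmd → Cmd
    unless : Test → Cmd → Cmd
    until  : Test → Cmd → Cmd

  record Mem : Set where
    constructor mem
    field
      nat  : ℕ → ℕ
      real : ℕ → Carrier

  open Mem public

  at : ℕ → Mem → Configuration
  at p m = ⟨ p , nat m , real m ⟩

  straight : Instruction → Bool
  straight (jump≤ℕ _ _ _) = false
  straight (jump≤ᴿ _ _ _) = false
  straight _              = true

  effect : Instruction → Mem → Mem
  effect i m = mem (N (execute i (at 0 m))) (R (execute i (at 0 m)))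

  run : List Instruction → Mem → Mem
  run []       m = m
  run (i ∷ is) m = run is (effect i m)

  holds : Test → Mem → Bool
  holds (leqℕ a b) m = nat m a ℕ.≤ᵇ nat m b
  holds (leqᴿ a b) m = Dec.does (em {real m a ≤ real m b})

  -- The times are those of the compiled code: one step for a test, and one more after each
  -- completed iteration for the jump back.
  data _⊢_⇒[_]_ : Cmd → Mem → ℕ → Mem → Set where
    block  : ∀ {is m} → T (all straight is) → block is ⊢ m ⇒[ length is ] run is m
    _⨾_    : ∀ {c c′ m m′ m″ t u} → c ⊢ m ⇒[ t ] m′ → c′ ⊢ m′ ⇒[ u ] m″ → (c ⨾ c′) ⊢ m ⇒[ t ℕ.+ u ] m″
    skip   : ∀ {b c m} → holds b m ≡ true → unless b c ⊢ m ⇒[ 1 ] m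
    enter  : ∀ {b c m m′ t} → holds b m ≡ false → c ⊢ m ⇒[ t ] m′ → unless b c ⊢ m ⇒[ suc t ] m′
    stop   : ∀ {b c m} → holds b m ≡ true → until b c ⊢ m ⇒[ 1 ] m
    repeat : ∀ {b c m m′ m″ t u} → holds b m ≡ false → c ⊢ m ⇒[ t ] m′ → until b c ⊢ m′ ⇒[ u ] m″ →
             until b c ⊢ m ⇒[ suc (t ℕ.+ suc u) ] m″

  jump : Test → ℕ → Instruction
  jump (leqℕ a b) l = jump≤ℕ a b l
  jump (leqᴿ a b) l = jump≤ᴿ a b l

  size : Cmd → ℕ
  size (block is)   = length is
  size (c ⨾ c′)     = size c ℕ.+ size c′
  size (unless b c) = suc (size c)
  size (until b c)  = suc (size c ℕ.+ 1)

  -- Jumps are absolute, so the address `p` of the first instruction is needed. `jump≤ℕ 0 0 p`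
  -- compares a register with itself and is always taken.
  compile : ℕ → Cmd → Program
  compile p (block is)   = is
  compile p (c ⨾ c′)     = compile p c ++ compile (p ℕ.+ size c) c′
  compile p (unless b c) = jump b (p ℕ.+ suc (size c)) ∷ compile (suc p) c
  compile p (until b c)  = jump b (p ℕ.+ suc (size c ℕ.+ 1)) ∷ compile (suc p) c ++ jump≤ℕ 0 0 p ∷ []

  length-compile : ∀ p c → length (compile p c) ≡ size c
  length-compile p (block is)   = ≡.refl
  length-compile p (c ⨾ c′)     = ≡.trans (List.length-++ (compile p c))
      (≡.cong₂ ℕ._+_ (length-compile p c) (length-compile _ c′))
  length-compile p (unless b c) = ≡.cong suc (length-compile (suc p) c)
  length-compile p (until b c)  = ≡.cong suc (≡.trans (List.length-++ (compile (suc p) c))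
      (≡.cong (ℕ._+ 1) (length-compile (suc p) c)))

  record Contains (P : Program) (p : ℕ) (is : Program) : Set where
    constructor contains
    field
      before after : Program
      splits       : P ≡ before ++ is ++ after
      offset       : length before ≡ p

  private
    fetch-++ : ∀ (pre : Program) {i rest} → fetch (pre ++ i ∷ rest) (length pre) ≡ just i
    fetch-++ []        = ≡.refl
    fetch-++ (_ ∷ pre) = fetch-++ pre

  fetch-head : ∀ {P p i is} → Contains P p (i ∷ is) → fetch P p ≡ just i
  fetch-head (contains pre post ≡.refl ≡.refl) = fetch-++ pre

  contains-++ˡ : ∀ {P p} is {js} → Contains P p (is ++ js) → Contains P p is
  contains-++ˡ is {js} (contains pre post eq off) =
    contains pre (js ++ post) (≡.trans eq (≡.cong (pre ++_) (List.++-assoc is js post))) off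

  contains-++ʳ : ∀ {P p} is {js} → Contains P p (is ++ js) → Contains P (p ℕ.+ length is) js
  contains-++ʳ is {js} (contains pre post eq ≡.refl) =
    contains (pre ++ is) post (≡.trans eq (≡.trans (≡.cong (pre ++_) (List.++-assoc is js post))
        (≡.sym (List.++-assoc pre is (js ++ post)))))
             (List.length-++ pre)

  contains-tail : ∀ {P p i is} → Contains P p (i ∷ is) → Contains P (suc p) is
  contains-tail {P} {p} {i} {is} con = ≡.subst (λ p → Contains P p is) (ℕ.+-comm p 1) (contains-++ʳ (i ∷ []) con)

  -- `⇓` speaks of halting runs only, so an initial segment is described by the time that it adds to
  -- every halting run that continues it.
  Reaches : Program → Configuration → ℕ → Configuration → Set
  Reaches P c t c′ = ∀ {u e} → P ⊢ c′ ⇓[ u ] e → P ⊢ c ⇓[ t ℕ.+ u ] e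

  reaches-trans : ∀ {P c c′ c″ t t′} → Reaches P c t c′ → Reaches P c′ t′ c″ → Reaches P c (t ℕ.+ t′) c″
  reaches-trans {P} {c} {t = t} {t′} f g {u} {e} d = ≡.subst (λ t → P ⊢ c ⇓[ t ] e) (≡.sym (ℕ.+-assoc t t′ u)) (f (g d))

  straight-step : ∀ i p m → T (straight i) → execute i (at p m) ≡ at (suc p) (effect i m)
  straight-step (setℕ a c)     p m _ = ≡.refl
  straight-step (addℕ a b c)   p m _ = ≡.refl
  straight-step (subℕ a b c)   p m _ = ≡.refl
  straight-step (loadℕ a b)    p m _ = ≡.refl
  straight-step (storeℕ a b)   p m _ = ≡.refl
  straight-step (oneᴿ a)       p m _ = ≡.refl
  straight-step (addᴿ a b c)   p m _ = ≡.refl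
  straight-step (subᴿ a b c)   p m _ = ≡.refl
  straight-step (mulᴿ a b c)   p m _ = ≡.refl
  straight-step (divᴿ a b c)   p m _ = ≡.refl
  straight-step (loadᴿ a b)    p m _ = ≡.refl
  straight-step (storeᴿ a b)   p m _ = ≡.refl

  T-∧ : ∀ {a b} → T (a ∧ b) → T a × T b
  T-∧ {true} {true} _ = tt , tt

  ∨-left : ∀ {x y} → T x → T (x ∨ y)
  ∨-left {true} _ = tt

  ∨-right : ∀ x {y} → T y → T (x ∨ y)
  ∨-right true  _  = tt
  ∨-right false ok = ok

  run-reaches : ∀ {P p} is m → T (all straight is) → Contains P p is →
                Reaches P (at p m) (length is) (at (p ℕ.+ length is) (run is m))
  run-reaches {P} {p} [] m _ _ d = ≡.subst (λ p → P ⊢ at p m ⇓[ _ ] _) (ℕ.+-identityʳ p) d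
  run-reaches {P} {p} (i ∷ is) m ok con {u} {e} d = next (fetch-head con)
    (≡.subst (λ c → P ⊢ c ⇓[ length is ℕ.+ u ] e) (≡.sym (straight-step i p m (proj₁ (T-∧ ok))))
      (run-reaches is (effect i m) (proj₂ (T-∧ ok)) (contains-tail con)
        (≡.subst (λ p → P ⊢ at p (run is (effect i m)) ⇓[ u ] e) (ℕ.+-suc p (length is)) d)))

  jump-taken : ∀ b l p m → holds b m ≡ true → execute (jump b l) (at p m) ≡ at l m
  jump-taken (leqℕ a b) l p m eq rewrite eq = ≡.refl
  jump-taken (leqᴿ a b) l p m eq rewrite eq = ≡.refl

  jump-passed : ∀ b l p m → holds b m ≡ false → execute (jump b l) (at p m) ≡ at (suc p) m
  jump-passed (leqℕ a b) l p m eq rewrite eq = ≡.refl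
  jump-passed (leqᴿ a b) l p m eq rewrite eq = ≡.refl

  ≤ᵇ-refl : ∀ x → (x ℕ.≤ᵇ x) ≡ true
  ≤ᵇ-refl zero          = ≡.refl
  ≤ᵇ-refl (suc zero)    = ≡.refl
  ≤ᵇ-refl (suc (suc x)) = ≤ᵇ-refl (suc x)

  correct : ∀ {P c m t m′} p → c ⊢ m ⇒[ t ] m′ → Contains P p (compile p c) →
            Reaches P (at p m) t (at (p ℕ.+ size c) m′)
  correct p (block {is} {m} ok) con = run-reaches is m ok con
  correct {P} p (_⨾_ {c} {c′} {m} {m′} {m″} {t} {u} d d′) con = reaches-trans (correct p d (contains-++ˡ _ con))
    (≡.subst (λ q → Reaches P (at (p ℕ.+ size c) m′) u (at q m″)) (ℕ.+-assoc p (size c) (size c′))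
      (correct (p ℕ.+ size c) d′ (≡.subst (λ q → Contains P (p ℕ.+ q) (compile (p ℕ.+ size c) c′))
          (length-compile p c) (contains-++ʳ (compile p c) con))))
  correct {P} p (skip {b} {c} {m} eq) con {u} {e} d = next (fetch-head con)
    (≡.subst (λ c → P ⊢ c ⇓[ u ] e) (≡.sym (jump-taken b _ p m eq)) d)
  correct {P} p (enter {b} {c} {m} {m′} {t} eq run) con {u} {e} d = next (fetch-head con)
    (≡.subst (λ c → P ⊢ c ⇓[ t ℕ.+ u ] e) (≡.sym (jump-passed b _ p m eq))
      (correct (suc p) run (contains-tail con) (≡.subst (λ p → P ⊢ at p m′ ⇓[ u ] e) (ℕ.+-suc p (size c)) d)))
  correct {P} p (stop {b} {c} {m} eq) con {u} {e} d = next (fetch-head con)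
    (≡.subst (λ c → P ⊢ c ⇓[ u ] e) (≡.sym (jump-taken b _ p m eq)) d)
  correct {P} p (repeat {b} {c} {m} {m′} {m″} {t} {t′} eq run rest) con {u} {e} d = next (fetch-head con)
    (≡.subst (λ c → P ⊢ c ⇓[ t ℕ.+ suc t′ ℕ.+ u ] e) (≡.sym (jump-passed b _ p m eq))
      (≡.subst (λ t → P ⊢ at (suc p) m ⇓[ t ] e) (≡.sym (ℕ.+-assoc t (suc t′) u))
        (correct (suc p) run (contains-++ˡ _ (contains-tail con))
          (next (fetch-head (≡.subst (λ q → Contains P (suc p ℕ.+ q) _) (length-compile (suc p) c)
              (contains-++ʳ (compile (suc p) c) (contains-tail con))))
            (≡.subst (λ c → P ⊢ c ⇓[ t′ ℕ.+ u ] e) (≡.sym (jump-taken (leqℕ 0 0) p _ m′ (≤ᵇ-refl (nat m′ 0))))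
              (correct p rest con d))))))

  halts : ∀ {c m t m′} → c ⊢ m ⇒[ t ] m′ → compile 0 c ⊢ at 0 m ⇓[ t ] at (size c) m′
  halts {c} {m} {t} {m′} run = ≡.subst (λ t → compile 0 c ⊢ at 0 m ⇓[ t ] at (size c) m′) (ℕ.+-identityʳ t)
      (correct 0 run (contains [] [] (≡.sym (List.++-identityʳ _)) ≡.refl)
        (halt (≡.trans (≡.cong (fetch (compile 0 c)) (≡.sym (length-compile 0 c))) (end (compile 0 c)))))
    where
    end : ∀ (is : Program) → fetch is (length is) ≡ nothing
    end []       = ≡.refl
    end (_ ∷ is) = end is

  -- Total correctness with time bounds, and frames

  Spec : Cmd → Mem → ℕ → (Mem → Set) → Set
  Spec c m b Q = ∃ λ m′ → ∃ λ t → c ⊢ m ⇒[ t ] m′ × t ℕ.≤ b × Q m′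

  spec-block : ∀ is {m Q} {_ : T (all straight is)} → Q (run is m) → Spec (block is) m (length is) Q
  spec-block is {ok} {_} {ok′} q = _ , _ , block ok′ , ℕ.≤-refl , q

  spec-seq : ∀ {c c′ m b b′ Q Q′} → Spec c m b Q → (∀ m′ → Q m′ → Spec c′ m′ b′ Q′) → Spec (c ⨾ c′) m (b ℕ.+ b′) Q′
  spec-seq (m′ , t , run , t≤b , q) rest with rest m′ q
  ... | m″ , u , run′ , u≤b′ , q′ = m″ , t ℕ.+ u , (run ⨾ run′) , ℕ.+-mono-≤ t≤b u≤b′ , q′

  spec-weaken : ∀ {c m b b′ Q Q′} → b ℕ.≤ b′ → (∀ m′ → Q m′ → Q′ m′) → Spec c m b Q → Spec c m b′ Q′
  spec-weaken b≤b′ Q⊆Q′ (m′ , t , run , t≤b , q) = m′ , t , run , ℕ.≤-trans t≤b b≤b′ , Q⊆Q′ m′ q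

  spec-unless : ∀ b {c m k Q} → (holds b m ≡ true → Q m) → (holds b m ≡ false → Spec c m k Q) → Spec (unless b c) m
      (suc k) Q
  spec-unless b {c} {m} {k} {Q} yes-case no-case with holds b m in eq
  ... | true  = m , 1 , skip eq , s≤s z≤n , yes-case ≡.refl
  ... | false with no-case ≡.refl
  ...   | m′ , t , run , t≤k , q = m′ , suc t , enter eq run , s≤s t≤k , q

  private
    cost-step : ∀ {t u b k} → t ℕ.≤ b → u ℕ.≤ k → suc (t ℕ.+ suc u) ℕ.≤ b ℕ.+ 2 ℕ.+ k
    cost-step {t} {u} {b} {k} t≤b u≤k = ℕ.≤-trans (s≤s (ℕ.≤-reflexive (ℕ.+-suc t u)))
      (ℕ.≤-trans (s≤s (s≤s (ℕ.+-mono-≤ t≤b u≤k))) (ℕ.≤-reflexive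
          (≡.trans (≡.sym (ℕ.+-assoc 2 b k)) (≡.cong (ℕ._+ k) (ℕ.+-comm 2 b)))))

  -- The index of the invariant counts the remaining iterations.
  spec-down : ∀ test {c b} (I : ℕ → Mem → Set) →
              (∀ m → I 0 m → holds test m ≡ true) →
              (∀ j m → I (suc j) m → holds test m ≡ false × Spec c m b (I j)) →
              ∀ j {m} → I j m → Spec (until test c) m (j ℕ.* (b ℕ.+ 2) ℕ.+ 1) (I 0)
  spec-down test I done body zero {m} i = m , 1 , stop (done m i) , ℕ.≤-refl , i
  spec-down test {c} {b} I done body (suc j) {m} i with body j m i
  ... | eq , m′ , t , run , t≤b , i′ with spec-down test I done body j i′
  ...   | m″ , u , run′ , u≤ , i″ = m″ , _ , repeat eq run run′ ,
            ℕ.≤-trans (cost-step t≤b u≤) (ℕ.≤-reflexive (≡.sym (ℕ.+-assoc (b ℕ.+ 2) (j ℕ.* (b ℕ.+ 2)) 1))) , i″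

  spec-up : ∀ test {c b} k (I : ℕ → Mem → Set) →
            (∀ m → I k m → holds test m ≡ true) →
            (∀ i m → i ℕ.< k → I i m → holds test m ≡ false × Spec c m b (I (suc i))) →
            ∀ {m} → I 0 m → Spec (until test c) m (k ℕ.* (b ℕ.+ 2) ℕ.+ 1) (I k)
  spec-up test {c} {b} k I done body i₀ = spec-weaken ℕ.≤-refl finish
      (spec-down test J (λ m (i , i+0≡k , Ii) → done m
          (≡.subst (λ i → I i m) (≡.trans (≡.sym (ℕ.+-identityʳ i)) i+0≡k) Ii)) step k (0 , ≡.refl , i₀))
    where
    J : ℕ → Mem → Set
    J j m = ∃ λ i → i ℕ.+ j ≡ k × I i m
    finish : ∀ m → J 0 m → I k m
    finish m (i , i+0≡k , Ii) = ≡.subst (λ i → I i m) (≡.trans (≡.sym (ℕ.+-identityʳ i)) i+0≡k) Ii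
    step : ∀ j m → J (suc j) m → holds test m ≡ false × Spec c m b (J j)
    step j m (i , i+1+j≡k , Ii) with body i m (ℕ.m+n≤o⇒m≤o (suc i)
        (ℕ.≤-reflexive (≡.trans (≡.sym (ℕ.+-suc i j)) i+1+j≡k))) Ii
    ... | eq , spec = eq , spec-weaken ℕ.≤-refl (λ m′ I′ → suc i , ≡.trans (≡.sym (ℕ.+-suc i j)) i+1+j≡k , I′) spec

  -- For loops whose exit depends on real numbers: the body shows `i < k` whenever the test fails,
  -- and `k` bounds the iterations without fixing their number.
  spec-while : ∀ test {c b} k (I : ℕ → Mem → Set) →
               (∀ i m → I i m → holds test m ≡ false → i ℕ.< k × Spec c m b (I (suc i))) →
               ∀ {m} → I 0 m → Spec (until test c) m (k ℕ.* (b ℕ.+ 2) ℕ.+ 1)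
                   (λ m′ → holds test m′ ≡ true × ∃ λ i → i ℕ.≤ k × I i m′)
  spec-while test {c} {b} k I body i₀ = go k 0 ≡.refl i₀
    where
    go : ∀ j i {m} → i ℕ.+ j ≡ k → I i m →
         Spec (until test c) m (j ℕ.* (b ℕ.+ 2) ℕ.+ 1) (λ m′ → holds test m′ ≡ true × ∃ λ i → i ℕ.≤ k × I i m′)
    go j i {m} i+j≡k Ii with holds test m in eq
    ... | true = m , 1 , stop eq , ℕ.m≤n+m 1 (j ℕ.* (b ℕ.+ 2)) , eq , i , ℕ.m+n≤o⇒m≤o i (ℕ.≤-reflexive i+j≡k) , Ii
    ... | false with j | body i m Ii eq
    ...   | zero  | i<k , _ = contradiction (≡.subst (i ℕ.<_) (≡.trans (≡.sym i+j≡k) (ℕ.+-identityʳ i)) i<k)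
        (ℕ.<-irrefl ≡.refl)
    ...   | suc j | _ , m′ , t , run , t≤b , I′ with go j (suc i) (≡.trans (≡.sym (ℕ.+-suc i j)) i+j≡k) I′
    ...     | m″ , u , run′ , u≤ , q = m″ , _ , repeat eq run run′ ,
                ℕ.≤-trans (cost-step t≤b u≤) (ℕ.≤-reflexive (≡.sym (ℕ.+-assoc (b ℕ.+ 2) (j ℕ.* (b ℕ.+ 2)) 1))) , q

  -- The registers c, …, 31 and the real register 0 are scratch.
  record Frame (c : ℕ) (m m′ : Mem) : Set where
    constructor frame
    field
      nats  : ∀ a → T ((a ℕ.<ᵇ c) ∨ (31 ℕ.<ᵇ a)) → nat m′ a ≡ nat m a
      reals : ∀ a → T (((0 ℕ.<ᵇ a) ∧ (a ℕ.<ᵇ c)) ∨ (31 ℕ.<ᵇ a)) → real m′ a ≡ real m a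

  open Frame public

  frame-refl : ∀ {c m} → Frame c m m
  frame-refl = frame (λ _ _ → ≡.refl) (λ _ _ → ≡.refl)

  frame-trans : ∀ {c m m′ m″} → Frame c m m′ → Frame c m′ m″ → Frame c m m″
  frame-trans f g = frame (λ a ok → ≡.trans (nats g a ok) (nats f a ok))
      (λ a ok → ≡.trans (reals g a ok) (reals f a ok))

  private
    ∨-map : ∀ x y z → (T x → T z) → T (x ∨ y) → T (z ∨ y)
    ∨-map true  y z f _ with z | f tt
    ... | true | _ = tt
    ∨-map false y true  f ok = tt
    ∨-map false y false f ok = ok

    less-mono : ∀ c c′ → T (c ℕ.≤ᵇ c′) → ∀ a → T (a ℕ.<ᵇ c) → T (a ℕ.<ᵇ c′)
    less-mono c c′ c≤c′ a a<c = ℕ.<⇒<ᵇ (ℕ.<-≤-trans (ℕ.<ᵇ⇒< a c a<c) (ℕ.≤ᵇ⇒≤ c c′ c≤c′))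

  preserved-nat : ∀ c c′ → T (c ℕ.≤ᵇ c′) → ∀ a → T ((a ℕ.<ᵇ c) ∨ (31 ℕ.<ᵇ a)) → T ((a ℕ.<ᵇ c′) ∨ (31 ℕ.<ᵇ a))
  preserved-nat c c′ c≤c′ a = ∨-map (a ℕ.<ᵇ c) (31 ℕ.<ᵇ a) (a ℕ.<ᵇ c′) (less-mono c c′ c≤c′ a)

  preserved-real : ∀ c c′ → T (c ℕ.≤ᵇ c′) → ∀ a →
                   T (((0 ℕ.<ᵇ a) ∧ (a ℕ.<ᵇ c)) ∨ (31 ℕ.<ᵇ a)) → T (((0 ℕ.<ᵇ a) ∧ (a ℕ.<ᵇ c′)) ∨ (31 ℕ.<ᵇ a))
  preserved-real c c′ c≤c′ zero    ok = ok
  preserved-real c c′ c≤c′ (suc a) ok =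
    ∨-map (suc a ℕ.<ᵇ c) (31 ℕ.<ᵇ suc a) (suc a ℕ.<ᵇ c′) (less-mono c c′ c≤c′ (suc a)) ok

  frame-weaken : ∀ c {c′ m m′} {_ : T (c ℕ.≤ᵇ c′)} → Frame c′ m m′ → Frame c m m′
  frame-weaken c {c′} {_} {_} {c≤c′} f =
    frame (λ a ok → nats f a (preserved-nat c c′ c≤c′ a ok)) (λ a ok → reals f a (preserved-real c c′ c≤c′ a ok))

  module _ {A : Set} (f : ℕ → A) where

    ≔-same : ∀ a {v} → (f [ a ≔ v ]) a ≡ v
    ≔-same a with a ℕ.≡ᵇ a in eq
    ... | true  = ≡.refl
    ... | false = contradiction (≡.subst T eq (ℕ.≡⇒≡ᵇ a a ≡.refl)) λ ()

    ≔-other : ∀ a b {v} → ¬ a ≡ b → (f [ a ≔ v ]) b ≡ f b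
    ≔-other a b a≢b with a ℕ.≡ᵇ b in eq
    ... | true  = contradiction (ℕ.≡ᵇ⇒≡ a b (≡.subst T (≡.sym eq) tt)) a≢b
    ... | false = ≡.refl

  -- Lets evaluation prove that a block touches scratch registers only. Stores are rejected because
  -- their target is not visible in the code.
  writes : ℕ → Instruction → Bool
  writes c (setℕ a _)    = (c ℕ.≤ᵇ a) ∧ (a ℕ.≤ᵇ 31)
  writes c (addℕ a _ _)  = (c ℕ.≤ᵇ a) ∧ (a ℕ.≤ᵇ 31)
  writes c (subℕ a _ _)  = (c ℕ.≤ᵇ a) ∧ (a ℕ.≤ᵇ 31)
  writes c (loadℕ a _)   = (c ℕ.≤ᵇ a) ∧ (a ℕ.≤ᵇ 31)
  writes c (oneᴿ a)      = (c ℕ.≤ᵇ a) ∧ (a ℕ.≤ᵇ 31)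
  writes c (addᴿ a _ _)  = (c ℕ.≤ᵇ a) ∧ (a ℕ.≤ᵇ 31)
  writes c (subᴿ a _ _)  = (c ℕ.≤ᵇ a) ∧ (a ℕ.≤ᵇ 31)
  writes c (mulᴿ a _ _)  = (c ℕ.≤ᵇ a) ∧ (a ℕ.≤ᵇ 31)
  writes c (divᴿ a _ _)  = (c ℕ.≤ᵇ a) ∧ (a ℕ.≤ᵇ 31)
  writes c (loadᴿ a _)   = (c ℕ.≤ᵇ a) ∧ (a ℕ.≤ᵇ 31)
  writes c _             = false

  private
    T-∨-elim : ∀ {x y} → T (x ∨ y) → T x ⊎ T y
    T-∨-elim {true}  _  = inj₁ tt
    T-∨-elim {false} ok = inj₂ ok

    distinct : ∀ c a b → T ((c ℕ.≤ᵇ a) ∧ (a ℕ.≤ᵇ 31)) → T ((b ℕ.<ᵇ c)) ⊎ T ((31 ℕ.<ᵇ b)) → ¬ a ≡ b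
    distinct c a b ok (inj₁ b<c) ≡.refl = ℕ.<⇒≱ (ℕ.<ᵇ⇒< a c b<c) (ℕ.≤ᵇ⇒≤ c a (proj₁ (T-∧ ok)))
    distinct c a b ok (inj₂ 31<b) ≡.refl = ℕ.<⇒≱ (ℕ.<ᵇ⇒< 31 a 31<b) (ℕ.≤ᵇ⇒≤ a 31 (proj₂ (T-∧ {(c ℕ.≤ᵇ a)} ok)))

    outside : ∀ c b → T (((0 ℕ.<ᵇ b) ∧ (b ℕ.<ᵇ c)) ∨ (31 ℕ.<ᵇ b)) → T ((b ℕ.<ᵇ c)) ⊎ T ((31 ℕ.<ᵇ b))
    outside c b ok with T-∨-elim {(0 ℕ.<ᵇ b) ∧ (b ℕ.<ᵇ c)} ok
    ... | inj₁ p = inj₁ (proj₂ (T-∧ {(0 ℕ.<ᵇ b)} p))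
    ... | inj₂ p = inj₂ p

    frame-nat : ∀ {c m} a v → T ((c ℕ.≤ᵇ a) ∧ (a ℕ.≤ᵇ 31)) → Frame c m (mem (nat m [ a ≔ v ]) (real m))
    frame-nat {c} {m} a v ok = frame (λ b out → ≔-other (nat m) a b (distinct c a b ok (T-∨-elim out))) (λ _ _ → ≡.refl)

    frame-real : ∀ {c m} a v → T ((c ℕ.≤ᵇ a) ∧ (a ℕ.≤ᵇ 31)) → Frame c m (mem (nat m) (real m [ a ≔ v ]))
    frame-real {c} {m} a v ok = frame (λ _ _ → ≡.refl)
        (λ b out → ≔-other (real m) a b (distinct c a b ok (outside c b out)))

    frame-effect : ∀ {c m} i → T (writes c i) → Frame c m (effect i m)
    frame-effect (setℕ a _)   = frame-nat a _
    frame-effect (addℕ a _ _) = frame-nat a _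
    frame-effect (subℕ a _ _) = frame-nat a _
    frame-effect (loadℕ a _)  = frame-nat a _
    frame-effect (oneᴿ a)     = frame-real a _
    frame-effect (addᴿ a _ _) = frame-real a _
    frame-effect (subᴿ a _ _) = frame-real a _
    frame-effect (mulᴿ a _ _) = frame-real a _
    frame-effect (divᴿ a _ _) = frame-real a _
    frame-effect (loadᴿ a _)  = frame-real a _

  frame-run : ∀ c is {m} {_ : T (all (writes c) is)} → Frame c m (run is m)
  frame-run c []       = frame-refl
  frame-run c (i ∷ is) {m} {ok} = frame-trans (frame-effect i (proj₁ (T-∧ ok)))
      (frame-run c is {effect i m} {proj₂ (T-∧ {writes c i} ok)})

-- The real RAM program

module Algorithm (em : ExcludedMiddle 0ℓ) (ℝ : Reals) where

  open StructuredPrograms em ℝ public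
  open Packing em ℝ public using (K)

  -- Registers of naturals: 0, 1, 2 hold n, d, k; 3, 4, 8 the constants 1, 32, 0; 5 and 6 the
  -- addresses of the array D of squared distances and of the output; 7 holds 4 k.  N[32 + y] is
  -- the address of the point y.  Registers of reals: 0 is scratch; 1, 2, 3 hold 0, 2³², 256;
  -- 4 holds ε and 5 holds 1 - 1/k.
  distanceTo : ℕ → ℕ → Cmd
  distanceTo a b =
    block (addℕ 24 4 a ∷ loadℕ 25 24 ∷ addℕ 24 4 b ∷ loadℕ 26 24 ∷ setℕ 27 0 ∷ addᴿ 24 1 1 ∷ []) ⨾
    until (leqℕ 1 27) (block (loadᴿ 25 25 ∷ loadᴿ 26 26 ∷ subᴿ 25 25 26 ∷ mulᴿ 25 25 25 ∷ addᴿ 24 24 25 ∷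
                              addℕ 25 3 25 ∷ addℕ 26 3 26 ∷ addℕ 27 3 27 ∷ []))

  -- The body leaves its term in R[21]. Adding R[1] = 0, or N[8] = 0 for naturals, is how values are
  -- moved between registers.
  sumOver : Cmd → Cmd
  sumOver body =
    block (setℕ 20 0 ∷ addᴿ 20 1 1 ∷ []) ⨾
    until (leqℕ 0 20) (body ⨾ block (addᴿ 20 20 21 ∷ addℕ 20 3 20 ∷ []))

  -- `score` puts the score of candidate N[15] into R[20]; N[16] keeps the best index. Candidate 0
  -- is scored once in advance to initialise the minimum.
  argmin : Cmd → Cmd
  argmin score =
    block (setℕ 15 0 ∷ []) ⨾ score ⨾ block (addᴿ 15 20 1 ∷ setℕ 16 0 ∷ []) ⨾
    until (leqℕ 0 15) (score ⨾ unless (leqᴿ 15 20) (block (addᴿ 15 20 1 ∷ addℕ 16 8 15 ∷ [])) ⨾ block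
        (addℕ 15 3 15 ∷ []))

  -- Summing `min (K q, D x) - D x` yields `-K` times the value of the isolated ball at `x`, so a
  -- search for a minimum finds the heaviest ball without any division. The median sum is restricted
  -- by `K q ≤ 256 D x` for the same reason.
  isolation medianCost greedyCost : Cmd
  isolation =
    block (addℕ 17 5 15 ∷ loadᴿ 17 17 ∷ []) ⨾
    sumOver (distanceTo 15 20 ⨾ block (mulᴿ 21 2 24 ∷ []) ⨾ unless (leqᴿ 21 17) (block (addᴿ 21 17 1 ∷ [])) ⨾ block
        (subᴿ 21 21 17 ∷ []))
  medianCost =
    sumOver (distanceTo 15 20 ⨾ block (addᴿ 21 24 1 ∷ []) ⨾ distanceTo 12 20 ⨾ block (mulᴿ 22 2 24 ∷ []) ⨾
             unless (leqᴿ 22 12) (block (addᴿ 21 1 1 ∷ [])))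
  greedyCost =
    sumOver (distanceTo 15 20 ⨾ block (addᴿ 21 24 1 ∷ addℕ 22 5 20 ∷ loadᴿ 22 22 ∷ []) ⨾ unless (leqᴿ 21 22)
        (block (addᴿ 21 22 1 ∷ [])))

  initialise relaxAll : Cmd
  initialise =
    block (setℕ 15 0 ∷ setℕ 20 0 ∷ []) ⨾
    until (leqℕ 0 20) (distanceTo 15 20 ⨾ block (addℕ 21 5 20 ∷ []) ⨾ block (storeᴿ 21 24 ∷ addℕ 20 3 20 ∷ []))
  relaxAll =
    block (setℕ 20 0 ∷ []) ⨾
    until (leqℕ 0 20) (distanceTo 16 20 ⨾ block (addℕ 21 5 20 ∷ loadᴿ 22 21 ∷ []) ⨾
                       unless (leqᴿ 22 24) (block (addᴿ 22 24 1 ∷ [])) ⨾ block (storeᴿ 21 22 ∷ addℕ 20 3 20 ∷ []))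

  coverStep greedyStep : Cmd
  coverStep  = argmin isolation ⨾ block (addℕ 12 8 16 ∷ addℕ 13 5 12 ∷ loadᴿ 12 13 ∷ mulᴿ 12 3 12 ∷ []) ⨾ argmin
      medianCost ⨾ relaxAll
  greedyStep = argmin greedyCost ⨾ relaxAll

  coverPhase greedyPhase : Cmd
  coverPhase  = block (setℕ 10 0 ∷ []) ⨾ until (leqℕ 7 10) (coverStep ⨾ block (addℕ 10 3 10 ∷ []))
  greedyPhase = block (addᴿ 10 2 2 ∷ addᴿ 10 10 10 ∷ []) ⨾ until (leqᴿ 10 4) (greedyStep ⨾ block (mulᴿ 10 10 5 ∷ []))

  -- Copies N[26] cells from address N[24] to address N[25], last cell first.
  copy : Cmd
  copy = until (leqℕ 26 8) (block (subℕ 26 26 3 ∷ addℕ 27 24 26 ∷ loadᴿ 0 27 ∷ addℕ 28 25 26 ∷ storeᴿ 28 0 ∷ []))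

  -- The input occupies the low registers, so it is first moved out of the way.
  setup : Cmd
  setup =
    block (setℕ 3 1 ∷ setℕ 4 32 ∷ addℕ 7 2 2 ∷ addℕ 7 7 7 ∷ []) ⨾
    -- The product `n d` by repeated addition, as naturals cannot be multiplied.
    until (leqℕ 0 10) (block (addℕ 9 1 9 ∷ addℕ 10 3 10 ∷ [])) ⨾
    -- The points go to `32 + n d` onwards, beyond their old cells. `ε` is stored behind them,
    -- because copying uses R[0] as scratch.
    block (addℕ 10 4 9 ∷ addℕ 11 10 9 ∷ addℕ 5 3 11 ∷ addℕ 6 5 0 ∷ storeᴿ 11 0 ∷
           setℕ 24 1 ∷ addℕ 25 8 10 ∷ addℕ 26 8 9 ∷ []) ⨾
    copy ⨾
    block (setℕ 12 0 ∷ addℕ 13 8 10 ∷ []) ⨾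
    until (leqℕ 0 12) (block (addℕ 14 4 12 ∷ storeℕ 14 13 ∷ []) ⨾ block (addℕ 13 1 13 ∷ addℕ 12 3 12 ∷ []))

  -- Squaring runs through 2, 4, 16, 256, 65536 and 2³², with 256 saved on the way. The real number
  -- `k` is built by counting, since naturals are not converted to reals.
  constants : Cmd
  constants =
    block (oneᴿ 6 ∷ subᴿ 1 6 6 ∷ addᴿ 2 6 6 ∷ mulᴿ 2 2 2 ∷ mulᴿ 2 2 2 ∷ mulᴿ 2 2 2 ∷ addᴿ 3 2 1 ∷
           mulᴿ 2 2 2 ∷ mulᴿ 2 2 2 ∷ loadᴿ 4 11 ∷ addᴿ 5 1 1 ∷ setℕ 12 0 ∷ []) ⨾
    until (leqℕ 2 12) (block (addᴿ 5 5 6 ∷ addℕ 12 3 12 ∷ [])) ⨾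
    block (divᴿ 5 6 5 ∷ subᴿ 5 6 5 ∷ [])

  -- The chosen centres are exactly the points at distance zero from the centres.
  output : Cmd
  output =
    block (setℕ 10 0 ∷ addℕ 11 8 6 ∷ setℕ 20 0 ∷ []) ⨾
    until (leqℕ 0 20)
      -- Copying is due when `D y ≤ 0`, but `unless` runs its body when the test fails; the flag
      -- N[22] negates the comparison.
      (block (addℕ 21 5 20 ∷ loadᴿ 22 21 ∷ setℕ 22 1 ∷ []) ⨾
       unless (leqᴿ 22 1) (block (setℕ 22 0 ∷ [])) ⨾
       unless (leqℕ 22 8) (block (addℕ 21 4 20 ∷ loadℕ 24 21 ∷ addℕ 25 8 11 ∷ addℕ 26 8 1 ∷ []) ⨾ copy ⨾
                           block (addℕ 11 1 11 ∷ addℕ 10 3 10 ∷ [])) ⨾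
       block (addℕ 20 3 20 ∷ [])) ⨾
    block (addℕ 24 8 6 ∷ setℕ 25 0 ∷ subℕ 26 11 6 ∷ addℕ 0 8 10 ∷ []) ⨾
    copy

  program : Cmd
  program = setup ⨾ constants ⨾ initialise ⨾ coverPhase ⨾ greedyPhase ⨾ output

-- Memory layout and the inner loops

module Loops (em : ExcludedMiddle 0ℓ) (ℝ : Reals) (n d k : ℕ) .{{_ : NonZero n}} .{{_ : NonZero d}} .{{_ : NonZero k}}
             (pt : ℕ → ℕ → KMeans.Carrier em ℝ) (ε : KMeans.Carrier em ℝ) where

  open KMeans em ℝ
  open OrderedField em ℝ
  open Algorithm em ℝ
  open Solver using (solve; _:=_; _:+_; _:*_; _:-_; :-_)

  sq : Carrier → Carrier
  sq x = x * x

  q : ℕ → ℕ → Carrier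
  q x y = ∑ d λ l → sq (pt x l - pt y l)

  nd : ℕ
  nd = n ℕ.* d

  -- The address of D y.
  slot : ℕ → ℕ
  slot y = 33 ℕ.+ (nd ℕ.+ nd ℕ.+ y)

  -- What both phases leave unchanged. `k⁻¹` expresses R[5] = `1 - 1/k` without an inverse.
  record Base (m : Mem) : Set where
    field
      n≡     : nat m 0 ≡ n
      d≡     : nat m 1 ≡ d
      k≡     : nat m 2 ≡ k
      one≡   : nat m 3 ≡ 1
      32≡    : nat m 4 ≡ 32
      D≡     : nat m 5 ≡ 33 ℕ.+ (nd ℕ.+ nd)
      out≡   : nat m 6 ≡ 33 ℕ.+ (nd ℕ.+ nd ℕ.+ n)
      4k≡    : nat m 7 ≡ k ℕ.+ k ℕ.+ (k ℕ.+ k)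
      zero≡  : nat m 8 ≡ 0
      table  : ∀ y → y ℕ.< n → nat m (32 ℕ.+ y) ≡ 32 ℕ.+ (nd ℕ.+ y ℕ.* d)
      cells  : ∀ y l → y ℕ.< n → l ℕ.< d → real m (32 ℕ.+ (nd ℕ.+ (y ℕ.* d ℕ.+ l))) ≡ pt y l
      zero≈  : real m 1 ≈ 0#
      K≈     : real m 2 ≈ num K
      256≈   : real m 3 ≈ num 256
      ε≡     : real m 4 ≡ ε
      k⁻¹    : num k * (1# - real m 5) ≈ 1#

  open Base

  -- A frame that leaves the reals from the array D on unspecified.
  record FrameD (c : ℕ) (m m′ : Mem) : Set where
    constructor frameD
    field
      natsD  : ∀ a → T ((a ℕ.<ᵇ c) ∨ (31 ℕ.<ᵇ a)) → nat m′ a ≡ nat m a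
      realsD : ∀ a → T (((0 ℕ.<ᵇ a) ∧ (a ℕ.<ᵇ c)) ∨ (31 ℕ.<ᵇ a)) → a ℕ.< 33 ℕ.+ (nd ℕ.+ nd) → real m′ a ≡ real m a

  open FrameD

  forget : ∀ {c m m′} → Frame c m m′ → FrameD c m m′
  forget f = frameD (nats f) λ a ok _ → reals f a ok

  frameD-trans : ∀ {c m m′ m″} → FrameD c m m′ → FrameD c m′ m″ → FrameD c m m″
  frameD-trans f g = frameD (λ a ok → ≡.trans (natsD g a ok) (natsD f a ok))
      (λ a ok off → ≡.trans (realsD g a ok off) (realsD f a ok off))

  cell< : ∀ {y l} → y ℕ.< n → l ℕ.< d → y ℕ.* d ℕ.+ l ℕ.< nd
  cell< {y} {l} y<n l<d = ℕ.<-≤-trans (ℕ.+-monoʳ-< (y ℕ.* d) l<d)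
      (ℕ.≤-trans (ℕ.≤-reflexive (ℕ.+-comm (y ℕ.* d) d)) (ℕ.*-monoˡ-≤ d y<n))

  low<D : ∀ a {_ : T (a ℕ.<ᵇ 33)} → a ℕ.< 33 ℕ.+ (nd ℕ.+ nd)
  low<D a {a<33} = ℕ.<-≤-trans (ℕ.<ᵇ⇒< a 33 a<33) (ℕ.m≤m+n 33 _)

  base-frameD : ∀ {m m′} → FrameD 9 m m′ → Base m → Base m′
  base-frameD f b = record
    { n≡ = ≡.trans (natsD f 0 _) (n≡ b) ; d≡ = ≡.trans (natsD f 1 _) (d≡ b) ; k≡ = ≡.trans (natsD f 2 _) (k≡ b)
    ; one≡ = ≡.trans (natsD f 3 _) (one≡ b) ; 32≡ = ≡.trans (natsD f 4 _) (32≡ b) ; D≡ = ≡.trans (natsD f 5 _) (D≡ b)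
    ; out≡ = ≡.trans (natsD f 6 _) (out≡ b) ; 4k≡ = ≡.trans (natsD f 7 _) (4k≡ b) ; zero≡ = ≡.trans (natsD f 8 _)
        (zero≡ b)
    ; table = λ y y<n → ≡.trans (natsD f (32 ℕ.+ y) _) (table b y y<n)
    ; cells = λ y l y<n l<d → ≡.trans (realsD f _ _
        (s≤s (ℕ.+-monoʳ-≤ 32 (ℕ.+-monoʳ-≤ nd (ℕ.<⇒≤ (cell< y<n l<d)))))) (cells b y l y<n l<d)
    ; zero≈ = trans (reflexive (realsD f 1 _ (low<D 1))) (zero≈ b) ; K≈ = trans
        (reflexive (realsD f 2 _ (low<D 2))) (K≈ b)
    ; 256≈ = trans (reflexive (realsD f 3 _ (low<D 3))) (256≈ b) ; ε≡ = ≡.trans (realsD f 4 _ (low<D 4)) (ε≡ b)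
    ; k⁻¹ = trans (*-congˡ (+-congˡ (-‿cong (reflexive (realsD f 5 _ (low<D 5)))))) (k⁻¹ b) }

  base-frame : ∀ c {m m′} {_ : T (9 ℕ.≤ᵇ c)} → Frame c m m′ → Base m → Base m′
  base-frame c {_} {_} {9≤c} f = base-frameD (forget (frame-weaken 9 {_} {_} {_} {9≤c} f))

  Holds-D : (ℕ → Carrier) → Mem → Set
  Holds-D D m = ∀ y → y ℕ.< n → real m (slot y) ≈ D y

  D-frame : ∀ {c D m m′} → Frame c m m′ → Holds-D D m → Holds-D D m′
  D-frame {c} f D≈ y y<n = trans (reflexive (reals f (slot y) (∨-right ((0 ℕ.<ᵇ slot y) ∧ (slot y ℕ.<ᵇ c)) tt)))
      (D≈ y y<n)

  ≤ᵇ-true : ∀ {a b x y} → a ≡ x → b ≡ y → x ℕ.≤ y → (a ℕ.≤ᵇ b) ≡ true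
  ≤ᵇ-true {a} {b} ≡.refl ≡.refl a≤b with a ℕ.≤ᵇ b in eq
  ... | true  = ≡.refl
  ... | false = contradiction (≡.subst T eq (ℕ.≤⇒≤ᵇ a≤b)) λ ()

  ≤ᵇ-false : ∀ {a b x y} → a ≡ x → b ≡ y → y ℕ.< x → (a ℕ.≤ᵇ b) ≡ false
  ≤ᵇ-false {a} {b} ≡.refl ≡.refl b<a with a ℕ.≤ᵇ b in eq
  ... | false = ≡.refl
  ... | true  = contradiction (ℕ.≤ᵇ⇒≤ a b (≡.subst T (≡.sym eq) tt)) (ℕ.<⇒≱ b<a)

  em-true : ∀ {P : Set} → Dec.does (em {P}) ≡ true → P
  em-true {P} eq with em {P}
  em-true     _  | yes p = p

  em-false : ∀ {P : Set} → Dec.does (em {P}) ≡ false → ¬ P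
  em-false {P} eq with em {P}
  em-false     _  | no ¬p = ¬p

  -- Folds the lower-order costs of a nested loop into a multiple of the leading product, using that
  -- both factors are at least 1.
  nest : ∀ e a b n x .{{_ : NonZero n}} .{{_ : NonZero x}} →
         e ℕ.+ (n ℕ.* (b ℕ.* x ℕ.+ a ℕ.+ 2) ℕ.+ 1) ℕ.≤ (3 ℕ.+ (e ℕ.+ a ℕ.+ b)) ℕ.* (n ℕ.* x)
  nest e a b n x = ℕ.≤-trans (ℕ.≤-reflexive (ℕ-Solver.solve 5
      (λ e a b n x → e :+ℕ (n :*ℕ (b :*ℕ x :+ℕ a :+ℕ conℕ 2) :+ℕ conℕ 1) :=ℕ
        b :*ℕ (n :*ℕ x) :+ℕ ((a :+ℕ conℕ 2) :*ℕ n :+ℕ (e :+ℕ conℕ 1) :*ℕ conℕ 1)) ≡.refl e a b n x))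
      (ℕ.≤-trans (ℕ.+-monoʳ-≤ (b ℕ.* (n ℕ.* x)) (ℕ.+-mono-≤ (ℕ.*-monoʳ-≤ (a ℕ.+ 2) (ℕ.m≤m*n n x))
          (ℕ.*-monoʳ-≤ (e ℕ.+ 1) 1≤nx)))
        (ℕ.≤-reflexive (ℕ-Solver.solve 4 (λ e a b y → b :*ℕ y :+ℕ ((a :+ℕ conℕ 2) :*ℕ y :+ℕ (e :+ℕ conℕ 1) :*ℕ y)
            :=ℕ (conℕ 3 :+ℕ (e :+ℕ a :+ℕ b)) :*ℕ y) ≡.refl e a b (n ℕ.* x))))
    where
    open ℕ-Solver using () renaming (_:+_ to _:+ℕ_; _:*_ to _:*ℕ_; _:=_ to _:=ℕ_; con to conℕ)
    1≤nx : 1 ℕ.≤ n ℕ.* x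
    1≤nx = ℕ.≤-trans (ℕ.>-nonZero⁻¹ n) (ℕ.m≤m*n n x)

  flat : ∀ a b x .{{_ : NonZero x}} → a ℕ.+ b ℕ.* x ℕ.≤ (a ℕ.+ b) ℕ.* x
  flat a b x = ℕ.≤-trans (ℕ.+-monoˡ-≤ (b ℕ.* x) (ℕ.m≤m*n a x)) (ℕ.≤-reflexive (≡.sym (ℕ.*-distribʳ-+ x a b)))

  distance-spec : ∀ {m a b x y} {_ : T ((a ℕ.<ᵇ 24) ∨ (31 ℕ.<ᵇ a))} {_ : T ((b ℕ.<ᵇ 24) ∨ (31 ℕ.<ᵇ b))} →
                  Base m → nat m a ≡ x → nat m b ≡ y → x ℕ.< n → y ℕ.< n →
                  Spec (distanceTo a b) m (17 ℕ.* d) (λ m′ → Frame 24 m m′ × real m′ 24 ≈ q x y)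
  distance-spec {m} {a} {b} {x} {y} {_} {b-ok} base a≡x b≡y x<n y<n = spec-weaken bound
      (λ m′ (f , _ , _ , _ , acc) → f , acc)
      (spec-seq (spec-block first {m} {λ m′ → m′ ≡ run first m} ≡.refl) λ { m′ ≡.refl →
        spec-up (leqℕ 1 27) d I done step start })
    where
    first = addℕ 24 4 a ∷ loadℕ 25 24 ∷ addℕ 24 4 b ∷ loadℕ 26 24 ∷ setℕ 27 0 ∷ addᴿ 24 1 1 ∷ []
    body = loadᴿ 25 25 ∷ loadᴿ 26 26 ∷ subᴿ 25 25 26 ∷ mulᴿ 25 25 25 ∷ addᴿ 24 24 25 ∷ addℕ 25 3 25 ∷ addℕ 26 3 26
        ∷ addℕ 27 3 27 ∷ []
    cell : ℕ → ℕ → ℕ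
    cell y j = 32 ℕ.+ (nd ℕ.+ (y ℕ.* d ℕ.+ j))
    I : ℕ → Mem → Set
    I j m′ = Frame 24 m m′ × nat m′ 25 ≡ cell x j × nat m′ 26 ≡ cell y j × nat m′ 27 ≡ j ×
             real m′ 24 ≈ ∑ j (λ l → sq (pt x l - pt y l))
    pointer : ∀ y → y ℕ.< n → nat m (32 ℕ.+ y) ≡ cell y 0
    pointer y y<n = ≡.trans (table base y y<n) (≡.cong (λ p → 32 ℕ.+ (nd ℕ.+ p)) (≡.sym (ℕ.+-identityʳ (y ℕ.* d))))
    b≡y′ : nat (run (addℕ 24 4 a ∷ loadℕ 25 24 ∷ []) m) b ≡ y
    b≡y′ = ≡.trans (nats (frame-run 24 (addℕ 24 4 a ∷ loadℕ 25 24 ∷ []) {m}) b b-ok) b≡y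
    start : I 0 (run first m)
    start = frame-run 24 first ,
      ≡.trans (≡.cong (nat m [ 24 ≔ nat m 4 ℕ.+ nat m a ]) (≡.cong₂ ℕ._+_ (32≡ base) a≡x)) (pointer x x<n) ,
      ≡.trans (≡.cong (nat (run (addℕ 24 4 a ∷ loadℕ 25 24 ∷ addℕ 24 4 b ∷ []) m)) (≡.cong₂ ℕ._+_ (32≡ base) b≡y′))
          (pointer y y<n) ,
      ≡.refl , trans (+-cong (zero≈ base) (zero≈ base)) (+-identityʳ 0#)
    done : ∀ m′ → I d m′ → holds (leqℕ 1 27) m′ ≡ true
    done m′ (f , _ , _ , j≡ , _) = ≤ᵇ-true (d≡ (base-frame 24 f base)) j≡ ℕ.≤-refl
    step : ∀ j m′ → j ℕ.< d → I j m′ → holds (leqℕ 1 27) m′ ≡ false × Spec (block body) m′ 8 (I (suc j))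
    step j m′ j<d (f , u≡ , v≡ , j≡ , acc) = ≤ᵇ-false (d≡ base′) j≡ j<d ,
      spec-block body (frame-trans f (frame-run 24 body) , advance x u≡ , advance y v≡ , ≡.cong₂ ℕ._+_ (one≡ base′) j≡ ,
        +-cong acc (*-cong diff diff))
      where
      base′ = base-frame 24 f base
      advance : ∀ y {a} → a ≡ cell y j → nat m′ 3 ℕ.+ a ≡ cell y (suc j)
      advance y eq = ≡.trans (≡.cong₂ ℕ._+_ (one≡ base′) eq)
          (≡.cong (32 ℕ.+_) (≡.trans (≡.sym (ℕ.+-suc nd _)) (≡.cong (nd ℕ.+_) (≡.sym (ℕ.+-suc (y ℕ.* d) j)))))
      coord : ∀ y → y ℕ.< n → real m′ (cell y j) ≡ pt y j
      coord y y<n = cells base′ y j y<n j<d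
      diff : real m′ (nat m′ 25) - (real m′ [ 25 ≔ real m′ (nat m′ 25) ]) (nat m′ 26) ≈ pt x j - pt y j
      diff = +-cong (reflexive (≡.trans (≡.cong (real m′) u≡) (coord x x<n)))
                    (-‿cong (reflexive (≡.trans (≡.cong (real m′ [ 25 ≔ real m′ (nat m′ 25) ]) v≡) (coord y y<n))))
    bound : 6 ℕ.+ (d ℕ.* 10 ℕ.+ 1) ℕ.≤ 17 ℕ.* d
    bound = ℕ.≤-trans (ℕ.≤-reflexive (ℕ-Solver.solve 1
        (λ d → ℕ-Solver.con 6 ℕ-Solver.:+ (d ℕ-Solver.:* ℕ-Solver.con 10 ℕ-Solver.:+ ℕ-Solver.con 1) ℕ-Solver.:=
        ℕ-Solver.con 7 ℕ-Solver.:+ ℕ-Solver.con 10 ℕ-Solver.:* d) ≡.refl d)) (flat 7 10 d)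

  fit : ∀ a b c x .{{_ : NonZero x}} {_ : T (a ℕ.+ b ℕ.≤ᵇ c)} → b ℕ.* x ℕ.+ a ℕ.≤ c ℕ.* x
  fit a b c x {ok} = ℕ.≤-trans (ℕ.≤-reflexive (ℕ.+-comm (b ℕ.* x) a))
      (ℕ.≤-trans (flat a b x) (ℕ.*-monoˡ-≤ x (ℕ.≤ᵇ⇒≤ (a ℕ.+ b) c ok)))

  instance
    nd≢0 : NonZero nd
    nd≢0 = ℕ.m*n≢0 n d

  -- The common allowance `40 d` is set by the median sum, whose body computes two distances at
  -- `17 d` each.
  sum-spec : ∀ {m} body f → Base m →
             (∀ m′ y → Frame 20 m m′ → nat m′ 20 ≡ y → y ℕ.< n →
                Spec body m′ (40 ℕ.* d) (λ m″ → Frame 21 m′ m″ × real m″ 21 ≈ f y)) →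
             Spec (sumOver body) m (47 ℕ.* nd) (λ m′ → Frame 20 m m′ × real m′ 20 ≈ ∑ n f)
  sum-spec {m} body f base body-spec = spec-weaken (nest 2 2 40 n d) (λ m′ (fr , _ , acc) → fr , acc)
      (spec-seq (spec-block first {m} {λ m′ → m′ ≡ run first m} ≡.refl) λ { m′ ≡.refl →
        spec-up (leqℕ 0 20) n I (λ m′ (fr , y≡ , _) → ≤ᵇ-true (n≡ (base-frame 20 fr base)) y≡ ℕ.≤-refl) step
          (frame-run 20 first , ≡.refl , trans (+-cong (zero≈ base) (zero≈ base)) (+-identityʳ 0#)) })
    where
    first = setℕ 20 0 ∷ addᴿ 20 1 1 ∷ []
    last = addᴿ 20 20 21 ∷ addℕ 20 3 20 ∷ []
    I : ℕ → Mem → Set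
    I y m′ = Frame 20 m m′ × nat m′ 20 ≡ y × real m′ 20 ≈ ∑ y f
    step : ∀ y m′ → y ℕ.< n → I y m′ → holds (leqℕ 0 20) m′ ≡ false × Spec (body ⨾ block last) m′ (40 ℕ.* d ℕ.+ 2)
        (I (suc y))
    step y m′ y<n (fr , y≡ , acc) = ≤ᵇ-false (n≡ base′) y≡ y<n ,
      spec-seq (body-spec m′ y fr y≡ y<n) λ m″ (fr′ , term) → spec-block last
        (frame-trans fr (frame-trans (frame-weaken 20 fr′) (frame-run 20 last)) ,
         ≡.cong₂ ℕ._+_ (≡.trans (nats fr′ 3 _) (one≡ base′)) (≡.trans (nats fr′ 20 _) y≡) ,
         +-cong (trans (reflexive (reals fr′ 20 _)) acc) term)
      where base′ = base-frame 20 fr base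

  Minimal : (ℕ → Carrier) → ℕ → Set
  Minimal f x = x ℕ.< n × ∀ y → y ℕ.< n → f x ≤ f y

  argmin-spec : ∀ {m} score f → Base m →
                (∀ m′ z → Frame 15 m m′ → nat m′ 15 ≡ z → z ℕ.< n →
                   Spec score m′ (49 ℕ.* nd) (λ m″ → Frame 17 m′ m″ × real m″ 20 ≈ f z)) →
                Spec (argmin score) m (108 ℕ.* (n ℕ.* nd)) (λ m′ → Frame 15 m m′ × ∃ λ x → nat m′ 16 ≡ x × Minimal f x)
  argmin-spec {m} score f base score-spec = spec-weaken bound
      (λ m′ (fr , _ , x , x≡ , x<n , _ , min) → fr , x , x≡ , x<n , min)
      (spec-seq (spec-block (setℕ 15 0 ∷ []) {m} {λ m′ → m′ ≡ run (setℕ 15 0 ∷ []) m} ≡.refl) λ { m₀ ≡.refl →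
        spec-seq (score-spec m₀ 0 (frame-run 15 (setℕ 15 0 ∷ [])) ≡.refl 0<n) λ m₁ (fr₁ , s≈) →
        spec-seq (spec-block init {m₁} {I 0} (init-I m₁ fr₁ s≈)) λ m₂ I₂ →
        spec-up (leqℕ 0 15) n I (λ m′ (fr , z≡ , _) → ≤ᵇ-true (n≡ (base-frame 15 fr base)) z≡ ℕ.≤-refl) step I₂ })
    where
    0<n : 0 ℕ.< n
    0<n = ℕ.>-nonZero⁻¹ n
    init = addᴿ 15 20 1 ∷ setℕ 16 0 ∷ []
    better = addᴿ 15 20 1 ∷ addℕ 16 8 15 ∷ []
    Best : ℕ → Mem → Set
    Best b m′ = ∃ λ x → nat m′ 16 ≡ x × x ℕ.< n × real m′ 15 ≈ f x × (∀ y → y ℕ.< b → f x ≤ f y)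
    I : ℕ → Mem → Set
    I z m′ = Frame 15 m m′ × nat m′ 15 ≡ z × Best z m′
    copied : ∀ {m′} → Base m′ → ∀ {v} → real m′ 20 ≈ v → real m′ 20 + real m′ 1 ≈ v
    copied base′ s≈ = trans (+-cong s≈ (zero≈ base′)) (+-identityʳ _)
    init-I : ∀ m₁ → Frame 17 (run (setℕ 15 0 ∷ []) m) m₁ → real m₁ 20 ≈ f 0 → I 0 (run init m₁)
    init-I m₁ fr₁ s≈ = frame-trans fr (frame-run 15 init) , nats fr₁ 15 _ , 0 , ≡.refl , 0<n , copied
        (base-frame 15 fr base) s≈ , λ y ()
      where fr = frame-trans (frame-run 15 (setℕ 15 0 ∷ []) {m}) (frame-weaken 15 fr₁)
    step : ∀ z m′ → z ℕ.< n → I z m′ → holds (leqℕ 0 15) m′ ≡ false ×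
           Spec (score ⨾ unless (leqᴿ 15 20) (block better) ⨾ block (addℕ 15 3 15 ∷ [])) m′ (49 ℕ.* nd ℕ.+ 4)
               (I (suc z))
    step z m′ z<n (fr , z≡ , x , x≡ , x<n , r≈ , min) = ≤ᵇ-false (n≡ (base-frame 15 fr base)) z≡ z<n ,
      spec-seq (score-spec m′ z fr z≡ z<n) λ m″ (fr′ , s≈) →
      spec-seq (spec-unless (leqᴿ 15 20) {m = m″} {Q = Mid} (keep m″ fr′ s≈) (replace m″ fr′ s≈)) λ m‴
          (fr″ , z≡″ , best) →
      spec-block (addℕ 15 3 15 ∷ []) (frame-trans fr″ (frame-run 15 (addℕ 15 3 15 ∷ [])) ,
        ≡.cong₂ ℕ._+_ (one≡ (base-frame 15 fr″ base)) z≡″ , best)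
      where
      Mid : Mem → Set
      Mid m‴ = Frame 15 m m‴ × nat m‴ 15 ≡ z × Best (suc z) m‴
      extend : ∀ {x} → f x ≤ f z → (∀ y → y ℕ.< z → f x ≤ f y) → ∀ y → y ℕ.< suc z → f x ≤ f y
      extend fx≤fz min y y<1+z with y ℕ.≟ z
      ... | yes ≡.refl = fx≤fz
      ... | no y≢z     = min y (ℕ.≤∧≢⇒< (ℕ.≤-pred y<1+z) y≢z)
      r≈′ : ∀ m″ → Frame 17 m′ m″ → real m″ 15 ≈ f x
      r≈′ m″ fr′ = trans (reflexive (reals fr′ 15 _)) r≈
      keep : ∀ m″ → Frame 17 m′ m″ → real m″ 20 ≈ f z → holds (leqᴿ 15 20) m″ ≡ true → Mid m″
      keep m″ fr′ s≈ le = frame-trans fr (frame-weaken 15 fr′) , ≡.trans (nats fr′ 15 _) z≡ , x , ≡.trans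
          (nats fr′ 16 _) x≡ , x<n , r≈′ m″ fr′ ,
        extend (≤-resp (r≈′ m″ fr′) s≈ (em-true le)) min
      replace : ∀ m″ → Frame 17 m′ m″ → real m″ 20 ≈ f z → holds (leqᴿ 15 20) m″ ≡ false → Spec (block better) m″ 2 Mid
      replace m″ fr′ s≈ nle = spec-block better
        (frame-trans fr″ (frame-run 15 better) , z≡″ , z , ≡.cong₂ ℕ._+_ (zero≡ base″) z≡″ , z<n , copied base″ s≈ ,
         extend ≤-refl (λ y y<z → ≤-trans (≤-resp s≈ (r≈′ m″ fr′) (≰⇒≥ (em-false nle))) (min y y<z)))
        where
        fr″ = frame-trans fr (frame-weaken 15 fr′)
        base″ = base-frame 15 fr″ base
        z≡″ = ≡.trans (nats fr′ 15 _) z≡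
    bound : 1 ℕ.+ (49 ℕ.* nd ℕ.+ (2 ℕ.+ (n ℕ.* (49 ℕ.* nd ℕ.+ 4 ℕ.+ 2) ℕ.+ 1))) ℕ.≤ 108 ℕ.* (n ℕ.* nd)
    bound = ℕ.≤-trans (ℕ.≤-reflexive (ℕ-Solver.solve 2
        (λ x y → con′ 1 :+′ (x :+′ (con′ 2 :+′ y)) :=′ x :+′ (con′ 3 :+′ y)) ≡.refl (49 ℕ.* nd)
        (n ℕ.* (49 ℕ.* nd ℕ.+ 4 ℕ.+ 2) ℕ.+ 1)))
      (ℕ.≤-trans (ℕ.+-mono-≤ (ℕ.*-monoʳ-≤ 49 (ℕ.m≤n*m nd n)) (nest 3 4 49 n nd))
          (ℕ.≤-reflexive (≡.sym (ℕ.*-distribʳ-+ (n ℕ.* nd) 49 59))))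
      where open ℕ-Solver using () renaming (_:+_ to _:+′_; _:=_ to _:=′_; con to con′)

  isolation-cost : (ℕ → Carrier) → ℕ → Carrier
  isolation-cost D x = ∑ n λ y → (num K * q x y ⊓ D x) - D x

  InBall : (ℕ → Carrier) → ℕ → ℕ → Set
  InBall D x y = num K * q x y ≤ num 256 * D x

  median-cost : (ℕ → Carrier) → ℕ → ℕ → Carrier
  median-cost D x z = ∑ n λ y → χ (InBall D x y) * q z y

  greedy-cost : (ℕ → Carrier) → ℕ → Carrier
  greedy-cost D z = ∑ n λ y → q z y ⊓ D y

  D-address : ∀ {m} → Base m → ∀ {a y} → a ≡ y → nat m 5 ℕ.+ a ≡ slot y
  D-address base a≡y = ≡.cong₂ ℕ._+_ (D≡ base) a≡y

  open Min totalOrder using (x≤y⇒x⊓y≈x; x≤y⇒y⊓x≈x; ⊓-cong)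

  isolation-spec : ∀ {D m m′ z} → Base m → Holds-D D m → Frame 15 m m′ → nat m′ 15 ≡ z → z ℕ.< n →
                   Spec isolation m′ (49 ℕ.* nd) (λ m″ → Frame 17 m′ m″ × real m″ 20 ≈ isolation-cost D z)
  isolation-spec {D} {m} {m′} {z} base₀ D≈ fr₀ z≡ z<n = spec-weaken
      (ℕ.+-mono-≤ (ℕ.*-monoʳ-≤ 2 (ℕ.>-nonZero⁻¹ nd)) (ℕ.≤-refl {47 ℕ.* nd}) ⟨ ℕ.≤-trans ⟩ ℕ.≤-reflexive
      (≡.sym (ℕ.*-distribʳ-+ nd 2 47))) (λ _ p → p)
      (spec-seq (spec-block first {m′} {λ m″ → m″ ≡ run first m′} ≡.refl) λ { m₁ ≡.refl →
        spec-weaken ℕ.≤-refl (λ m″ (fr , s≈) → frame-trans (frame-run 17 first) (frame-weaken 17 fr) , s≈)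
          (sum-spec body _ (base-frame 17 (frame-run 17 first) base) body-spec) })
    where
    first = addℕ 17 5 15 ∷ loadᴿ 17 17 ∷ []
    scale = mulᴿ 21 2 24 ∷ []
    base = base-frame 15 fr₀ base₀
    m₁ = run first m′
    Dz≈ : real m₁ 17 ≈ D z
    Dz≈ = trans (reflexive (≡.cong (real m′) (D-address base z≡))) (D-frame fr₀ D≈ z z<n)
    body = distanceTo 15 20 ⨾ block scale ⨾ unless (leqᴿ 21 17) (block (addᴿ 21 17 1 ∷ [])) ⨾ block (subᴿ 21 21 17 ∷ [])
    body-spec : ∀ m₂ y → Frame 20 m₁ m₂ → nat m₂ 20 ≡ y → y ℕ.< n →
                Spec body m₂ (40 ℕ.* d) (λ m″ → Frame 21 m₂ m″ × real m″ 21 ≈ (num K * q z y ⊓ D z) - D z)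
    body-spec m₂ y fr y≡ y<n = spec-weaken (fit 4 17 40 d) (λ _ p → p)
      (spec-seq (distance-spec base₂ (≡.trans (nats fr 15 _) z≡) y≡ z<n y<n) λ m₃ (fr₃ , q≈) →
       spec-seq (spec-block scale {m₃} {λ m₄ → Frame 21 m₂ m₄ × real m₄ 21 ≈ num K * q z y}
         (frame-trans (frame-weaken 21 fr₃) (frame-run 21 scale) , *-cong (K≈ (base-frame 24 fr₃ base₂)) q≈)) λ m₄
             (fr₄ , Kq≈) →
       spec-seq (spec-unless (leqᴿ 21 17) {m = m₄} {Q = λ m₅ → Frame 21 m₂ m₅ × real m₅ 21 ≈ num K * q z y ⊓ D z}
         (λ le → fr₄ , trans Kq≈ (sym (x≤y⇒x⊓y≈x (≤-resp Kq≈ (R17 fr₄) (em-true le)))))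
         (λ nle → spec-block (addᴿ 21 17 1 ∷ []) (frame-trans fr₄ (frame-run 21 (addᴿ 21 17 1 ∷ [])) ,
            trans (+-cong (R17 fr₄) (zero≈ (base-frame 21 fr₄ base₂)))
                (trans (+-identityʳ _) (sym (x≤y⇒y⊓x≈x (≤-resp (R17 fr₄) Kq≈ (≰⇒≥ (em-false nle)))))))))
       λ m₅ (fr₅ , min≈) → spec-block (subᴿ 21 21 17 ∷ [])
           (frame-trans fr₅ (frame-run 21 (subᴿ 21 21 17 ∷ [])) , +-cong min≈ (-‿cong (R17 fr₅))))
      where
      base₂ = base-frame 20 fr (base-frame 17 (frame-run 17 first) base)
      R17 : ∀ {m₄} → Frame 21 m₂ m₄ → real m₄ 17 ≈ D z
      R17 fr₄ = trans (reflexive (≡.trans (reals fr₄ 17 _) (reals fr 17 _))) Dz≈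

  median-spec : ∀ {D m m′ x z} → Base m → nat m 12 ≡ x → x ℕ.< n → real m 12 ≈ num 256 * D x →
                Frame 15 m m′ → nat m′ 15 ≡ z → z ℕ.< n →
                Spec medianCost m′ (49 ℕ.* nd) (λ m″ → Frame 17 m′ m″ × real m″ 20 ≈ median-cost D x z)
  median-spec {D} {m} {m′} {x} {z} base₀ x≡ x<n r≈ fr₀ z≡ z<n = spec-weaken (ℕ.*-monoˡ-≤ nd (ℕ.≤ᵇ⇒≤ 47 49 _))
      (λ m″ (fr , s≈) → frame-weaken 17 fr , s≈)
      (sum-spec body _ base body-spec)
    where
    base = base-frame 15 fr₀ base₀
    body = distanceTo 15 20 ⨾ block (addᴿ 21 24 1 ∷ []) ⨾ distanceTo 12 20 ⨾ block (mulᴿ 22 2 24 ∷ []) ⨾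
             unless (leqᴿ 22 12) (block (addᴿ 21 1 1 ∷ []))
    bound : 17 ℕ.* d ℕ.+ (1 ℕ.+ (17 ℕ.* d ℕ.+ (1 ℕ.+ 2))) ℕ.≤ 40 ℕ.* d
    bound = ℕ.≤-trans (ℕ.≤-reflexive (ℕ-Solver.solve 1
        (λ d → con′ 17 :*′ d :+′ (con′ 1 :+′ (con′ 17 :*′ d :+′ con′ 3)) :=′ con′ 34 :*′ d :+′ con′ 4) ≡.refl d))
        (fit 4 34 40 d)
      where open ℕ-Solver using () renaming (_:+_ to _:+′_; _:*_ to _:*′_; _:=_ to _:=′_; con to con′)
    body-spec : ∀ m₂ y → Frame 20 m′ m₂ → nat m₂ 20 ≡ y → y ℕ.< n →
                Spec body m₂ (40 ℕ.* d) (λ m″ → Frame 21 m₂ m″ × real m″ 21 ≈ χ (InBall D x y) * q z y)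
    body-spec m₂ y fr y≡ y<n = spec-weaken bound (λ _ p → p)
      (spec-seq (distance-spec base₂ (≡.trans (nats fr 15 _) z≡) y≡ z<n y<n) λ m₃ (fr₃ , q≈) →
       spec-seq (spec-block (addᴿ 21 24 1 ∷ []) {m₃} {λ m₄ → Frame 21 m₂ m₄ × real m₄ 21 ≈ q z y}
         (frame-trans (frame-weaken 21 fr₃) (frame-run 21 (addᴿ 21 24 1 ∷ [])) , trans
             (+-cong q≈ (zero≈ (base-frame 24 fr₃ base₂))) (+-identityʳ _))) λ m₄ (fr₄ , q≈₄) →
       spec-seq (distance-spec (base-frame 21 fr₄ base₂)
           (≡.trans (nats fr₄ 12 _) (≡.trans (nats fr 12 _) (≡.trans (nats fr₀ 12 _) x≡)))
           (≡.trans (nats fr₄ 20 _) y≡) x<n y<n) λ m₅ (fr₅ , qx≈) →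
       spec-seq (spec-block (mulᴿ 22 2 24 ∷ []) {m₅}
           {λ m₆ → Frame 21 m₂ m₆ × real m₆ 21 ≈ q z y × real m₆ 22 ≈ num K * q x y}
         (frame-trans fr₄ (frame-trans (frame-weaken 21 fr₅) (frame-run 21 (mulᴿ 22 2 24 ∷ []))) , trans
             (reflexive (reals fr₅ 21 _)) q≈₄ ,
          *-cong (K≈ (base-frame 24 fr₅ (base-frame 21 fr₄ base₂))) qx≈)) λ m₆ (fr₆ , q≈₆ , Kq≈) →
       spec-unless (leqᴿ 22 12)
         (λ le → fr₆ , trans q≈₆ (sym (trans (*-congʳ (χ-yes (≤-resp Kq≈ (R12 fr₆) (em-true le)))) (*-identityˡ _))))
         (λ nle → spec-block (addᴿ 21 1 1 ∷ []) (frame-trans fr₆ (frame-run 21 (addᴿ 21 1 1 ∷ [])) ,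
            trans (+-cong (zero≈ (base-frame 21 fr₆ base₂)) (zero≈ (base-frame 21 fr₆ base₂))) (trans (+-identityʳ 0#)
              (sym (trans (*-congʳ (χ-no λ le → em-false nle (≤-resp (sym Kq≈) (sym (R12 fr₆)) le))) (zeroˡ _)))))))
      where
      base₂ = base-frame 20 fr base
      R12 : ∀ {m₄} → Frame 21 m₂ m₄ → real m₄ 12 ≈ num 256 * D x
      R12 fr₄ = trans (reflexive (≡.trans (reals fr₄ 12 _) (≡.trans (reals fr 12 _) (reals fr₀ 12 _)))) r≈

  greedy-spec : ∀ {D m m′ z} → Base m → Holds-D D m → Frame 15 m m′ → nat m′ 15 ≡ z → z ℕ.< n →
                Spec greedyCost m′ (49 ℕ.* nd) (λ m″ → Frame 17 m′ m″ × real m″ 20 ≈ greedy-cost D z)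
  greedy-spec {D} {m} {m′} {z} base₀ D≈ fr₀ z≡ z<n = spec-weaken (ℕ.*-monoˡ-≤ nd (ℕ.≤ᵇ⇒≤ 47 49 _))
      (λ m″ (fr , s≈) → frame-weaken 17 fr , s≈)
      (sum-spec body _ base body-spec)
    where
    base = base-frame 15 fr₀ base₀
    load = addᴿ 21 24 1 ∷ addℕ 22 5 20 ∷ loadᴿ 22 22 ∷ []
    body = distanceTo 15 20 ⨾ block load ⨾ unless (leqᴿ 21 22) (block (addᴿ 21 22 1 ∷ []))
    body-spec : ∀ m₂ y → Frame 20 m′ m₂ → nat m₂ 20 ≡ y → y ℕ.< n →
                Spec body m₂ (40 ℕ.* d) (λ m″ → Frame 21 m₂ m″ × real m″ 21 ≈ q z y ⊓ D y)
    body-spec m₂ y fr y≡ y<n = spec-weaken (fit 5 17 40 d) (λ _ p → p)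
      (spec-seq (distance-spec base₂ (≡.trans (nats fr 15 _) z≡) y≡ z<n y<n) λ m₃ (fr₃ , q≈) →
       spec-seq (spec-block load {m₃} {λ m₄ → Frame 21 m₂ m₄ × real m₄ 21 ≈ q z y × real m₄ 22 ≈ D y}
         (loaded m₃ fr₃ q≈)) λ m₄ (fr₄ , q≈₄ , D≈₄) →
       spec-unless (leqᴿ 21 22)
         (λ le → fr₄ , trans q≈₄ (sym (x≤y⇒x⊓y≈x (≤-resp q≈₄ D≈₄ (em-true le)))))
         (λ nle → spec-block (addᴿ 21 22 1 ∷ []) (frame-trans fr₄ (frame-run 21 (addᴿ 21 22 1 ∷ [])) ,
            trans (+-cong D≈₄ (zero≈ (base-frame 21 fr₄ base₂)))
                (trans (+-identityʳ _) (sym (x≤y⇒y⊓x≈x (≤-resp D≈₄ q≈₄ (≰⇒≥ (em-false nle)))))))))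
      where
      base₂ = base-frame 20 fr base
      loaded : ∀ m₃ → Frame 24 m₂ m₃ → real m₃ 24 ≈ q z y → Frame 21 m₂ (run load m₃) × real (run load m₃) 21 ≈ q z
          y × real (run load m₃) 22 ≈ D y
      loaded m₃ fr₃ q≈ = frame-trans (frame-weaken 21 fr₃) (frame-run 21 load) , trans (+-cong q≈ (zero≈ base₃))
          (+-identityʳ _) ,
        trans (reflexive (≡.cong (real m₃ [ 21 ≔ real m₃ 24 + real m₃ 1 ])
            (D-address base₃ (≡.trans (nats fr₃ 20 _) y≡))))
          (D-frame (frame-trans fr₀ (frame-weaken 15 (frame-trans fr (frame-weaken 20 fr₃)))) D≈ y y<n)
        where base₃ = base-frame 24 fr₃ base₂

-- Updates of the distance array and the two phases

module Phases (em : ExcludedMiddle 0ℓ) (ℝ : Reals) (n d k : ℕ) .{{_ : NonZero n}} .{{_ : NonZero d}} .{{_ : NonZero k}}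
              (pt : ℕ → ℕ → KMeans.Carrier em ℝ) (ε : KMeans.Carrier em ℝ) where

  open KMeans em ℝ
  open OrderedField em ℝ
  open Algorithm em ℝ
  open Loops em ℝ n d k pt ε
  open Base
  open FrameD
  open Min totalOrder using (x≤y⇒x⊓y≈x; x≤y⇒y⊓x≈x; ⊓-cong)

  frameD-weaken : ∀ c {c′ m m′} {_ : T (c ℕ.≤ᵇ c′)} → FrameD c′ m m′ → FrameD c m m′
  frameD-weaken c {c′} {_} {_} {c≤c′} f = frameD (λ a ok → natsD f a (preserved-nat c c′ c≤c′ a ok))
                                                (λ a ok a<D → realsD f a (preserved-real c c′ c≤c′ a ok) a<D)

  base-D : ∀ c {m m′} {_ : T (9 ℕ.≤ᵇ c)} → FrameD c m m′ → Base m → Base m′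
  base-D c {_} {_} {9≤c} f = base-frameD (frameD-weaken 9 {_} {_} {_} {9≤c} f)

  -- Cells behind `y` hold the new array and cells from `y` on still the old one, so the body may
  -- read `D y` before replacing it. `FrameD` is silent about these cells, hence the separate clause
  -- on the others.
  store-loop : ∀ {m} {D : ℕ → Carrier} (new : ℕ → Carrier) body b → Base m → nat m 20 ≡ 0 →
    (∀ y → y ℕ.< n → real m (slot y) ≈ D y) →
    (∀ m′ y → FrameD 20 m m′ → nat m′ 20 ≡ y → y ℕ.< n → real m′ (slot y) ≈ D y →
       Spec body m′ b (λ m″ → FrameD 20 m′ m″ × nat m″ 20 ≡ suc y ×
         real m″ (slot y) ≈ new y ×
         (∀ i → i ℕ.< n → ¬ i ≡ y → real m″ (slot i) ≡ real m′ (slot i)))) →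
    Spec (until (leqℕ 0 20) body) m (n ℕ.* (b ℕ.+ 2) ℕ.+ 1) (λ m′ → FrameD 20 m m′ × Holds-D new m′)
  store-loop {m} {D} new body b base i≡0 D≈ body-spec = spec-weaken ℕ.≤-refl (λ m′ (fr , _ , done , _) → fr , done)
      (spec-up (leqℕ 0 20) n I (λ m′ (fr , y≡ , _) → ≤ᵇ-true (n≡ (base-D 20 fr base)) y≡ ℕ.≤-refl) step
        (forget (frame-refl {20}) , i≡0 , (λ i ()) , λ i _ i<n → D≈ i i<n))
    where
    cell : ℕ → ℕ
    cell i = slot i
    I : ℕ → Mem → Set
    I y m′ = FrameD 20 m m′ × nat m′ 20 ≡ y × (∀ i → i ℕ.< y → real m′ (cell i) ≈ new i) ×
             (∀ i → y ℕ.≤ i → i ℕ.< n → real m′ (cell i) ≈ D i)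
    step : ∀ y m′ → y ℕ.< n → I y m′ → holds (leqℕ 0 20) m′ ≡ false × Spec body m′ b (I (suc y))
    step y m′ y<n (fr , y≡ , old , rest) = ≤ᵇ-false (n≡ (base-D 20 fr base)) y≡ y<n ,
      spec-weaken ℕ.≤-refl (λ m″ (fr′ , y≡′ , new-y , others) → frameD-trans fr fr′ , y≡′ ,
          (λ i i<1+y → settled m″ new-y others i i<1+y) ,
          (λ i y<i i<n → trans (reflexive (others i i<n λ { ≡.refl → ℕ.<-irrefl ≡.refl y<i }))
              (rest i (ℕ.<⇒≤ y<i) i<n)))
        (body-spec m′ y fr y≡ y<n (rest y ℕ.≤-refl y<n))
      where
      settled : ∀ m″ → real m″ (cell y) ≈ new y → (∀ i → i ℕ.< n → ¬ i ≡ y → real m″ (cell i) ≡ real m′ (cell i)) →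
                ∀ i → i ℕ.< suc y → real m″ (cell i) ≈ new i
      settled m″ new-y others i i<1+y with i ℕ.≟ y
      ... | yes ≡.refl = new-y
      ... | no i≢y     = trans (reflexive (others i (ℕ.≤-<-trans (ℕ.≤-pred i<1+y) y<n) i≢y))
          (old i (ℕ.≤∧≢⇒< (ℕ.≤-pred i<1+y) i≢y))

  store-spec : ∀ {m′ m v y} r → FrameD 20 m′ m → Base m → nat m 20 ≡ y → nat m 21 ≡ slot y → y ℕ.< n → real m r ≈ v →
    (∀ i → i ℕ.< n → ¬ i ≡ y → real m (slot i) ≡ real m′ (slot i)) →
    Spec (block (storeᴿ 21 r ∷ addℕ 20 3 20 ∷ [])) m 2 (λ m″ → FrameD 20 m′ m″ × nat m″ 20 ≡ suc y ×
         real m″ (slot y) ≈ v ×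
         (∀ i → i ℕ.< n → ¬ i ≡ y → real m″ (slot i) ≡ real m′ (slot i)))
  store-spec {m′} {m} {v} {y} r fr base y≡ a≡ y<n v≈ same = spec-block (storeᴿ 21 r ∷ addℕ 20 3 20 ∷ [])
      (frameD-trans fr (frameD (λ a ok → nats (frame-run 20 (addℕ 20 3 20 ∷ []) {m}) a ok)
          (λ a ok a<D → ≔-other (real m) (nat m 21) a λ eq → ℕ.<⇒≱ a<D
              (ℕ.≤-trans (ℕ.+-monoʳ-≤ 33 (ℕ.m≤m+n (nd ℕ.+ nd) y)) (ℕ.≤-reflexive (≡.trans (≡.sym a≡) eq))))) ,
       ≡.cong₂ ℕ._+_ (one≡ base) y≡ ,
       trans (reflexive (≡.trans (≡.cong (real m [ nat m 21 ≔ real m r ]) (≡.sym a≡))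
           (≔-same (real m) (nat m 21)))) v≈ ,
       λ i i<n i≢y → ≡.trans (≔-other (real m) (nat m 21) _ λ eq → i≢y
           (≡.sym (ℕ.+-cancelˡ-≡ (nd ℕ.+ nd) y i (ℕ.+-cancelˡ-≡ 33 _ _ (≡.trans (≡.sym a≡) eq))))) (same i i<n i≢y))

  D-cell : ∀ c i {m m′} → Frame c m m′ → real m′ (slot i) ≡ real m (slot i)
  D-cell c i f = reals f (slot i) (∨-right ((0 ℕ.<ᵇ slot i) ∧ (slot i ℕ.<ᵇ c)) tt)

  relax-spec : ∀ {m D z} → Base m → Holds-D D m → nat m 16 ≡ z → z ℕ.< n →
               Spec relaxAll m (27 ℕ.* nd) (λ m′ → FrameD 20 m m′ × Holds-D (λ y → D y ⊓ q z y) m′)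
  relax-spec {m} {D} {z} base D≈ z≡ z<n = spec-weaken (nest 1 6 17 n d) (λ _ p → p)
      (spec-seq (spec-block (setℕ 20 0 ∷ []) {m} {λ m′ → m′ ≡ run (setℕ 20 0 ∷ []) m} ≡.refl) λ { m₀ ≡.refl →
        spec-weaken (ℕ.≤-reflexive (≡.cong (λ b → n ℕ.* (b ℕ.+ 2) ℕ.+ 1) ≡.refl))
          (λ m′ (fr , D′) → frameD-trans (forget (frame-run 20 (setℕ 20 0 ∷ []))) fr , D′)
          (store-loop {m₀} {D} (λ y → D y ⊓ q z y) body (17 ℕ.* d ℕ.+ 6)
              (base-frame 20 (frame-run 20 (setℕ 20 0 ∷ [])) base) ≡.refl
            (D-frame (frame-run 20 (setℕ 20 0 ∷ []) {m}) D≈) body-spec) })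
    where
    m₀ = run (setℕ 20 0 ∷ []) m
    base₀ : Base m₀
    base₀ = base-frame 20 (frame-run 20 (setℕ 20 0 ∷ [])) base
    load = addℕ 21 5 20 ∷ loadᴿ 22 21 ∷ []
    body = distanceTo 16 20 ⨾ block load ⨾ unless (leqᴿ 22 24) (block (addᴿ 22 24 1 ∷ [])) ⨾ block
        (storeᴿ 21 22 ∷ addℕ 20 3 20 ∷ [])
    body-spec : ∀ m′ y → FrameD 20 m₀ m′ → nat m′ 20 ≡ y → y ℕ.< n → real m′ (slot y) ≈ D y →
       Spec body m′ (17 ℕ.* d ℕ.+ 6) (λ m″ → FrameD 20 m′ m″ × nat m″ 20 ≡ suc y ×
         real m″ (slot y) ≈ D y ⊓ q z y ×
         (∀ i → i ℕ.< n → ¬ i ≡ y → real m″ (slot i) ≡ real m′ (slot i)))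
    body-spec m′ y fr y≡ y<n Dy≈ =
      spec-seq (distance-spec base′ (≡.trans (natsD fr 16 _) z≡) y≡ z<n y<n) λ m₁ (fr₁ , q≈) →
      spec-seq (spec-block load {m₁} {λ m₂ → Frame 21 m′ m₂ × nat m₂ 21 ≡ slot y × real m₂ 22 ≈ D y × real m₂ 24 ≈
          q z y}
        (loaded m₁ fr₁ q≈)) λ m₂ (fr₂ , a≡ , D≈₂ , q≈₂) →
      spec-seq (spec-unless (leqᴿ 22 24) {m = m₂} {Q = λ m₃ → Frame 21 m′ m₃ × nat m₃ 21 ≡ slot y × real m₃ 22 ≈ D
          y ⊓ q z y}
        (λ le → fr₂ , a≡ , trans D≈₂ (sym (x≤y⇒x⊓y≈x (≤-resp D≈₂ q≈₂ (em-true le)))))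
        (λ nle → spec-block (addᴿ 22 24 1 ∷ []) (frame-trans fr₂ (frame-run 21 (addᴿ 22 24 1 ∷ [])) , a≡ ,
           trans (+-cong q≈₂ (zero≈ (base-frame 21 fr₂ base′)))
               (trans (+-identityʳ _) (sym (x≤y⇒y⊓x≈x (≤-resp q≈₂ D≈₂ (≰⇒≥ (em-false nle)))))))))
      λ m₃ (fr₃ , a≡₃ , min≈) → store-spec 22 (forget (frame-weaken 20 fr₃)) (base-frame 21 fr₃ base′)
          (≡.trans (nats fr₃ 20 _) y≡) a≡₃ y<n min≈
        (λ i _ _ → D-cell 21 i fr₃)
      where
      base′ = base-D 20 fr base₀
      loaded : ∀ m₁ → Frame 24 m′ m₁ → real m₁ 24 ≈ q z y → Frame 21 m′ (run load m₁) × nat (run load m₁) 21 ≡ slot y ×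
               real (run load m₁) 22 ≈ D y × real (run load m₁) 24 ≈ q z y
      loaded m₁ fr₁ q≈ = frame-trans (frame-weaken 21 fr₁) (frame-run 21 load) , address ,
        trans (reflexive (≡.trans (≡.cong (real m₁) address) (D-cell 24 y fr₁))) Dy≈ , q≈
        where address = D-address (base-frame 24 fr₁ base′) (≡.trans (nats fr₁ 20 _) y≡)

  initialise-spec : ∀ {m} → Base m → Spec initialise m (25 ℕ.* nd) (λ m′ → Base m′ × Holds-D (q 0) m′)
  initialise-spec {m} base = spec-weaken (nest 2 3 17 n d) (λ _ p → p)
      (spec-seq (spec-block first {m} {λ m′ → m′ ≡ run first m} ≡.refl) λ { m₀ ≡.refl →
        spec-weaken ℕ.≤-refl (λ m′ (fr , D′) → base-D 20 fr base₀ , D′)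
          (store-loop {m₀} {λ y → real m₀ (slot y)} (q 0) body (17 ℕ.* d ℕ.+ 3) base₀ ≡.refl (λ _ _ → refl)
              body-spec) })
    where
    first = setℕ 15 0 ∷ setℕ 20 0 ∷ []
    m₀ = run first m
    base₀ : Base m₀
    base₀ = base-frame 15 (frame-run 15 first) base
    body = distanceTo 15 20 ⨾ block (addℕ 21 5 20 ∷ []) ⨾ block (storeᴿ 21 24 ∷ addℕ 20 3 20 ∷ [])
    body-spec : ∀ m′ y → FrameD 20 m₀ m′ → nat m′ 20 ≡ y → y ℕ.< n → real m′ (slot y) ≈ real m₀ (slot y) →
       Spec body m′ (17 ℕ.* d ℕ.+ 3) (λ m″ → FrameD 20 m′ m″ × nat m″ 20 ≡ suc y ×
         real m″ (slot y) ≈ q 0 y ×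
         (∀ i → i ℕ.< n → ¬ i ≡ y → real m″ (slot i) ≡ real m′ (slot i)))
    body-spec m′ y fr y≡ y<n _ =
      spec-seq (distance-spec base′ (natsD fr 15 _) y≡ (ℕ.≤-<-trans z≤n y<n) y<n) λ m₁ (fr₁ , q≈) →
      spec-seq (spec-block (addℕ 21 5 20 ∷ []) {m₁} {λ m₂ → Frame 21 m′ m₂ × nat m₂ 21 ≡ slot y × real m₂ 24 ≈ q 0 y}
        (frame-trans (frame-weaken 21 fr₁) (frame-run 21 (addℕ 21 5 20 ∷ [])) , D-address (base-frame 24 fr₁ base′)
            (≡.trans (nats fr₁ 20 _) y≡) , q≈)) λ m₂ (fr₂ , a≡ , q≈₂) →
      store-spec 24 (forget (frame-weaken 20 fr₂)) (base-frame 21 fr₂ base′) (≡.trans (nats fr₂ 20 _) y≡) a≡ y<n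
          q≈₂ (λ i _ _ → D-cell 21 i fr₂)
      where base′ = base-D 20 fr base₀

  relax : (ℕ → Carrier) → ℕ → ℕ → Carrier
  relax D z y = D y ⊓ q z y

  coverStep-spec : ∀ {m} {D : ℕ → Carrier} → Base m → Holds-D D m →
    Spec coverStep m (247 ℕ.* (n ℕ.* nd)) (λ m′ → FrameD 11 m m′ × ∃ λ x → ∃ λ z →
      Minimal (isolation-cost D) x × Minimal (median-cost D x) z × Holds-D (relax D z) m′)
  coverStep-spec {m} {D} base D≈ = spec-weaken bound (λ _ p → p)
      (spec-seq (argmin-spec isolation (isolation-cost D) base λ m′ z → isolation-spec {D} base D≈) λ m₁
          (fr₁ , x , x≡ , x-min) →
       spec-seq (spec-block prepare {m₁} {λ m₂ → Frame 12 m m₂ × nat m₂ 12 ≡ x × real m₂ 12 ≈ num 256 * D x}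
         (frame-trans (frame-weaken 12 fr₁) (frame-run 12 prepare) , x≡₁ m₁ fr₁ x≡ , *-cong
             (256≈ (base-frame 15 fr₁ base))
           (trans (reflexive (≡.cong (real m₁) (D-address (base-frame 15 fr₁ base) (x≡₁ m₁ fr₁ x≡))))
               (D-frame fr₁ D≈ x (proj₁ x-min))))) λ m₂ (fr₂ , x≡₂ , r≈) →
       spec-seq (argmin-spec medianCost (median-cost D x) (base-frame 12 fr₂ base) λ m′ z → median-spec {D}
           (base-frame 12 fr₂ base) x≡₂ (proj₁ x-min) r≈) λ m₃ (fr₃ , z , z≡ , z-min) →
       spec-weaken ℕ.≤-refl (λ m₄ (fr₄ , D′) → frameD-trans
           (forget (frame-trans (frame-weaken 11 fr₂) (frame-weaken 11 fr₃))) (frameD-weaken 11 fr₄) , x , z ,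
           x-min , z-min , D′)
         (relax-spec (base-frame 15 fr₃ (base-frame 12 fr₂ base)) (D-frame fr₃ (D-frame fr₂ D≈)) z≡ (proj₁ z-min)))
    where
    prepare = addℕ 12 8 16 ∷ addℕ 13 5 12 ∷ loadᴿ 12 13 ∷ mulᴿ 12 3 12 ∷ []
    x≡₁ : ∀ {x} m₁ → Frame 15 m m₁ → nat m₁ 16 ≡ x → nat m₁ 8 ℕ.+ nat m₁ 16 ≡ x
    x≡₁ m₁ fr₁ x≡ = ≡.cong₂ ℕ._+_ (zero≡ (base-frame 15 fr₁ base)) x≡
    bound : 108 ℕ.* (n ℕ.* nd) ℕ.+ (4 ℕ.+ (108 ℕ.* (n ℕ.* nd) ℕ.+ 27 ℕ.* nd)) ℕ.≤ 247 ℕ.* (n ℕ.* nd)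
    bound = ℕ.≤-trans (ℕ.+-monoʳ-≤ (108 ℕ.* w) (ℕ.+-mono-≤ (ℕ.m≤m*n 4 w)
        (ℕ.+-monoʳ-≤ (108 ℕ.* w) (ℕ.*-monoʳ-≤ 27 (ℕ.m≤n*m nd n)))))
        (ℕ.≤-reflexive (ℕ-Solver.solve 1 (λ w → con′ 108 :*′ w :+′
            (con′ 4 :*′ w :+′ (con′ 108 :*′ w :+′ con′ 27 :*′ w)) :=′ con′ 247 :*′ w) ≡.refl w))
      where
      open ℕ-Solver using () renaming (_:+_ to _:+′_; _:*_ to _:*′_; _:=_ to _:=′_; con to con′)
      w = n ℕ.* nd
      instance
        w≢0 : NonZero w
        w≢0 = ℕ.m*n≢0 n nd

  greedyStep-spec : ∀ {m} {D : ℕ → Carrier} → Base m → Holds-D D m →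
    Spec greedyStep m (247 ℕ.* (n ℕ.* nd)) (λ m′ → FrameD 11 m m′ × ∃ λ z → Minimal (greedy-cost D) z × Holds-D
        (relax D z) m′)
  greedyStep-spec {m} {D} base D≈ = spec-weaken bound (λ _ p → p)
      (spec-seq (argmin-spec greedyCost (greedy-cost D) base λ m′ z → greedy-spec {D} base D≈) λ m₃
          (fr₃ , z , z≡ , z-min) →
       spec-weaken ℕ.≤-refl (λ m₄ (fr₄ , D′) → frameD-trans (forget (frame-weaken 11 fr₃)) (frameD-weaken 11 fr₄) ,
           z , z-min , D′)
         (relax-spec (base-frame 15 fr₃ base) (D-frame fr₃ D≈) z≡ (proj₁ z-min)))
    where
    bound : 108 ℕ.* (n ℕ.* nd) ℕ.+ 27 ℕ.* nd ℕ.≤ 247 ℕ.* (n ℕ.* nd)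
    bound = ℕ.≤-trans (ℕ.+-monoʳ-≤ (108 ℕ.* (n ℕ.* nd)) (ℕ.*-monoʳ-≤ 27 (ℕ.m≤n*m nd n)))
        (ℕ.≤-trans (ℕ.≤-reflexive (≡.sym (ℕ.*-distribʳ-+ (n ℕ.* nd) 108 27)))
            (ℕ.*-monoˡ-≤ (n ℕ.* nd) (ℕ.≤ᵇ⇒≤ 135 247 _)))

  -- The run with the machine forgotten: only minimality of the chosen indices remains, so the
  -- analysis is independent of how ties are broken. The initial array belongs to point 0, a centre
  -- opened before any step.
  data CoverTrace : ℕ → (ℕ → Carrier) → Set where
    start : CoverTrace 0 (q 0)
    step  : ∀ {t D x z} → CoverTrace t D → Minimal (isolation-cost D) x → Minimal (median-cost D x) z → CoverTrace
        (suc t) (relax D z)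

  data GreedyTrace (D₀ : ℕ → Carrier) : ℕ → (ℕ → Carrier) → Set where
    start : GreedyTrace D₀ 0 D₀
    step  : ∀ {t D z} → GreedyTrace D₀ t D → Minimal (greedy-cost D) z → GreedyTrace D₀ (suc t) (relax D z)

  4k : ℕ
  4k = k ℕ.+ k ℕ.+ (k ℕ.+ k)

  coverPhase-spec : ∀ {m} → Base m → Holds-D (q 0) m →
    Spec coverPhase m (1 ℕ.+ (4k ℕ.* (247 ℕ.* (n ℕ.* nd) ℕ.+ 1 ℕ.+ 2) ℕ.+ 1))
        (λ m′ → Base m′ × ∃ λ D → CoverTrace 4k D × Holds-D D m′)
  coverPhase-spec {m} base D≈ =
      spec-seq (spec-block (setℕ 10 0 ∷ []) {m} {I 0}
          (base-frame 10 fr₀ base , ≡.refl , q 0 , start , D-frame fr₀ D≈)) λ m₁ I₁ →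
      spec-weaken ℕ.≤-refl (λ m′ (base′ , _ , p) → base′ , p)
        (spec-up (leqℕ 7 10) 4k I (λ m′ (base′ , t≡ , _) → ≤ᵇ-true (4k≡ base′) t≡ ℕ.≤-refl) body I₁)
    where
    fr₀ = frame-run 10 (setℕ 10 0 ∷ []) {m}
    I : ℕ → Mem → Set
    I t m′ = Base m′ × nat m′ 10 ≡ t × ∃ λ D → CoverTrace t D × Holds-D D m′
    body : ∀ t m′ → t ℕ.< 4k → I t m′ → holds (leqℕ 7 10) m′ ≡ false × Spec (coverStep ⨾ block (addℕ 10 3 10 ∷ []))
        m′ (247 ℕ.* (n ℕ.* nd) ℕ.+ 1) (I (suc t))
    body t m′ t<4k (base′ , t≡ , D , trace , D≈′) = ≤ᵇ-false (4k≡ base′) t≡ t<4k ,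
      spec-seq (coverStep-spec base′ D≈′) λ m″ (fr , x , z , x-min , z-min , D″) →
      let base″ = base-D 11 fr base′ ; fr‴ = frame-run 10 (addℕ 10 3 10 ∷ []) {m″} in
      spec-block (addℕ 10 3 10 ∷ []) (base-frame 10 fr‴ base″ , ≡.cong₂ ℕ._+_ (one≡ base″)
          (≡.trans (natsD fr 10 _) t≡) ,
        relax D z , step trace x-min z-min , D-frame fr‴ D″)

  -- `J` is any strict bound on the indices at which the stopping test fails; the exponential
  -- estimate supplies it later.
  greedyPhase-spec : ∀ {m D₀} J → Base m → Holds-D D₀ m →
    (∀ i → ¬ num 4 * num K * real m 5 ^ i ≤ ε → i ℕ.< J) →
    Spec greedyPhase m (2 ℕ.+ (J ℕ.* (247 ℕ.* (n ℕ.* nd) ℕ.+ 1 ℕ.+ 2) ℕ.+ 1)) (λ m′ → Base m′ × ∃ λ i → i ℕ.≤ J ×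
      num 4 * num K * real m 5 ^ i ≤ ε × ∃ λ D → GreedyTrace D₀ i D × Holds-D D m′)
  greedyPhase-spec {m} {D₀} J base D≈ J-bound =
      spec-seq (spec-block first {m} {I 0} (base-frame 10 fr₀ base , ≡.refl , e₀ , D₀ , start , D-frame fr₀ D≈)) λ
          m₁ I₁ →
      spec-weaken ℕ.≤-refl (λ m′ (le , i , i≤J , base′ , _ , e≈ , p) → base′ , i , i≤J , ≤-resp e≈
          (reflexive (ε≡ base′)) (em-true le) , p)
        (spec-while (leqᴿ 10 4) J I body I₁)
    where
    first = addᴿ 10 2 2 ∷ addᴿ 10 10 10 ∷ []
    fr₀ = frame-run 10 first {m}
    I : ℕ → Mem → Set
    I i m′ = Base m′ × real m′ 5 ≡ real m 5 × real m′ 10 ≈ num 4 * num K * real m 5 ^ i × ∃ λ D → GreedyTrace D₀ i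
        D × Holds-D D m′
    e₀ : real m 2 + real m 2 + (real m 2 + real m 2) ≈ num 4 * num K * 1#
    e₀ = trans (solve 1 (λ K → K :+ K :+ (K :+ K) := # 4 :* K :* # 1) refl (real m 2)) (*-congʳ (*-congˡ (K≈ base)))
      where open Solver using (solve; _:=_; _:+_; _:*_)
    body : ∀ i m′ → I i m′ → holds (leqᴿ 10 4) m′ ≡ false → i ℕ.< J × Spec (greedyStep ⨾ block (mulᴿ 10 10 5 ∷ []))
        m′ (247 ℕ.* (n ℕ.* nd) ℕ.+ 1) (I (suc i))
    body i m′ (base′ , c≡ , e≈ , D , trace , D≈′) nle =
      J-bound i (λ le → em-false nle (≤-resp (sym e≈) (reflexive (≡.sym (ε≡ base′))) le)) ,
      (spec-seq (greedyStep-spec base′ D≈′) λ m″ (fr , z , z-min , D″) →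
      let base″ = base-D 11 fr base′ ; fr‴ = frame-run 10 (mulᴿ 10 10 5 ∷ []) {m″} in
      spec-block (mulᴿ 10 10 5 ∷ []) (base-frame 10 fr‴ base″ , ≡.trans (realsD fr 5 _ (low<D 5)) c≡ ,
        trans (*-cong (trans (reflexive (realsD fr 10 _ (low<D 10))) e≈)
            (reflexive (≡.trans (realsD fr 5 _ (low<D 5)) c≡)))
          (solve 3 (λ a c p → a :* p :* c := a :* (c :* p)) refl (num 4 * num K) (real m 5) (real m 5 ^ i)) ,
        relax D z , step trace z-min , D-frame fr‴ D″))
      where open Solver using (solve; _:=_; _:+_; _:*_)

  -- R[0] is scratch and, when `dst` is 0, also a target. Going downwards writes that target in the
  -- very last iteration, so scratch values never spoil a copied cell.
  copy-spec : ∀ {m} src dst len → nat m 24 ≡ src → nat m 25 ≡ dst → nat m 26 ≡ len → nat m 3 ≡ 1 → nat m 8 ≡ 0 →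
    (∀ i j → i ℕ.< len → j ℕ.< len → ¬ src ℕ.+ i ≡ dst ℕ.+ j) → (∀ i → i ℕ.< len → ¬ src ℕ.+ i ≡ 0) →
    Spec copy m (len ℕ.* 7 ℕ.+ 1) (λ m′ → (∀ a → T ((a ℕ.<ᵇ 24) ∨ (31 ℕ.<ᵇ a)) → nat m′ a ≡ nat m a) ×
      (∀ j → j ℕ.< len → real m′ (dst ℕ.+ j) ≡ real m (src ℕ.+ j)) ×
      (∀ a → ¬ a ≡ 0 → (∀ j → j ℕ.< len → ¬ a ≡ dst ℕ.+ j) → real m′ a ≡ real m a))
  copy-spec {m} src dst len src≡ dst≡ len≡ one≡ zero≡ apart src≢0 =
      spec-weaken ℕ.≤-refl (λ m′ (same , _ , _ , _ , _ , copied , others) → same , (λ j j<len → copied j z≤n j<len)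
          , λ a a≢0 off → others a a≢0 λ i _ → off i)
        (spec-down (leqℕ 26 8) I (λ m′ (same , _ , _ , j≡ , _) → ≤ᵇ-true j≡ (≡.trans (same 8 _) zero≡) ℕ.≤-refl)
            step′ len
          ((λ _ _ → ≡.refl) , src≡ , dst≡ , len≡ , ℕ.≤-refl , (λ i len≤i i<len → contradiction len≤i (ℕ.<⇒≱ i<len))
              , λ _ _ _ → ≡.refl))
    where
    body = subℕ 26 26 3 ∷ addℕ 27 24 26 ∷ loadᴿ 0 27 ∷ addℕ 28 25 26 ∷ storeᴿ 28 0 ∷ []
    I : ℕ → Mem → Set
    I j m′ = (∀ a → T ((a ℕ.<ᵇ 24) ∨ (31 ℕ.<ᵇ a)) → nat m′ a ≡ nat m a) × nat m′ 24 ≡ src × nat m′ 25 ≡ dst × nat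
        m′ 26 ≡ j × j ℕ.≤ len ×
      (∀ i → j ℕ.≤ i → i ℕ.< len → real m′ (dst ℕ.+ i) ≡ real m (src ℕ.+ i)) ×
      (∀ a → ¬ a ≡ 0 → (∀ i → j ℕ.≤ i → i ℕ.< len → ¬ a ≡ dst ℕ.+ i) → real m′ a ≡ real m a)
    step′ : ∀ j m′ → I (suc j) m′ → holds (leqℕ 26 8) m′ ≡ false × Spec (block body) m′ 5 (I j)
    step′ j m′ (same , src≡′ , dst≡′ , j≡ , j<len , copied , others) =
      ≤ᵇ-false j≡ (≡.trans (same 8 _) zero≡) (s≤s z≤n) ,
      spec-block body ((λ a ok → ≡.trans (nats (frame-run 24 (subℕ 26 26 3 ∷ addℕ 27 24 26 ∷ addℕ 28 25 26 ∷ [])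
          {m′}) a ok) (same a ok)) ,
        src≡′ , dst≡′ , j≡′ , ℕ.<⇒≤ j<len , copied′ , others′)
      where
      j≡′ : nat m′ 26 ℕ.∸ nat m′ 3 ≡ j
      j≡′ = ≡.cong₂ ℕ._∸_ j≡ (≡.trans (same 3 _) one≡)
      from = nat m′ 24 ℕ.+ (nat m′ 26 ℕ.∸ nat m′ 3)
      to = nat m′ 25 ℕ.+ (nat m′ 26 ℕ.∸ nat m′ 3)
      to≡ : to ≡ dst ℕ.+ j
      to≡ = ≡.cong₂ ℕ._+_ dst≡′ j≡′
      v = real m′ from
      v≡ : v ≡ real m (src ℕ.+ j)
      v≡ = ≡.trans (≡.cong (real m′) (≡.cong₂ ℕ._+_ src≡′ j≡′))
          (others (src ℕ.+ j) (src≢0 j j<len) λ i _ i<len → apart j i j<len i<len)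
      mid = real m′ [ 0 ≔ v ]
      copied′ : ∀ i → j ℕ.≤ i → i ℕ.< len → (mid [ to ≔ v ]) (dst ℕ.+ i) ≡ real m (src ℕ.+ i)
      copied′ i j≤i i<len with i ℕ.≟ j
      ... | yes ≡.refl = ≡.trans (≡.cong (mid [ to ≔ v ]) (≡.sym to≡)) (≡.trans (≔-same mid to) v≡)
      ... | no i≢j = ≡.trans (≔-other mid to (dst ℕ.+ i) λ eq → i≢j (ℕ.+-cancelˡ-≡ dst i j (≡.trans (≡.sym eq) to≡)))
          (≡.trans (≔-other (real m′) 0 (dst ℕ.+ i) λ eq → ℕ.<⇒≢
              (ℕ.<-≤-trans (ℕ.≤-<-trans z≤n j<i) (ℕ.m≤n+m i dst)) eq) (copied i j<i i<len))
        where j<i = ℕ.≤∧≢⇒< j≤i λ j≡i → i≢j (≡.sym j≡i)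
      others′ : ∀ a → ¬ a ≡ 0 → (∀ i → j ℕ.≤ i → i ℕ.< len → ¬ a ≡ dst ℕ.+ i) → (mid [ to ≔ v ]) a ≡ real m a
      others′ a a≢0 off = ≡.trans (≔-other mid to a λ eq → off j ℕ.≤-refl j<len (≡.trans (≡.sym eq) to≡))
          (≡.trans (≔-other (real m′) 0 a λ eq → a≢0 (≡.sym eq)) (others a a≢0 λ i j<i → off i (ℕ.<⇒≤ j<i)))

-- Correctness of the set-up and of the output

module Execution (em : ExcludedMiddle 0ℓ) (ℝ : Reals) (n d k : ℕ) .{{_ : NonZero n}} .{{_ : NonZero d}}
    .{{_ : NonZero k}}
                 (pt : ℕ → ℕ → KMeans.Carrier em ℝ) (ε : KMeans.Carrier em ℝ) where

  open KMeans em ℝ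
  open OrderedField em ℝ
  open Algorithm em ℝ
  open Loops em ℝ n d k pt ε
  open Phases em ℝ n d k pt ε

  record Start (m : Mem) : Set where
    field
      n≡    : nat m 0 ≡ n
      d≡    : nat m 1 ≡ d
      k≡    : nat m 2 ≡ k
      rest≡ : ∀ a → 3 ℕ.≤ a → nat m a ≡ 0
      ε≡    : real m 0 ≡ ε
      cells : ∀ y l → y ℕ.< n → l ℕ.< d → real m (suc (y ℕ.* d ℕ.+ l)) ≡ pt y l

  record Ready (m : Mem) : Set where
    field
      n≡     : nat m 0 ≡ n
      d≡     : nat m 1 ≡ d
      k≡     : nat m 2 ≡ k
      one≡   : nat m 3 ≡ 1
      32≡    : nat m 4 ≡ 32
      D≡     : nat m 5 ≡ 33 ℕ.+ (nd ℕ.+ nd)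
      out≡   : nat m 6 ≡ 33 ℕ.+ (nd ℕ.+ nd ℕ.+ n)
      4k≡    : nat m 7 ≡ 4k
      zero≡  : nat m 8 ≡ 0
      stash≡ : nat m 11 ≡ 32 ℕ.+ (nd ℕ.+ nd)
      table  : ∀ y → y ℕ.< n → nat m (32 ℕ.+ y) ≡ 32 ℕ.+ (nd ℕ.+ y ℕ.* d)
      cells  : ∀ y l → y ℕ.< n → l ℕ.< d → real m (32 ℕ.+ (nd ℕ.+ (y ℕ.* d ℕ.+ l))) ≡ pt y l
      ε≡     : real m (32 ℕ.+ (nd ℕ.+ nd)) ≡ ε

  setup-bound : ℕ
  setup-bound = 4 ℕ.+ (n ℕ.* 4 ℕ.+ 1 ℕ.+ (8 ℕ.+ (nd ℕ.* 7 ℕ.+ 1 ℕ.+ (2 ℕ.+ (n ℕ.* 6 ℕ.+ 1)))))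

  setup-spec : ∀ {m} → Start m → Spec setup m setup-bound Ready
  setup-spec {m} s =
      spec-seq (spec-block init {m} {λ m′ → m′ ≡ m₁} ≡.refl) λ { m′ ≡.refl →
      spec-seq (spec-up (leqℕ 0 10) n Product multiplied multiply
          (frame-refl , rest≡ 9 (ℕ.≤ᵇ⇒≤ _ _ _) , rest≡ 10 (ℕ.≤ᵇ⇒≤ _ _ _) , ≡.refl)) λ m₂ product →
      spec-seq (spec-block layout {m₂} {λ m′ → m′ ≡ run layout m₂} ≡.refl) λ { m₃ ≡.refl →
      spec-seq (copy-spec 1 (32 ℕ.+ nd) nd ≡.refl (proj₁ (laid-out m₂ product)) (proj₂ (laid-out m₂ product))
                 (constant m₂ product 3 _ ≡.refl) (constant m₂ product 8 _ (rest≡ 8 (ℕ.≤ᵇ⇒≤ _ _ _)))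
                 (λ i j i<nd _ eq → ℕ.<⇒≱ (s≤s i<nd) (ℕ.≤-trans
                     (ℕ.m≤n+m (suc nd) 31 ⟨ ℕ.≤-trans ⟩ ℕ.≤-reflexive (ℕ.+-suc 31 nd))
                     (ℕ.≤-trans (ℕ.m≤m+n (32 ℕ.+ nd) j) (ℕ.≤-reflexive (≡.sym eq)))))
                 (λ i _ ())) λ m₄ copied →
      after-copy m₂ product m₄ copied } }
    where
    open Start s
    init = setℕ 3 1 ∷ setℕ 4 32 ∷ addℕ 7 2 2 ∷ addℕ 7 7 7 ∷ []
    layout = addℕ 10 4 9 ∷ addℕ 11 10 9 ∷ addℕ 5 3 11 ∷ addℕ 6 5 0 ∷ storeᴿ 11 0 ∷ setℕ 24 1 ∷ addℕ 25 8 10 ∷ addℕ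
        26 8 9 ∷ []
    m₁ = run init m
    -- The frame is applied to memories with blank reals, and the reals are asserted equal as a
    -- whole: R[0] still holds `ε`, which a frame would not protect.
    Product : ℕ → Mem → Set
    Product i m′ = Frame 9 (mem (nat m₁) (λ _ → 0#)) (mem (nat m′) (λ _ → 0#)) × nat m′ 9 ≡ i ℕ.* d × nat m′ 10 ≡ i
        × real m′ ≡ real m
    multiplied : ∀ m′ → Product n m′ → holds (leqℕ 0 10) m′ ≡ true
    multiplied m′ (fr , _ , i≡ , _) = ≤ᵇ-true (≡.trans (nats fr 0 _) n≡) i≡ ℕ.≤-refl
    multiply : ∀ i m′ → i ℕ.< n → Product i m′ → holds (leqℕ 0 10) m′ ≡ false × Spec
        (block (addℕ 9 1 9 ∷ addℕ 10 3 10 ∷ [])) m′ 2 (Product (suc i))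
    multiply i m′ i<n (fr , p≡ , i≡ , same) = ≤ᵇ-false (≡.trans (nats fr 0 _) n≡) i≡ i<n ,
      spec-block (addℕ 9 1 9 ∷ addℕ 10 3 10 ∷ []) (frame
          (λ a ok → ≡.trans (nats (frame-run 9 (addℕ 9 1 9 ∷ addℕ 10 3 10 ∷ []) {m′}) a ok) (nats fr a ok))
          (λ _ _ → ≡.refl) ,
        ≡.cong₂ ℕ._+_ (≡.trans (nats fr 1 _) d≡) p≡ , ≡.cong₂ ℕ._+_ (nats fr 3 _) i≡ , same)
    module _ (m₂ : Mem) (product : Product n m₂) where
      m₃ = run layout m₂
      fr₂ = proj₁ product
      nd≡ : nat m₂ 9 ≡ nd
      nd≡ = proj₁ (proj₂ product)
      X≡ : nat m₂ 4 ℕ.+ nat m₂ 9 ≡ 32 ℕ.+ nd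
      X≡ = ≡.cong₂ ℕ._+_ (nats fr₂ 4 _) nd≡
      stash≡₃ : nat m₃ 11 ≡ 32 ℕ.+ (nd ℕ.+ nd)
      stash≡₃ = ≡.cong₂ ℕ._+_ X≡ nd≡
      D≡₃ : nat m₃ 5 ≡ 33 ℕ.+ (nd ℕ.+ nd)
      D≡₃ = ≡.cong₂ ℕ._+_ (nats fr₂ 3 _) stash≡₃
      zero≡₂ : nat m₂ 8 ≡ 0
      zero≡₂ = ≡.trans (nats fr₂ 8 _) (rest≡ 8 (ℕ.≤ᵇ⇒≤ _ _ _))
      constant : ∀ a (_ : T ((a ℕ.<ᵇ 5) ∨ ((6 ℕ.<ᵇ a) ∧ (a ℕ.<ᵇ 9)))) {v} → nat m₁ a ≡ v → nat m₃ a ≡ v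
      constant 0 _ eq = ≡.trans (nats fr₂ 0 _) eq
      constant 1 _ eq = ≡.trans (nats fr₂ 1 _) eq
      constant 2 _ eq = ≡.trans (nats fr₂ 2 _) eq
      constant 3 _ eq = ≡.trans (nats fr₂ 3 _) eq
      constant 4 _ eq = ≡.trans (nats fr₂ 4 _) eq
      constant 7 _ eq = ≡.trans (nats fr₂ 7 _) eq
      constant 8 _ eq = ≡.trans (nats fr₂ 8 _) eq
      constant (suc (suc (suc (suc (suc (suc (suc (suc (suc a))))))))) () eq
      laid-out : nat m₃ 25 ≡ 32 ℕ.+ nd × nat m₃ 26 ≡ nd
      laid-out = ≡.cong₂ ℕ._+_ zero≡₂ X≡ , ≡.cong₂ ℕ._+_ zero≡₂ nd≡
      module _ (m₄ : Mem) (copied : (∀ a → T ((a ℕ.<ᵇ 24) ∨ (31 ℕ.<ᵇ a)) → nat m₄ a ≡ nat m₃ a) ×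
            (∀ j → j ℕ.< nd → real m₄ (32 ℕ.+ nd ℕ.+ j) ≡ real m₃ (1 ℕ.+ j)) ×
            (∀ a → ¬ a ≡ 0 → (∀ j → j ℕ.< nd → ¬ a ≡ 32 ℕ.+ nd ℕ.+ j) → real m₄ a ≡ real m₃ a)) where
        point-cells : ∀ y l → y ℕ.< n → l ℕ.< d → real m₄ (32 ℕ.+ (nd ℕ.+ (y ℕ.* d ℕ.+ l))) ≡ pt y l
        point-cells y l y<n l<d = ≡.trans (proj₁ (proj₂ copied) (y ℕ.* d ℕ.+ l) (cell< y<n l<d))
          (≡.trans (≔-other (real m₂) (nat m₃ 11) (suc (y ℕ.* d ℕ.+ l)) λ eq → ℕ.<⇒≢
              (ℕ.<-≤-trans (s≤s (cell< y<n l<d)) (s≤s (ℕ.m≤n+m nd 31 ⟨ ℕ.≤-trans ⟩ ℕ.+-monoʳ-≤ 31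
              (ℕ.m≤m+n nd nd)))) (≡.trans (≡.sym eq) stash≡₃))
            (≡.trans (≡.cong (λ r → r (suc (y ℕ.* d ℕ.+ l))) (proj₂ (proj₂ (proj₂ product)))) (cells y l y<n l<d)))
        stashed : real m₄ (32 ℕ.+ (nd ℕ.+ nd)) ≡ ε
        stashed = ≡.trans (proj₂ (proj₂ copied) _ (λ ()) λ j j<nd eq → ℕ.<⇒≢ j<nd
            (≡.sym (ℕ.+-cancelˡ-≡ nd nd j (ℕ.+-cancelˡ-≡ 32 (nd ℕ.+ nd) (nd ℕ.+ j) eq))))
          (≡.trans (≡.cong (real m₂ [ nat m₃ 11 ≔ real m₂ 0 ]) (≡.sym stash≡₃)) (≡.trans (≔-same (real m₂) (nat m₃ 11))
            (≡.trans (≡.cong (λ r → r 0) (proj₂ (proj₂ (proj₂ product)))) ε≡)))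
        first = setℕ 12 0 ∷ addℕ 13 8 10 ∷ []
        m₅ = run first m₄
        Table : ℕ → Mem → Set
        Table y m′ = (∀ a → a ℕ.< 12 → nat m′ a ≡ nat m₃ a) × nat m′ 12 ≡ y × nat m′ 13 ≡ 32 ℕ.+ (nd ℕ.+ y ℕ.* d) ×
          (∀ i → i ℕ.< y → nat m′ (32 ℕ.+ i) ≡ 32 ℕ.+ (nd ℕ.+ i ℕ.* d)) × real m′ ≡ real m₄
        below : ∀ a → a ℕ.< 12 → nat m₅ a ≡ nat m₃ a
        below a a<12 = ≡.trans (nats (frame-run 12 first {m₄}) a (∨-left (ℕ.<⇒<ᵇ a<12)))
            (proj₁ copied a (∨-left {a ℕ.<ᵇ 24} (ℕ.<⇒<ᵇ (ℕ.<-trans a<12 (ℕ.≤ᵇ⇒≤ 13 24 _)))))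
        filled : ∀ m′ → Table n m′ → holds (leqℕ 0 12) m′ ≡ true
        filled m′ (low , y≡ , _) = ≤ᵇ-true (≡.trans (low 0 (ℕ.≤ᵇ⇒≤ _ _ _)) (constant 0 _ n≡)) y≡ ℕ.≤-refl
        fill : ∀ y m′ → y ℕ.< n → Table y m′ → holds (leqℕ 0 12) m′ ≡ false ×
               Spec (block (addℕ 14 4 12 ∷ storeℕ 14 13 ∷ []) ⨾ block (addℕ 13 1 13 ∷ addℕ 12 3 12 ∷ [])) m′ 4
                   (Table (suc y))
        fill y m′ y<n (low , y≡ , p≡ , entries , same) = ≤ᵇ-false
            (≡.trans (low 0 (ℕ.≤ᵇ⇒≤ _ _ _)) (constant 0 _ n≡)) y≡ y<n ,
          (spec-seq (spec-block (addℕ 14 4 12 ∷ storeℕ 14 13 ∷ []) {m′} {λ m″ → (∀ a → a ℕ.< 14 → nat m″ a ≡ nat m′ a) ×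
              (∀ i → i ℕ.< suc y → nat m″ (32 ℕ.+ i) ≡ 32 ℕ.+ (nd ℕ.+ i ℕ.* d)) × real m″ ≡ real m₄}
                  (stored-low , stored , same)) λ m″ (low″ , entries″ , same″) →
           spec-block (addℕ 13 1 13 ∷ addℕ 12 3 12 ∷ [])
             ((λ a a<12 → ≡.trans (nats (frame-run 12 (addℕ 13 1 13 ∷ addℕ 12 3 12 ∷ []) {m″}) a
                 (∨-left (ℕ.<⇒<ᵇ a<12))) (≡.trans (low″ a (ℕ.<-trans a<12 (ℕ.≤ᵇ⇒≤ _ _ _))) (low a a<12))) ,
              ≡.cong₂ ℕ._+_ (≡.trans (low″ 3 (ℕ.≤ᵇ⇒≤ _ _ _))
                  (≡.trans (low 3 (ℕ.≤ᵇ⇒≤ _ _ _)) (constant 3 _ ≡.refl))) (≡.trans (low″ 12 (ℕ.≤ᵇ⇒≤ _ _ _)) y≡) ,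
              ≡.trans (≡.cong₂ ℕ._+_ (≡.trans (low″ 1 (ℕ.≤ᵇ⇒≤ _ _ _))
                  (≡.trans (low 1 (ℕ.≤ᵇ⇒≤ _ _ _)) (constant 1 _ d≡))) (≡.trans (low″ 13 (ℕ.≤ᵇ⇒≤ _ _ _)) p≡))
                (ℕ-Solver.solve 3 (λ d e f → d :+′ (con′ 32 :+′ (e :+′ f)) :=′ con′ 32 :+′ (e :+′ (d :+′ f)))
                    ≡.refl d nd (y ℕ.* d)) ,
              entries″ , same″))
          where
          open ℕ-Solver using () renaming (_:+_ to _:+′_; _:=_ to _:=′_; con to con′)
          A = nat m′ 4 ℕ.+ nat m′ 12
          A≡ : A ≡ 32 ℕ.+ y
          A≡ = ≡.cong₂ ℕ._+_ (≡.trans (low 4 (ℕ.≤ᵇ⇒≤ _ _ _)) (constant 4 _ ≡.refl)) y≡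
          f = nat m′ [ 14 ≔ A ]
          stored-low : ∀ a → a ℕ.< 14 → (f [ A ≔ nat m′ 13 ]) a ≡ nat m′ a
          stored-low a a<14 = ≡.trans (≔-other f A a λ eq → ℕ.<⇒≱ (ℕ.<-trans a<14 (ℕ.≤ᵇ⇒≤ 15 32 _))
              (ℕ.≤-trans (ℕ.m≤m+n 32 y) (ℕ.≤-reflexive (≡.trans (≡.sym A≡) eq))))
            (≔-other (nat m′) 14 a λ eq → ℕ.<⇒≢ a<14 (≡.sym eq))
          stored : ∀ i → i ℕ.< suc y → (f [ A ≔ nat m′ 13 ]) (32 ℕ.+ i) ≡ 32 ℕ.+ (nd ℕ.+ i ℕ.* d)
          stored i i<1+y with i ℕ.≟ y
          ... | yes ≡.refl = ≡.trans (≡.cong (f [ A ≔ nat m′ 13 ]) (≡.sym A≡)) (≡.trans (≔-same f A) p≡)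
          ... | no i≢y = ≡.trans (≔-other f A (32 ℕ.+ i) λ eq → i≢y (ℕ.+-cancelˡ-≡ 32 i y (≡.trans (≡.sym eq) A≡)))
              (entries i (ℕ.≤∧≢⇒< (ℕ.≤-pred i<1+y) i≢y))
        after-copy : Spec (block first ⨾ until (leqℕ 0 12)
            (block (addℕ 14 4 12 ∷ storeℕ 14 13 ∷ []) ⨾ block (addℕ 13 1 13 ∷ addℕ 12 3 12 ∷ []))) m₄
            (2 ℕ.+ (n ℕ.* 6 ℕ.+ 1)) Ready
        after-copy = spec-seq (spec-block first {m₄} {Table 0} (below , ≡.refl ,
              ≡.trans (≡.cong₂ ℕ._+_ (≡.trans (proj₁ copied 8 _) (constant 8 _ (rest≡ 8 (ℕ.≤ᵇ⇒≤ _ _ _))))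
                  (≡.trans (proj₁ copied 10 _) X≡)) (≡.cong (32 ℕ.+_) (≡.sym (ℕ.+-identityʳ nd))) ,
              (λ i ()) , ≡.refl)) λ m′ table₀ →
          spec-weaken ℕ.≤-refl (λ m″ (low , _ , _ , entries , same) → record
            { n≡ = ≡.trans (low 0 (ℕ.≤ᵇ⇒≤ _ _ _)) (constant 0 _ n≡) ; d≡ = ≡.trans (low 1 (ℕ.≤ᵇ⇒≤ _ _ _))
                (constant 1 _ d≡)
            ; k≡ = ≡.trans (low 2 (ℕ.≤ᵇ⇒≤ _ _ _)) (constant 2 _ k≡) ; one≡ = ≡.trans (low 3 (ℕ.≤ᵇ⇒≤ _ _ _))
                (constant 3 _ ≡.refl)
            ; 32≡ = ≡.trans (low 4 (ℕ.≤ᵇ⇒≤ _ _ _)) (constant 4 _ ≡.refl) ; D≡ = ≡.trans (low 5 (ℕ.≤ᵇ⇒≤ _ _ _)) D≡₃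
            ; out≡ = ≡.trans (low 6 (ℕ.≤ᵇ⇒≤ _ _ _)) (≡.cong₂ ℕ._+_ D≡₃ (constant 0 _ n≡))
            ; 4k≡ = ≡.trans (low 7 (ℕ.≤ᵇ⇒≤ _ _ _)) (constant 7 _
                (≡.cong₂ ℕ._+_ (≡.cong₂ ℕ._+_ k≡ k≡) (≡.cong₂ ℕ._+_ k≡ k≡)))
            ; zero≡ = ≡.trans (low 8 (ℕ.≤ᵇ⇒≤ _ _ _)) (constant 8 _ (rest≡ 8 (ℕ.≤ᵇ⇒≤ _ _ _))) ; stash≡ = ≡.trans
                (low 11 (ℕ.≤ᵇ⇒≤ _ _ _)) stash≡₃
            ; table = entries ; cells = λ y l y<n l<d → ≡.trans (≡.cong (λ r → r _) same) (point-cells y l y<n l<d)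
            ; ε≡ = ≡.trans (≡.cong (λ r → r (32 ℕ.+ (nd ℕ.+ nd))) same) stashed })
          (spec-up (leqℕ 0 12) n Table filled fill table₀)

  constants-spec : ∀ {m} → Ready m → Spec constants m (12 ℕ.+ (k ℕ.* 4 ℕ.+ 1 ℕ.+ 2)) Base
  constants-spec {m} r =
      spec-seq (spec-block first {m} {λ m′ → m′ ≡ m₁} ≡.refl) λ { m′ ≡.refl →
      spec-seq (spec-up (leqℕ 2 12) k I (λ m′ (ns , i≡ , _) → ≤ᵇ-true (≡.trans (ns 2 λ ()) R.k≡) i≡ ℕ.≤-refl) step′
                 ((λ _ _ → ≡.refl) , ≡.refl , (λ _ _ → ≡.refl) , trans (+-cong zero≈₁ zero≈₁)
                     (trans (+-identityʳ 0#) (sym num-0)))) λ m₂ (ns , _ , rs , k≈) →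
      spec-block (divᴿ 5 6 5 ∷ subᴿ 5 6 5 ∷ []) (record
        { n≡ = ≡.trans (ns 0 λ ()) R.n≡ ; d≡ = ≡.trans (ns 1 λ ()) R.d≡ ; k≡ = ≡.trans (ns 2 λ ()) R.k≡ ; one≡ =
            ≡.trans (ns 3 λ ()) R.one≡
        ; 32≡ = ≡.trans (ns 4 λ ()) R.32≡ ; D≡ = ≡.trans (ns 5 λ ()) R.D≡ ; out≡ = ≡.trans (ns 6 λ ()) R.out≡ ; 4k≡
            = ≡.trans (ns 7 λ ()) R.4k≡
        ; zero≡ = ≡.trans (ns 8 λ ()) R.zero≡ ; table = λ y y<n → ≡.trans (ns (32 ℕ.+ y) λ ()) (R.table y y<n)
        ; cells = λ y l y<n l<d → ≡.trans (rs (32 ℕ.+ (nd ℕ.+ (y ℕ.* d ℕ.+ l))) λ ()) (R.cells y l y<n l<d)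
        ; zero≈ = trans (reflexive (rs 1 λ ())) zero≈₁ ; K≈ = trans (reflexive (rs 2 λ ())) K≈₁
        ; 256≈ = trans (reflexive (rs 3 λ ())) (trans (+-cong 256≈₁ zero≈₁) (+-identityʳ _))
        ; ε≡ = ≡.trans (rs 4 λ ()) (≡.trans (≡.cong (real (run (List.take 9 first) m)) R.stash≡) R.ε≡)
        ; k⁻¹ = k⁻¹≈ (real m₂ 6) (real m₂ 5) (reflexive (rs 6 λ ())) k≈ }) }
    where
    module R = Ready r
    first = oneᴿ 6 ∷ subᴿ 1 6 6 ∷ addᴿ 2 6 6 ∷ mulᴿ 2 2 2 ∷ mulᴿ 2 2 2 ∷ mulᴿ 2 2 2 ∷ addᴿ 3 2 1 ∷
           mulᴿ 2 2 2 ∷ mulᴿ 2 2 2 ∷ loadᴿ 4 11 ∷ addᴿ 5 1 1 ∷ setℕ 12 0 ∷ []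
    m₁ = run first m
    I : ℕ → Mem → Set
    I i m′ = (∀ a → ¬ a ≡ 12 → nat m′ a ≡ nat m₁ a) × nat m′ 12 ≡ i × (∀ a → ¬ a ≡ 5 → real m′ a ≡ real m₁ a) ×
        real m′ 5 ≈ num i
    step′ : ∀ i m′ → i ℕ.< k → I i m′ → holds (leqℕ 2 12) m′ ≡ false × Spec
        (block (addᴿ 5 5 6 ∷ addℕ 12 3 12 ∷ [])) m′ 2 (I (suc i))
    step′ i m′ i<k (ns , i≡ , rs , k≈) = ≤ᵇ-false (≡.trans (ns 2 λ ()) R.k≡) i≡ i<k ,
      spec-block (addᴿ 5 5 6 ∷ addℕ 12 3 12 ∷ []) ((λ a a≢ → ≡.trans (≔-other (nat m′) 12 a λ eq → a≢ (≡.sym eq))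
          (ns a a≢)) ,
        ≡.cong₂ ℕ._+_ (≡.trans (ns 3 λ ()) R.one≡) i≡ ,
            (λ a a≢ → ≡.trans (≔-other (real m′) 5 a λ eq → a≢ (≡.sym eq)) (rs a a≢)) ,
        trans (+-cong k≈ (reflexive (rs 6 λ ()))) (trans (+-comm _ _) (sym (num-suc i))))
    zero≈₁ : 1# - 1# ≈ 0#
    zero≈₁ = -‿inverseʳ 1#
    square : ∀ a {x} → x ≈ num a → x * x ≈ num (a ℕ.* a)
    square a x≈ = trans (*-cong x≈ x≈) (sym (num-* a a))
    256≈₁ : (1# + 1#) * (1# + 1#) * ((1# + 1#) * (1# + 1#)) * ((1# + 1#) * (1# + 1#) * ((1# + 1#) * (1# + 1#))) ≈
        num 256
    256≈₁ = square 16 (square 4 (square 2 (trans (+-cong (sym num-1) (sym num-1)) (sym (num-+ 1 1)))))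
    K≈₁ = square 65536 (square 256 256≈₁)
    k⁻¹≈ : ∀ one x → one ≈ 1# → x ≈ num k → num k * (1# - (one - one * x ⁻¹)) ≈ 1#
    k⁻¹≈ one x one≈ x≈ = trans (*-cong (sym x≈) (+-congˡ (-‿cong (+-cong one≈ (-‿cong (*-congʳ one≈))))))
      (trans (solve 2 (λ x i → x :* (# 1 :- (# 1 :- # 1 :* i)) := x :* i) refl x (x ⁻¹))
        (*-inverseʳ λ x≈0 → ≰0⇒≉0 (num≰0 k) (trans (sym x≈) x≈0)))
      where open Solver using (solve; _:=_; _:*_; _:-_)

  open Base
  open FrameD

  -- `g` enumerates the points below `i` at distance 0 from the centres. A point opened several
  -- times is listed once, which is what makes the output free of repetitions.
  record Selected (D : ℕ → Carrier) (i c : ℕ) (g : ℕ → ℕ) : Set where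
    field
      c≤i       : c ℕ.≤ i
      bounded   : ∀ j → j ℕ.< c → g j ℕ.< i
      vanishing : ∀ j → j ℕ.< c → D (g j) ≤ 0#
      injective : ∀ j j′ → j ℕ.< c → j′ ℕ.< c → g j ≡ g j′ → j ≡ j′
      complete  : ∀ y → y ℕ.< i → D y ≤ 0# → ∃ λ j → j ℕ.< c × g j ≡ y

  open Selected

  skip-point : ∀ {D i c g} → Selected D i c g → ¬ D i ≤ 0# → Selected D (suc i) c g
  skip-point {D} {i} {c} {g} s D≰0 = record
    { c≤i = ℕ.m≤n⇒m≤1+n (c≤i s) ; bounded = λ j j<c → ℕ.m<n⇒m<1+n (bounded s j j<c) ; vanishing = vanishing s ;
        injective = injective s ; complete = all′ }
    where
    all′ : ∀ y → y ℕ.< suc i → D y ≤ 0# → ∃ λ j → j ℕ.< c × g j ≡ y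
    all′ y y<1+i Dy≤0 with y ℕ.≟ i
    ... | yes ≡.refl = contradiction Dy≤0 D≰0
    ... | no y≢i     = complete s y (ℕ.≤∧≢⇒< (ℕ.≤-pred y<1+i) y≢i) Dy≤0

  select-point : ∀ {D i c g} → Selected D i c g → D i ≤ 0# → Selected D (suc i) (suc c) (g [ c ≔ i ])
  select-point {D} {i} {c} {g} s D≤0 = record
    { c≤i = s≤s (c≤i s) ; bounded = bounded′ ; vanishing = vanishing′ ; injective = injective′ ; complete = complete′ }
    where
    cases : ∀ j → j ℕ.< suc c → (j ≡ c × (g [ c ≔ i ]) j ≡ i) ⊎ (j ℕ.< c × (g [ c ≔ i ]) j ≡ g j)
    cases j j<1+c with j ℕ.≟ c
    ... | yes ≡.refl = inj₁ (≡.refl , ≔-same g c)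
    ... | no j≢c     = inj₂ (ℕ.≤∧≢⇒< (ℕ.≤-pred j<1+c) j≢c , ≔-other g c j λ eq → j≢c (≡.sym eq))
    bounded′ : ∀ j → j ℕ.< suc c → (g [ c ≔ i ]) j ℕ.< suc i
    bounded′ j j<1+c with cases j j<1+c
    ... | inj₁ (_ , eq)   = s≤s (ℕ.≤-reflexive eq)
    ... | inj₂ (j<c , eq) = s≤s (ℕ.≤-trans (ℕ.≤-reflexive eq) (ℕ.<⇒≤ (bounded s j j<c)))
    vanishing′ : ∀ j → j ℕ.< suc c → D ((g [ c ≔ i ]) j) ≤ 0#
    vanishing′ j j<1+c with cases j j<1+c
    ... | inj₁ (_ , eq)   = ≡.subst (λ y → D y ≤ 0#) (≡.sym eq) D≤0
    ... | inj₂ (j<c , eq) = ≡.subst (λ y → D y ≤ 0#) (≡.sym eq) (vanishing s j j<c)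
    injective′ : ∀ j j′ → j ℕ.< suc c → j′ ℕ.< suc c → (g [ c ≔ i ]) j ≡ (g [ c ≔ i ]) j′ → j ≡ j′
    injective′ j j′ j<1+c j′<1+c eq with cases j j<1+c | cases j′ j′<1+c
    ... | inj₁ (≡.refl , _) | inj₁ (≡.refl , _)  = ≡.refl
    ... | inj₁ (_ , gj)     | inj₂ (j′<c , gj′)  = contradiction (≡.trans (≡.sym gj′) (≡.trans (≡.sym eq) gj))
        (ℕ.<⇒≢ (bounded s j′ j′<c))
    ... | inj₂ (j<c , gj)   | inj₁ (_ , gj′)     = contradiction (≡.trans (≡.sym gj) (≡.trans eq gj′))
        (ℕ.<⇒≢ (bounded s j j<c))
    ... | inj₂ (j<c , gj)   | inj₂ (j′<c , gj′)  = injective s j j′ j<c j′<c (≡.trans (≡.sym gj) (≡.trans eq gj′))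
    complete′ : ∀ y → y ℕ.< suc i → D y ≤ 0# → ∃ λ j → j ℕ.< suc c × (g [ c ≔ i ]) j ≡ y
    complete′ y y<1+i Dy≤0 with y ℕ.≟ i
    ... | yes ≡.refl = c , ℕ.n<1+n c , ≔-same g c
    ... | no y≢i with complete s y (ℕ.≤∧≢⇒< (ℕ.≤-pred y<1+i) y≢i) Dy≤0
    ...   | j , j<c , gj≡y = j , ℕ.m<n⇒m<1+n j<c , ≡.trans (≔-other g c j λ eq → ℕ.<⇒≢ j<c (≡.sym eq)) gj≡y

  Outputs-points : Mem → (ℕ → Carrier) → Set
  Outputs-points m D = ∃ λ c → ∃ λ g → nat m 0 ≡ c × Selected D n c g ×
    (∀ j l → j ℕ.< c → l ℕ.< d → real m (j ℕ.* d ℕ.+ l) ≡ pt (g j) l)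

  output-bound : ℕ
  output-bound = 3 ℕ.+ (n ℕ.* (21 ℕ.* d ℕ.+ 2) ℕ.+ 1 ℕ.+ (4 ℕ.+ (nd ℕ.* 7 ℕ.+ 1)))

  output-spec : ∀ {m} {D : ℕ → Carrier} → Base m → Holds-D D m → Spec output m output-bound (λ m′ → Outputs-points m′ D)
  output-spec {m} {D} base D≈ =
      spec-seq (spec-block first {m} {I 0} (forget (frame-run 10 first) , (λ y _ → ≡.refl) , ≡.refl , 0 , (λ y → y)
          , ≡.refl ,
          ≡.trans (≡.cong₂ ℕ._+_ (zero≡ base) (out≡ base)) (≡.cong (33 ℕ.+_) (≡.sym (ℕ.+-identityʳ _))) ,
          record { c≤i = z≤n ; bounded = λ j () ; vanishing = λ j () ; injective = λ j j′ () ; complete = λ y () }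
              , λ j l ())) λ m₁ I₁ →
      spec-seq (spec-up (leqℕ 0 20) n I (λ m′ (fr , _ , i≡ , _) → ≤ᵇ-true (n≡ (base-D 10 fr base)) i≡ ℕ.≤-refl)
          step′ I₁) λ m₂ I₂ →
      finish m₂ I₂
    where
    first = setℕ 10 0 ∷ addℕ 11 8 6 ∷ setℕ 20 0 ∷ []
    test = addℕ 21 5 20 ∷ loadᴿ 22 21 ∷ setℕ 22 1 ∷ []
    prepare = addℕ 21 4 20 ∷ loadℕ 24 21 ∷ addℕ 25 8 11 ∷ addℕ 26 8 1 ∷ []
    count = addℕ 11 1 11 ∷ addℕ 10 3 10 ∷ []
    out = nd ℕ.+ nd ℕ.+ n
    D-cells : Mem → Mem → Set
    D-cells m m′ = ∀ y → y ℕ.< n → real m′ (slot y) ≡ real m (slot y)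
    Written : Mem → ℕ → Set
    Written m′ i = ∃ λ c → ∃ λ g → nat m′ 10 ≡ c × nat m′ 11 ≡ 33 ℕ.+ (out ℕ.+ c ℕ.* d) × Selected D i c g ×
      (∀ j l → j ℕ.< c → l ℕ.< d → real m′ (33 ℕ.+ (out ℕ.+ (j ℕ.* d ℕ.+ l))) ≡ pt (g j) l)
    I : ℕ → Mem → Set
    I i m′ = FrameD 10 m m′ × D-cells m m′ × nat m′ 20 ≡ i × Written m′ i
    frame-cells : ∀ {c m m′} → Frame c m m′ → ∀ a → real m′ (33 ℕ.+ a) ≡ real m (33 ℕ.+ a)
    frame-cells {c} fr a = reals fr (33 ℕ.+ a) (∨-right ((0 ℕ.<ᵇ (33 ℕ.+ a)) ∧ ((33 ℕ.+ a) ℕ.<ᵇ c)) tt)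
    body = block test ⨾ unless (leqᴿ 22 1) (block (setℕ 22 0 ∷ [])) ⨾
           unless (leqℕ 22 8) (block prepare ⨾ copy ⨾ block count) ⨾ block (addℕ 20 3 20 ∷ [])
    step′ : ∀ i m′ → i ℕ.< n → I i m′ → holds (leqℕ 0 20) m′ ≡ false × Spec body m′ (21 ℕ.* d) (I (suc i))
    step′ i m′ i<n (fr , cells≡ , i≡ , c , g , c≡ , p≡ , sel , written) = ≤ᵇ-false (n≡ base′) i≡ i<n , spec-weaken
        bound (λ _ p → p)
      (spec-seq (spec-block test {m′} {λ m₁ → Frame 21 m′ m₁ × nat m₁ 22 ≡ 1 × real m₁ 22 ≈ D i}
         (frame-run 21 test , ≡.refl , trans (reflexive
             (≡.trans (≡.cong (real m′) (D-address base′ i≡)) (cells≡ i i<n))) (D≈ i i<n))) λ m₁ (fr₁ , one , D≈₁) →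
       spec-seq (spec-unless (leqᴿ 22 1) {m = m₁} {Q = λ m₂ → Frame 21 m′ m₂ ×
           ((nat m₂ 22 ≡ 1 × D i ≤ 0#) ⊎ (nat m₂ 22 ≡ 0 × ¬ D i ≤ 0#))}
         (λ le → fr₁ , inj₁ (one , ≤-resp D≈₁ (zero≈ (base-frame 21 fr₁ base′)) (em-true le)))
         (λ nle → spec-block (setℕ 22 0 ∷ []) (frame-trans fr₁ (frame-run 21 (setℕ 22 0 ∷ [])) , inj₂
             (≡.refl , λ Di≤0 → em-false nle (≤-resp (sym D≈₁) (sym (zero≈ (base-frame 21 fr₁ base′))) Di≤0))))) λ
             m₂ (fr₂ , flag) →
       spec-seq (spec-unless (leqℕ 22 8) {m = m₂} {Q = Next} (skipped m₂ fr₂ flag) (selected m₂ fr₂ flag)) λ m₃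
           (fr₃ , cells₃ , i≡₃ , written₃) →
       spec-block (addℕ 20 3 20 ∷ []) (frameD-trans fr₃ (forget (frame-run 10 (addℕ 20 3 20 ∷ []))) , cells₃ ,
           ≡.cong₂ ℕ._+_ (one≡ (base-D 10 fr₃ base)) i≡₃ , written₃))
      where
      base′ = base-D 10 fr base
      bound : 3 ℕ.+ (2 ℕ.+ (suc (4 ℕ.+ (d ℕ.* 7 ℕ.+ 1 ℕ.+ 2)) ℕ.+ 1)) ℕ.≤ 21 ℕ.* d
      bound = ℕ.≤-trans (ℕ.≤-reflexive (ℕ-Solver.solve 1
          (λ d → con′ 3 :+′ (con′ 2 :+′ (con′ 1 :+′ (con′ 4 :+′ (d :*′ con′ 7 :+′ con′ 1 :+′ con′ 2)) :+′ con′ 1))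
          :=′ con′ 14 :+′ con′ 7 :*′ d) ≡.refl d)) (flat 14 7 d)
        where open ℕ-Solver using () renaming (_:+_ to _:+′_; _:*_ to _:*′_; _:=_ to _:=′_; con to con′)
      Next : Mem → Set
      Next m₃ = FrameD 10 m m₃ × D-cells m m₃ × nat m₃ 20 ≡ i × Written m₃ (suc i)
      skipped : ∀ m₂ → Frame 21 m′ m₂ → (nat m₂ 22 ≡ 1 × D i ≤ 0#) ⊎ (nat m₂ 22 ≡ 0 × ¬ D i ≤ 0#) → holds
          (leqℕ 22 8) m₂ ≡ true → Next m₂
      skipped m₂ fr₂ (inj₁ (one , _)) le = contradiction
          (≡.trans (≡.sym le) (≤ᵇ-false one (zero≡ (base-frame 21 fr₂ base′)) (s≤s z≤n))) λ ()
      skipped m₂ fr₂ (inj₂ (_ , D≰0)) le = frameD-trans fr (forget (frame-weaken 10 fr₂)) ,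
          (λ y y<n → ≡.trans (frame-cells fr₂ _) (cells≡ y y<n)) , ≡.trans (nats fr₂ 20 _) i≡ ,
        c , g , ≡.trans (nats fr₂ 10 _) c≡ , ≡.trans (nats fr₂ 11 _) p≡ , skip-point sel D≰0 , λ j l j<c l<d →
            ≡.trans (frame-cells fr₂ _) (written j l j<c l<d)
      selected : ∀ m₂ → Frame 21 m′ m₂ → (nat m₂ 22 ≡ 1 × D i ≤ 0#) ⊎ (nat m₂ 22 ≡ 0 × ¬ D i ≤ 0#) → holds
          (leqℕ 22 8) m₂ ≡ false →
                 Spec (block prepare ⨾ copy ⨾ block count) m₂ (4 ℕ.+ (d ℕ.* 7 ℕ.+ 1 ℕ.+ 2)) Next
      selected m₂ fr₂ (inj₂ (zero′ , _)) nle = contradiction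
          (≡.trans (≡.sym nle) (≤ᵇ-true zero′ (zero≡ (base-frame 21 fr₂ base′)) z≤n)) λ ()
      selected m₂ fr₂ (inj₁ (_ , D≤0)) nle =
          spec-seq (spec-block prepare {m₂} {λ m₃ → m₃ ≡ run prepare m₂} ≡.refl) λ { m₃ ≡.refl →
          spec-seq (copy-spec (32 ℕ.+ (nd ℕ.+ i ℕ.* d)) (33 ℕ.+ (out ℕ.+ c ℕ.* d)) d source
              (≡.cong₂ ℕ._+_ (zero≡ base₂) p≡₂) (≡.cong₂ ℕ._+_ (zero≡ base₂) (d≡ base₂)) (one≡ base₂) (zero≡ base₂)
            (λ a b a<d _ eq → ℕ.<⇒≢ (source<out a b a<d) (≡.trans (≡.sym (shuffle a)) eq)) (λ a _ ())) λ m₄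
                (ns , copied , others) →
          spec-block count (wrap m₄ ns copied others) }
        where
        base₂ = base-frame 21 fr₂ base′
        p≡₂ : nat m₂ 11 ≡ 33 ℕ.+ (out ℕ.+ c ℕ.* d)
        p≡₂ = ≡.trans (nats fr₂ 11 _) p≡
        m₃ = run prepare m₂
        fr₃ : Frame 21 m′ m₃
        fr₃ = frame-trans fr₂ (frame-run 21 prepare)
        source : nat m₃ 24 ≡ 32 ℕ.+ (nd ℕ.+ i ℕ.* d)
        source = ≡.trans (≡.cong (nat m₂ [ 21 ≔ nat m₂ 4 ℕ.+ nat m₂ 20 ])
            (≡.cong₂ ℕ._+_ (32≡ base₂) (≡.trans (nats fr₂ 20 _) i≡))) (table base₂ i i<n)
        shuffle : ∀ a → 32 ℕ.+ (nd ℕ.+ i ℕ.* d) ℕ.+ a ≡ 32 ℕ.+ (nd ℕ.+ (i ℕ.* d ℕ.+ a))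
        shuffle a = ≡.cong (32 ℕ.+_) (ℕ.+-assoc nd (i ℕ.* d) a)
        source<out : ∀ a b → a ℕ.< d → 32 ℕ.+ (nd ℕ.+ (i ℕ.* d ℕ.+ a)) ℕ.< 33 ℕ.+ (out ℕ.+ c ℕ.* d) ℕ.+ b
        source<out a b a<d = s≤s (ℕ.+-monoʳ-≤ 32 (ℕ.≤-trans (ℕ.+-monoʳ-≤ nd (ℕ.<⇒≤ (cell< i<n a<d)))
            (ℕ.≤-trans (ℕ.m≤m+n (nd ℕ.+ nd) n) (ℕ.≤-trans (ℕ.m≤m+n out (c ℕ.* d)) (ℕ.m≤m+n (out ℕ.+ c ℕ.* d) b)))))
        wrap : ∀ m₄ → (∀ a → T ((a ℕ.<ᵇ 24) ∨ (31 ℕ.<ᵇ a)) → nat m₄ a ≡ nat m₃ a) →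
               (∀ j → j ℕ.< d → real m₄ (33 ℕ.+ (out ℕ.+ c ℕ.* d) ℕ.+ j) ≡ real m₃ (32 ℕ.+ (nd ℕ.+ i ℕ.* d) ℕ.+ j)) →
               (∀ a → ¬ a ≡ 0 → (∀ j → j ℕ.< d → ¬ a ≡ 33 ℕ.+ (out ℕ.+ c ℕ.* d) ℕ.+ j) → real m₄ a ≡ real m₃ a) →
                   Next (run count m₄)
        wrap m₄ ns copied others =
            frameD-trans fr (frameD-trans (forget (frame-weaken 10 fr₃))
                (frameD-trans (frameD (λ a ok → ns a (low a ok)) (λ a ok a<D → others a (positive a ok) λ j _ eq →
              ℕ.<⇒≱ a<D (ℕ.≤-trans (ℕ.+-monoʳ-≤ 33 (ℕ.≤-trans (ℕ.m≤m+n (nd ℕ.+ nd) n)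
                  (ℕ.≤-trans (ℕ.m≤m+n out (c ℕ.* d)) (ℕ.m≤m+n _ j)))) (ℕ.≤-reflexive (≡.sym eq)))))
                  (forget (frame-run 10 count {m₄})))) ,
            (λ y y<n → ≡.trans (others _ (λ ()) λ j _ eq → ℕ.<⇒≢ (D<out y j y<n) eq)
                (≡.trans (frame-cells fr₃ _) (cells≡ y y<n))) ,
            ≡.trans (ns 20 _) (≡.trans (nats fr₃ 20 _) i≡) ,
            suc c , (g [ c ≔ i ]) , ≡.cong₂ ℕ._+_ (≡.trans (ns 3 _) (one≡ base₂))
                (≡.trans (ns 10 _) (≡.trans (nats fr₃ 10 _) c≡)) ,
            ≡.trans (≡.cong₂ ℕ._+_ (≡.trans (ns 1 _) (d≡ base₂)) (≡.trans (ns 11 _) (≡.trans (nats fr₃ 11 _) p≡)))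
              (ℕ-Solver.solve 3 (λ d o e → d :+′ (con′ 33 :+′ (o :+′ e)) :=′ con′ 33 :+′ (o :+′ (d :+′ e))) ≡.refl
                  d out (c ℕ.* d)) ,
            select-point sel D≤0 , written′
          where
          open ℕ-Solver using () renaming (_:+_ to _:+′_; _:=_ to _:=′_; con to con′)
          low : ∀ a → T ((a ℕ.<ᵇ 10) ∨ (31 ℕ.<ᵇ a)) → T ((a ℕ.<ᵇ 24) ∨ (31 ℕ.<ᵇ a))
          low a ok with a ℕ.<ᵇ 10 in eq
          ... | true  = ∨-left (ℕ.<⇒<ᵇ (ℕ.<-trans (ℕ.<ᵇ⇒< a 10 (≡.subst T (≡.sym eq) tt)) (ℕ.≤ᵇ⇒≤ 11 24 _)))
          ... | false = ∨-right (a ℕ.<ᵇ 24) ok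
          positive : ∀ a → T (((0 ℕ.<ᵇ a) ∧ (a ℕ.<ᵇ 10)) ∨ (31 ℕ.<ᵇ a)) → ¬ a ≡ 0
          positive zero () _
          positive (suc a) _ ()
          D<out : ∀ y j → y ℕ.< n → slot y ℕ.< 33 ℕ.+ (out ℕ.+ c ℕ.* d) ℕ.+ j
          D<out y j y<n = ℕ.+-monoʳ-< 33 (ℕ.<-≤-trans (ℕ.+-monoʳ-< (nd ℕ.+ nd) y<n)
              (ℕ.≤-trans (ℕ.m≤m+n out (c ℕ.* d)) (ℕ.m≤m+n _ j)))
          written′ : ∀ j l → j ℕ.< suc c → l ℕ.< d → real m₄ (33 ℕ.+ (out ℕ.+ (j ℕ.* d ℕ.+ l))) ≡ pt ((g [ c ≔ i ]) j) l
          written′ j l j<1+c l<d with j ℕ.≟ c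
          ... | yes ≡.refl = ≡.trans (≡.cong (λ a → real m₄ (33 ℕ.+ a)) (≡.sym (ℕ.+-assoc out (c ℕ.* d) l)))
              (≡.trans (copied l l<d)
                (≡.trans (≡.cong (real m₃) (shuffle l)) (≡.trans (cells (base-frame 21 fr₃ base′) i l i<n l<d)
                    (≡.cong (λ y → pt y l) (≡.sym (≔-same g c))))))
          ... | no j≢c = ≡.trans (others _ (λ ()) λ b _ eq → ℕ.<⇒≢ (earlier b)
              (ℕ.+-cancelˡ-≡ (33 ℕ.+ out) (j ℕ.* d ℕ.+ l) (c ℕ.* d ℕ.+ b)
              (≡.trans eq (≡.cong (33 ℕ.+_) (ℕ.+-assoc out (c ℕ.* d) b)))))
                (≡.trans (frame-cells fr₃ _) (≡.trans (written j l j<c l<d)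
                    (≡.cong (λ y → pt y l) (≡.sym (≔-other g c j λ eq → j≢c (≡.sym eq))))))
            where
            j<c = ℕ.≤∧≢⇒< (ℕ.≤-pred j<1+c) j≢c
            earlier : ∀ b → j ℕ.* d ℕ.+ l ℕ.< c ℕ.* d ℕ.+ b
            earlier b = ℕ.<-≤-trans (ℕ.+-monoʳ-< (j ℕ.* d) l<d)
                (ℕ.≤-trans (ℕ.≤-reflexive (ℕ.+-comm (j ℕ.* d) d)) (ℕ.≤-trans (ℕ.*-monoˡ-≤ d j<c) (ℕ.m≤m+n (c ℕ.* d) b)))
    finish : ∀ m₂ → I n m₂ → Spec (block (addℕ 24 8 6 ∷ setℕ 25 0 ∷ subℕ 26 11 6 ∷ addℕ 0 8 10 ∷ []) ⨾ copy) m₂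
        (4 ℕ.+ (nd ℕ.* 7 ℕ.+ 1)) (λ m′ → Outputs-points m′ D)
    finish m₂ (fr , _ , _ , c , g , c≡ , p≡ , sel , written) =
        spec-seq (spec-block last {m₂} {λ m₃ → m₃ ≡ run last m₂} ≡.refl) λ { m₃ ≡.refl →
        spec-weaken (ℕ.+-monoˡ-≤ 1 (ℕ.*-monoˡ-≤ 7 (ℕ.*-monoˡ-≤ d (c≤i sel)))) (λ m₄ (ns , copied , _) →
            c , g , ≡.trans (ns 0 _) (≡.cong₂ ℕ._+_ (zero≡ base₂) c≡) , sel , λ j l j<c l<d → ≡.trans
                (copied (j ℕ.* d ℕ.+ l) (inside j<c l<d)) (written j l j<c l<d))
          (copy-spec (33 ℕ.+ out) 0 (c ℕ.* d) (≡.cong₂ ℕ._+_ (zero≡ base₂) (out≡ base₂)) ≡.refl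
            (≡.trans (≡.cong₂ ℕ._∸_ p≡ (out≡ base₂)) (ℕ.m+n∸m≡n (33 ℕ.+ out) (c ℕ.* d))) (one≡ base₂) (zero≡ base₂)
            (λ a b _ b<cd eq → ℕ.<⇒≱ (ℕ.<-≤-trans b<cd (ℕ.*-monoˡ-≤ d (c≤i sel)))
                (ℕ.≤-trans (ℕ.m≤n+m nd 33) (ℕ.≤-trans (ℕ.+-monoʳ-≤ 33
                (ℕ.≤-trans (ℕ.m≤m+n nd nd) (ℕ.≤-trans (ℕ.m≤m+n (nd ℕ.+ nd) n) (ℕ.m≤m+n out a)))) (ℕ.≤-reflexive eq))))
            (λ a _ ())) }
      where
      last = addℕ 24 8 6 ∷ setℕ 25 0 ∷ subℕ 26 11 6 ∷ addℕ 0 8 10 ∷ []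
      base₂ = base-D 10 fr base
      inside : ∀ {j l} → j ℕ.< c → l ℕ.< d → j ℕ.* d ℕ.+ l ℕ.< c ℕ.* d
      inside {j} {l} j<c l<d = ℕ.<-≤-trans (ℕ.+-monoʳ-< (j ℕ.* d) l<d)
          (ℕ.≤-trans (ℕ.≤-reflexive (ℕ.+-comm (j ℕ.* d) d)) (ℕ.*-monoˡ-≤ d j<c))

-- Cost analysis of a trace

module TraceAnalysis (em : ExcludedMiddle 0ℓ) (ℝ : Reals) (n d k : ℕ) .{{_ : NonZero n}} .{{_ : NonZero d}}
    .{{_ : NonZero k}}
                     (pt : ℕ → ℕ → KMeans.Carrier em ℝ) (ε : KMeans.Carrier em ℝ) where

  open KMeans em ℝ
  open OrderedField em ℝ
  open Algorithm em ℝ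
  open Loops em ℝ n d k pt ε
  open Phases em ℝ n d k pt ε
  open Packing em ℝ using (pos; 0≤pos; Run; packing-bound)
  open Clusters em ℝ hiding (W)
  open Solver using (solve; _:=_; _:+_; _:*_; _:-_; :-_)
  open Min totalOrder using (x≤y⇒x⊓y≈x; x≤y⇒y⊓x≈x; ⊓-comm)
  open Max totalOrder using () renaming (x≤y⇒x⊔y≈y to ⊔-right; x≤y⇒y⊔x≈y to ⊔-left)

  P : ℕ → Point d
  P y l = pt y (toℕ l)

  q≈dist : ∀ x y → q x y ≈ dist (P x) (P y)
  q≈dist x y = sym (sum≈∑ d _ _ λ l → refl)

  0≤q : ∀ x y → 0# ≤ q x y
  0≤q x y = ≤-resp refl (sym (q≈dist x y)) (0≤dist (P x) (P y))

  q-refl : ∀ x → q x x ≈ 0#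
  q-refl x = trans (q≈dist x x) (dist-refl (P x))

  q-sym : ∀ x y → q x y ≈ q y x
  q-sym x y = trans (q≈dist x y) (trans (dist-sym (P x) (P y)) (sym (q≈dist y x)))

  q-tri : ∀ x y z → q x z ≤ num 2 * (q x y + q y z)
  q-tri x y z = ≤-resp (sym (q≈dist x z)) (*-congˡ (+-cong (sym (q≈dist x y)) (sym (q≈dist y z))))
      (dist-tri (P x) (P y) (P z))

  relax≤ˡ : ∀ D z y → relax D z y ≤ D y
  relax≤ˡ D z y = x⊓y≤x (D y) (q z y)

  relax≤ʳ : ∀ D z y → relax D z y ≤ q z y
  relax≤ʳ D z y = x⊓y≤y (D y) (q z y)

  -- Characterises `D y` as the distance to the nearest of the centres opened so far. `s` may repeat
  -- a point, so `c` counts openings.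
  record Centres (D : ℕ → Carrier) (c : ℕ) : Set where
    field
      s        : ℕ → ℕ
      s<n      : ∀ j → j ℕ.< c → s j ℕ.< n
      lower    : ∀ j y → j ℕ.< c → D y ≤ q (s j) y
      attained : ∀ y → ∃ λ j → j ℕ.< c × q (s j) y ≤ D y

    0≤D : ∀ y → 0# ≤ D y
    0≤D y with attained y
    ... | j , _ , q≤D = ≤-trans (0≤q (s j) y) q≤D

  initial-centre : Centres (q 0) 1
  initial-centre = record
    { s = λ _ → 0 ; s<n = λ _ _ → ℕ.>-nonZero⁻¹ n ; lower = λ _ _ _ → ≤-refl ; attained = λ _ → 0 , s≤s z≤n , ≤-refl }

  add-centre : ∀ {D c z} → Centres D c → z ℕ.< n → Centres (relax D z) (suc c)
  add-centre {D} {c} {z} C z<n = record { s = s [ c ≔ z ] ; s<n = s<n′ ; lower = lower′ ; attained = attained′ }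
    where
    open Centres C
    cases : ∀ j → j ℕ.< suc c → (s [ c ≔ z ]) j ≡ z ⊎ (j ℕ.< c × (s [ c ≔ z ]) j ≡ s j)
    cases j j<1+c with j ℕ.≟ c
    ... | yes ≡.refl = inj₁ (≔-same s c)
    ... | no j≢c     = inj₂ (ℕ.≤∧≢⇒< (ℕ.≤-pred j<1+c) j≢c , ≔-other s c j λ eq → j≢c (≡.sym eq))
    s<n′ : ∀ j → j ℕ.< suc c → (s [ c ≔ z ]) j ℕ.< n
    s<n′ j j<1+c with cases j j<1+c
    ... | inj₁ eq         = ≡.subst (ℕ._< n) (≡.sym eq) z<n
    ... | inj₂ (j<c , eq) = ≡.subst (ℕ._< n) (≡.sym eq) (s<n j j<c)
    lower′ : ∀ j y → j ℕ.< suc c → relax D z y ≤ q ((s [ c ≔ z ]) j) y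
    lower′ j y j<1+c with cases j j<1+c
    ... | inj₁ eq         = ≡.subst (λ x → relax D z y ≤ q x y) (≡.sym eq) (relax≤ʳ D z y)
    ... | inj₂ (j<c , eq) = ≡.subst (λ x → relax D z y ≤ q x y) (≡.sym eq) (≤-trans (relax≤ˡ D z y) (lower j y j<c))
    attained′ : ∀ y → ∃ λ j → j ℕ.< suc c × q ((s [ c ≔ z ]) j) y ≤ relax D z y
    attained′ y = pick (≤-total (D y) (q z y)) (attained y)
      where
      pick : D y ≤ q z y ⊎ q z y ≤ D y → (∃ λ j → j ℕ.< c × q (s j) y ≤ D y) → ∃ λ j → j ℕ.< suc c × q
          ((s [ c ≔ z ]) j) y ≤ relax D z y
      pick (inj₁ D≤q) (j , j<c , q≤D) = j , ℕ.m<n⇒m<1+n j<c ,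
          ≡.subst (λ x → q x y ≤ relax D z y) (≡.sym (≔-other s c j λ eq → ℕ.<⇒≢ j<c (≡.sym eq)))
              (⊓-glb q≤D (≤-trans q≤D D≤q))
      pick (inj₂ q≤D) _ = c , ℕ.n<1+n c , ≡.subst (λ x → q x y ≤ relax D z y) (≡.sym (≔-same s c)) (⊓-glb q≤D ≤-refl)

  cover-centres : ∀ {t D} → CoverTrace t D → Centres D (suc t)
  cover-centres start = initial-centre
  cover-centres (step tr _ z-min) = add-centre (cover-centres tr) (proj₁ z-min)

  greedy-centres : ∀ {D₀ c i D} → Centres D₀ c → GreedyTrace D₀ i D → Centres D (i ℕ.+ c)
  greedy-centres C start = C
  greedy-centres C (step tr z-min) = add-centre (greedy-centres C tr) (proj₁ z-min)

  record Entry : Set where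
    constructor entry
    field
      point-x point-z : ℕ
      distances       : ℕ → Carrier

  open Entry

  Valid : Entry → Set
  Valid (entry x z D) = Minimal (isolation-cost D) x × Minimal (median-cost D x) z × (∀ y → 0# ≤ D y)

  Precedes : Entry → (ℕ → Carrier) → Set
  Precedes (entry x z D) D′ = ∀ y → D′ y ≤ D y × D′ y ≤ q z y

  -- Random access to a trace: the charging argument compares arbitrary pairs of steps, which the
  -- inductive form does not expose.
  record History (T : ℕ) (D : ℕ → Carrier) : Set where
    field
      h      : ℕ → Entry
      valid  : ∀ t → t ℕ.< T → Valid (h t)
      order  : ∀ s t → s ℕ.< t → t ℕ.< T → Precedes (h s) (distances (h t))
      recent : ∀ t → t ℕ.< T → Precedes (h t) D

  history : ∀ {T D} → CoverTrace T D → History T D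
  history start = record { h = λ _ → entry 0 0 (q 0) ; valid = λ _ () ; order = λ _ _ _ () ; recent = λ _ () }
  history (step {T} {D} {x} {z} tr x-min z-min) = record { h = h′ ; valid = valid′ ; order = order′ ; recent = recent′ }
    where
    open History (history tr)
    e = entry x z D
    h′ = h [ T ≔ e ]
    cases : ∀ t → t ℕ.< suc T → h′ t ≡ e ⊎ (t ℕ.< T × h′ t ≡ h t)
    cases t t<1+T with t ℕ.≟ T
    ... | yes ≡.refl = inj₁ (≔-same h T)
    ... | no t≢T     = inj₂ (ℕ.≤∧≢⇒< (ℕ.≤-pred t<1+T) t≢T , ≔-other h T t λ eq → t≢T (≡.sym eq))
    valid′ : ∀ t → t ℕ.< suc T → Valid (h′ t)
    valid′ t t<1+T with cases t t<1+T
    ... | inj₁ eq         = ≡.subst Valid (≡.sym eq) (x-min , z-min , Centres.0≤D (cover-centres tr))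
    ... | inj₂ (t<T , eq) = ≡.subst Valid (≡.sym eq) (valid t t<T)
    order′ : ∀ s t → s ℕ.< t → t ℕ.< suc T → Precedes (h′ s) (distances (h′ t))
    order′ s t s<t t<1+T with cases s (ℕ.<-trans s<t t<1+T) | cases t t<1+T
    ... | inj₂ (s<T , eq) | inj₁ eq′         = ≡.subst₂ (λ e e′ → Precedes e (distances e′)) (≡.sym eq) (≡.sym eq′)
        (recent s s<T)
    ... | inj₂ (s<T , eq) | inj₂ (t<T , eq′) = ≡.subst₂ (λ e e′ → Precedes e (distances e′)) (≡.sym eq) (≡.sym eq′)
        (order s t s<t t<T)
    ... | inj₁ eq         | _ with s ℕ.<? T
    ...   | yes s<T = ≡.subst (λ e → Precedes e (distances (h′ t)))
        (≡.sym (≔-other h T s λ T≡s → ℕ.<⇒≢ s<T (≡.sym T≡s))) (last t s<t t<1+T s<T)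
      where
      last : ∀ t → s ℕ.< t → t ℕ.< suc T → s ℕ.< T → Precedes (h s) (distances (h′ t))
      last t s<t t<1+T s<T with cases t t<1+T
      ... | inj₁ eq′         = ≡.subst (λ e′ → Precedes (h s) (distances e′)) (≡.sym eq′) (recent s s<T)
      ... | inj₂ (t<T , eq′) = ≡.subst (λ e′ → Precedes (h s) (distances e′)) (≡.sym eq′) (order s t s<t t<T)
    ...   | no s≮T = contradiction (ℕ.<-≤-trans s<t (ℕ.≤-pred t<1+T)) s≮T
    recent′ : ∀ t → t ℕ.< suc T → Precedes (h′ t) (relax D z)
    recent′ t t<1+T with cases t t<1+T
    ... | inj₁ eq = ≡.subst (λ e → Precedes e (relax D z)) (≡.sym eq) λ y → relax≤ˡ D z y , relax≤ʳ D z y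
    ... | inj₂ (t<T , eq) = ≡.subst (λ e → Precedes e (relax D z)) (≡.sym eq) λ y →
            ≤-trans (relax≤ˡ D z y) (proj₁ (recent t t<T y)) , ≤-trans (relax≤ˡ D z y) (proj₂ (recent t t<T y))

  minimal-exists : ∀ (f : ℕ → Carrier) → ∃ (Minimal f)
  minimal-exists f = go n (ℕ.>-nonZero⁻¹ n)
    where
    go : ∀ m → 0 ℕ.< m → ∃ λ x → x ℕ.< m × ∀ y → y ℕ.< m → f x ≤ f y
    go (suc zero) _ = 0 , s≤s z≤n , λ { zero _ → ≤-refl ; (suc y) (s≤s ()) }
    go (suc (suc m)) _ with go (suc m) (s≤s z≤n)
    ... | x , x<m , min with ≤-total (f x) (f (suc m))
    ...   | inj₁ fx≤ = x , ℕ.m<n⇒m<1+n x<m , bound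
      where
      bound : ∀ y → y ℕ.< suc (suc m) → f x ≤ f y
      bound y y< with y ℕ.≟ suc m
      ... | yes ≡.refl = fx≤
      ... | no y≢      = min y (ℕ.≤∧≢⇒< (ℕ.≤-pred y<) y≢)
    ...   | inj₂ ≤fx = suc m , ℕ.n<1+n _ , bound
      where
      bound : ∀ y → y ℕ.< suc (suc m) → f (suc m) ≤ f y
      bound y y< with y ℕ.≟ suc m
      ... | yes ≡.refl = ≤-refl
      ... | no y≢      = ≤-trans ≤fx (min y (ℕ.≤∧≢⇒< (ℕ.≤-pred y<) y≢))

  K≰0 : ¬ num K ≤ 0#
  K≰0 = num≰0 K

  radius : Carrier → Carrier
  radius D = num K ⁻¹ * D

  K*radius : ∀ D → num K * radius D ≈ D
  K*radius D = trans (sym (*-assoc _ _ _)) (trans (*-congʳ (*-inverseʳ (≰0⇒≉0 K≰0))) (*-identityˡ D))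

  0≤radius : ∀ {D} → 0# ≤ D → 0# ≤ radius D
  0≤radius 0≤D = *-nonNeg (≰⇒≥ (⁻¹≰0 K≰0)) 0≤D

  radius-mono : ∀ {D D′} → D ≤ D′ → radius D ≤ radius D′
  radius-mono = *-monoˡ-≤ (≰⇒≥ (⁻¹≰0 K≰0))

  value : (ℕ → Carrier) → ℕ → Carrier
  value D x = ∑ n λ y → pos (radius (D x) - q x y)

  isolation≈ : ∀ D x → isolation-cost D x ≈ - (num K * value D x)
  isolation≈ D x = trans (∑-cong n λ y _ → termwise y) (trans (∑-neg n _) (-‿cong (∑-*ˡ n (num K) _)))
    where
    termwise : ∀ y → (num K * q x y ⊓ D x) - D x ≈ - (num K * pos (radius (D x) - q x y))
    termwise y = cases (≤-total (num K * q x y) (D x))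
      where
      cases : num K * q x y ≤ D x ⊎ D x ≤ num K * q x y → (num K * q x y ⊓ D x) - D x ≈ -
          (num K * pos (radius (D x) - q x y))
      cases (inj₁ Kq≤D) = trans (+-congʳ (x≤y⇒x⊓y≈x Kq≤D)) (trans (+-congˡ (-‿cong (sym (K*radius (D x)))))
          (trans (solve 3 (λ K q r → K :* q :- K :* r := :- (K :* (r :- q))) refl (num K) (q x y) (radius (D x)))
            (-‿cong (*-congˡ (sym (⊔-left (sub-nonneg (*-cancelˡ-≤ K≰0 (≤-resp refl (sym (K*radius (D x))) Kq≤D)))))))))
      cases (inj₂ D≤Kq) = trans (+-congʳ (x≤y⇒y⊓x≈x D≤Kq))
          (trans (-‿inverseʳ (D x)) (trans (solve 1 (λ K → # 0 := :- (K :* # 0)) refl (num K))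
            (-‿cong (*-congˡ (sym (⊔-right (by (*-cancelˡ-≤ K≰0 (≤-resp (sym (K*radius (D x))) refl D≤Kq))
              (solve 2 (λ r q → (r :- q) :+ q := # 0 :+ r) refl (radius (D x)) (q x y)))))))))

  value-maximal : ∀ {D x} → Minimal (isolation-cost D) x → ∀ y → y ℕ.< n → value D y ≤ value D x
  value-maximal {D} {x} (_ , min) y y<n = *-cancelˡ-≤ K≰0 (by (≤-resp (isolation≈ D x) (isolation≈ D y) (min y y<n))
    (solve 2 (λ a b → a :+ (:- a) := b :+ (:- b)) refl (num K * value D y) (num K * value D x)))

  pos-mono : ∀ {u v} → u ≤ v → pos u ≤ pos v
  pos-mono {u} {v} u≤v = ⊔-lub (≤-trans u≤v (x≤x⊔y v 0#)) (0≤pos v)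

  value-mono : ∀ {D D′} x → D x ≤ D′ x → value D x ≤ value D′ x
  value-mono {D} {D′} x D≤D′ = ∑-mono n λ y _ → pos-mono (+-monoˡ-≤ (- q x y) (radius-mono D≤D′))

  ball⇒ : ∀ {D x y} → InBall D x y → q x y ≤ num 256 * radius (D x)
  ball⇒ {D} {x} {y} in-ball = *-cancelˡ-≤ K≰0 (≤-resp refl (trans (*-congˡ (sym (K*radius (D x))))
    (solve 3 (λ c K r → c :* (K :* r) := K :* (c :* r)) refl (num 256) (num K) (radius (D x)))) in-ball)

  ball⇐ : ∀ {D x y} → q x y ≤ num 256 * radius (D x) → InBall D x y
  ball⇐ {D} {x} {y} q≤ = ≤-resp refl (trans (solve 3 (λ c K r → K :* (c :* r) := c :* (K :* r)) refl (num 256)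
      (num K) (radius (D x)))
    (*-congˡ (K*radius (D x)))) (*-monoˡ-≤ (≰⇒≥ K≰0) q≤)

  -- Averaging `q x z ≤ 2 (q x y + q z y)` over the points near `x`: the median does no worse than
  -- `x`, and `x` costs at most 256 radii per point, so the factor is `4 · 256`.
  median-near : ∀ {D x z} → (∀ y → 0# ≤ D y) → x ℕ.< n → Minimal (median-cost D x) z → q x z ≤ num 1024 * radius (D x)
  median-near {D} {x} {z} 0≤D x<n (_ , min) = *-cancelˡ-≤ W≰0
      (≤-trans W*q≤ (by (+-mono-≤ (*-monoˡ-≤ (0≤num 2) (min x x<n)) (*-monoˡ-≤ (0≤num 4) own≤))
      (solve 4 (λ a b W r → # 2 :* (a :+ b) :+ (# 2 :* a :+ # 4 :* (W :* (# 256 :* r))) := W :* (# 1024 :* r) :+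
          (# 2 :* b :+ # 4 :* a)) refl
        (median-cost D x x) (median-cost D x z) W (radius (D x)))))
    where
    W = ∑ n λ y → χ (InBall D x y)
    self : InBall D x x
    self = ball⇐ {D} (≤-resp (sym (q-refl x)) refl (*-nonNeg (0≤num 256) (0≤radius (0≤D x))))
    W≰0 : ¬ W ≤ 0#
    W≰0 W≤0 = 1≰0 (≤-trans (≤-resp (χ-yes self) refl (term≤∑ n (λ y _ → 0≤χ _) x<n)) W≤0)
    W*q≤ : W * q x z ≤ num 2 * (median-cost D x x + median-cost D x z)
    W*q≤ = ≤-resp (trans (∑-cong n λ y _ → *-comm _ _) (trans (∑-*ˡ n (q x z) _) (*-comm _ _)))
      (trans (∑-*ˡ n (num 2) _) (*-congˡ (∑-+ n _ _)))
      (∑-mono n λ y _ → ≤-trans (*-monoˡ-≤ (0≤χ (InBall D x y))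
          (≤-trans (q-tri x y z) (≤-reflexive (*-congˡ (+-congˡ (q-sym y z))))))
        (≤-reflexive (solve 3 (λ w a b → w :* (# 2 :* (a :+ b)) := # 2 :* (w :* a :+ w :* b)) refl
            (χ (InBall D x y)) (q x y) (q z y))))
    own≤ : median-cost D x x ≤ W * (num 256 * radius (D x))
    own≤ = ≤-resp refl (trans (∑-cong n λ y _ → *-comm _ _) (trans (∑-*ˡ n _ _) (*-comm _ _)))
        (∑-mono n λ y _ → inside y)
      where
      inside : ∀ y → χ (InBall D x y) * q x y ≤ χ (InBall D x y) * (num 256 * radius (D x))
      inside y with em {InBall D x y}
      ... | yes in-ball = *-monoˡ-≤ 0≤1 (ball⇒ {D} in-ball)
      ... | no  _       = ≤-reflexive (trans (zeroˡ _) (sym (zeroˡ _)))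

  module Compare (κ : ℕ) (κ≤k : κ ℕ.≤ k) (c : ℕ → Point d) (a : ℕ → ℕ) (a<κ : ∀ y → y ℕ.< n → a y ℕ.< κ) where

    open Assignment n κ P c a a<κ

    optimum : Carrier
    optimum = ∑ n payment

    0≤optimum : 0# ≤ optimum
    0≤optimum = ∑-nonneg n λ y _ → 0≤dist (P y) (c (a y))

    χ-⇔ : ∀ {P Q : Set} → (P → Q) → (Q → P) → χ P ≈ χ Q
    χ-⇔ {P} {Q} f g with em {P} | em {Q}
    ... | yes _ | yes _ = refl
    ... | no  _ | no  _ = refl
    ... | yes p | no ¬q = contradiction (f p) ¬q
    ... | no ¬p | yes q = contradiction (g q) ¬p

    belongs-term≤ : ∀ j y {u v} → u ≤ v → 0# ≤ v → belongs j y * u ≤ v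
    belongs-term≤ j y u≤v 0≤v with em {a y ≡ j}
    ... | yes _ = ≤-trans (≤-reflexive (*-identityˡ _)) u≤v
    ... | no  _ = ≤-trans (≤-reflexive (zeroˡ _)) 0≤v

    cover-bound : ∀ {D} → CoverTrace 4k D → ∑ n D ≤ num 3 * num K * optimum
    cover-bound {D} tr with em {value D (proj₁ (minimal-exists (isolation-cost D))) ≤ 0#}
    -- The point `x` alone contributes its whole radius to the value at `x`; if no value is
    -- positive, every `D x` vanishes.
    ... | yes U≤0 = ≤-trans (≤-trans (∑-mono n {g = λ _ → 0#} λ x x<n → D≤0 x x<n) (≤-reflexive (∑-0 n)))
            (*-nonNeg (*-nonNeg (0≤num 3) (0≤num K)) 0≤optimum)
      where
      D≤0 : ∀ x → x ℕ.< n → D x ≤ 0#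
      D≤0 x x<n = ≤-resp (K*radius (D x)) (zeroʳ _) (*-monoˡ-≤ (0≤num K) (≤-trans (≤-trans
        (≤-resp (trans (+-congˡ (-‿cong (q-refl x))) (solve 1 (λ r → r :- # 0 := r) refl _)) refl
            (x≤x⊔y (radius (D x) - q x x) 0#))
        (term≤∑ n (λ y _ → 0≤pos (radius (D x) - q x y)) x<n))
            (≤-trans (value-maximal (proj₂ (minimal-exists (isolation-cost D))) x x<n) U≤0)))
    ... | no U≰0 = ≤-resp (trans (sym (∑-*ˡ n (num K) _)) (∑-cong n λ x _ → K*radius (D x)))
        (solve 2 (λ K f → K :* (# 3 :* f) := # 3 :* K :* f) refl (num K) optimum)
            (*-monoˡ-≤ (0≤num K) radii≤)
      where
      open History (history tr)
      best = minimal-exists (isolation-cost D)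
      U = value D (proj₁ best)
      0≤U = ≰⇒≥ U≰0
      xs zs : ℕ → ℕ
      xs t = point-x (h t)
      zs t = point-z (h t)
      Ds : ℕ → ℕ → Carrier
      Ds t = distances (h t)
      ρ : ℕ → Carrier
      ρ t = radius (Ds t (xs t))
      history-run : Run dist
      history-run = record
        { 0≤q = 0≤dist ; q-refl = dist-refl ; q-sym = dist-sym ; q-tri = dist-tri
        ; n = n ; τ = 4k ; κ = κ ; pt = P ; x = λ t → P (xs t) ; z = λ t → P (zs t) ; c = c ; a = a ; a<κ = a<κ
        ; ρ = ρ ; U = U
        ; 0≤ρ = λ t t<T → 0≤radius (proj₂ (proj₂ (valid t t<T)) (xs t))
        -- `K ρ t` is the entry of `x t` in the array before step `t`, hence at most its distance to
        -- any centre opened earlier.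
        ; sep = λ s t s<t t<T → ≤-resp (sym (K*radius _)) (trans (q-sym (zs s) (xs t)) (q≈dist (xs t) (zs s)))
            (proj₂ (order s t s<t t<T (xs t)))
        ; near = λ t t<T → ≤-resp (q≈dist (xs t) (zs t)) refl
            (median-near (proj₂ (proj₂ (valid t t<T))) (proj₁ (proj₁ (valid t t<T))) (proj₁ (proj₂ (valid t t<T))))
        ; U≰0 = U≰0
        -- Values only fall as `D` decreases, so the ball found heaviest at step `t` was worth at
        -- least the heaviest one left at the end.
        ; value = λ t t<T → ≤-trans (value-mono {D} {Ds t} _ (proj₁ (recent t t<T _)))
            (≤-trans (value-maximal (proj₁ (valid t t<T)) _ (proj₁ (proj₂ best)))
            (≤-reflexive (∑-cong n λ y _ → pos-cong (+-congˡ (-‿cong (q≈dist (xs t) y))))))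
        ; median = λ t v t<T v<T → ≤-resp (ball-sum t (zs t)) (ball-sum t (xs v))
            (proj₂ (proj₁ (proj₂ (valid t t<T))) (xs v) (proj₁ (proj₁ (valid v v<T)))) }
        where
        pos-cong : ∀ {u v} → u ≈ v → pos u ≈ pos v
        pos-cong u≈v = ≤-antisym (pos-mono (≤-reflexive u≈v)) (pos-mono (≤-reflexive (sym u≈v)))
        ball-sum : ∀ t w → median-cost (Ds t) (xs t) w ≈ ∑ n λ y → χ (dist (P (xs t)) (P y) ≤ num 256 * ρ t) * dist
            (P w) (P y)
        ball-sum t w = ∑-cong n λ y _ → *-cong (χ-⇔ (λ in-ball → ≤-resp (q≈dist (xs t) y) refl (ball⇒ {Ds t} in-ball))
          (λ d≤ → ball⇐ {Ds t} (≤-resp (sym (q≈dist (xs t) y)) refl d≤))) (q≈dist w y)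
      kU≤ : num k * U ≤ optimum
      kU≤ = *-cancelˡ-≤ (num≰0 2) (by (+-mono-≤ (packing-bound history-run)
          (*-monoˡ-≤ (0≤num 2) (*-monoʳ-≤ 0≤U (num-mono κ≤k))))
        (trans (solve 4 (λ k κ U f → # 2 :* (k :* U) :+ (# 2 :* (κ :* U :+ f) :+ # 2 :* (k :* U)) :=
            # 2 :* f :+ ((k :+ k :+ (k :+ k)) :* U :+ # 2 :* (κ :* U))) refl (num k) (num κ) U optimum)
          (+-congˡ (+-congʳ (*-congʳ (sym (trans (num-+ (k ℕ.+ k) (k ℕ.+ k)) (+-cong (num-+ k k) (num-+ k k)))))))))
      -- For `x` in a cluster, the sum of radius minus distance over that cluster is at most the
      -- value at `x`, hence at most `U`.
      radii≤ : ∑ n (λ x → radius (D x)) ≤ num 3 * optimum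
      radii≤ = ≤-trans (clustering-bound (λ x _ → radius (D x)) (λ x → radius (D x)) U 0≤U
          (λ j → weighted-left n (belongs j) (λ x → radius (D x)))
          (λ j x x<n → ≤-trans (∑-mono n λ y _ → belongs-term≤ j y
              (≤-trans (≤-reflexive (+-congˡ (-‿cong (sym (q≈dist x y))))) (x≤x⊔y (radius (D x) - q x y) 0#))
              (0≤pos (radius (D x) - q x y)))
            (value-maximal (proj₂ best) x x<n)))
        (by (+-mono-≤ (*-monoʳ-≤ 0≤U (num-mono κ≤k)) kU≤)
            (solve 3 (λ a b f → (a :+ # 2 :* f) :+ (b :+ f) := # 3 :* f :+ (a :+ b)) refl (num κ * U) (num k * U)
            optimum))

    -- Opening a member `x` of a cluster lowers the cost by at least the sum of `D y - q x y` over
    -- that cluster, and the greedy choice lowers it at least as much. This is the hypothesis of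
    -- `clustering-bound`.
    greedy-step : ∀ {D z} → (∀ y → 0# ≤ D y) → Minimal (greedy-cost D) z → ∑ n D ≤ num k *
        (∑ n D - ∑ n (relax D z)) + num 2 * optimum
    greedy-step {D} {z} 0≤D (_ , min) = ≤-trans (clustering-bound (λ _ y → D y) D Γ 0≤Γ
        (λ j → weighted-right n (belongs j) D) bound)
        (+-mono-≤ (*-monoʳ-≤ 0≤Γ (num-mono κ≤k)) ≤-refl)
      where
      Γ = ∑ n D - ∑ n (relax D z)
      0≤Γ : 0# ≤ Γ
      0≤Γ = sub-nonneg (∑-mono n λ y _ → relax≤ˡ D z y)
      bound : ∀ j x → x ℕ.< n → ∑ n (λ y → belongs j y * (D y - dist (P x) (P y))) ≤ Γ
      bound j x x<n = ≤-trans (∑-mono n {g = λ y → D y - (q x y ⊓ D y)} λ y _ → belongs-term≤ j y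
            (≤-trans (≤-reflexive (+-congˡ (-‿cong (sym (q≈dist x y)))))
                (by (x⊓y≤x (q x y) (D y)) (solve 3 (λ D q m → (D :- q) :+ q := (D :- m) :+ m) refl (D y) (q x y)
                (q x y ⊓ D y))))
            (sub-nonneg (x⊓y≤y (q x y) (D y))))
        (≤-trans (≤-reflexive (∑-sub n _ _)) (by (min x x<n)
            (trans (solve 3 (λ F a b → (F :- a) :+ a := (F :- b) :+ b) refl (∑ n D) (greedy-cost D x) (∑ n (relax D z)))
          (+-congˡ (∑-cong n λ y _ → ⊓-comm (D y) (q z y))))))

    greedy-bound : ∀ {D₀ c₀ i D r} → Centres D₀ c₀ → 0# ≤ r → num k * (1# - r) ≈ 1# → GreedyTrace D₀ i D →
                   ∑ n D - num 2 * optimum ≤ r ^ i * (∑ n D₀ - num 2 * optimum)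
    greedy-bound C 0≤r kr start = ≤-reflexive (sym (*-identityˡ _))
    greedy-bound {D₀} {r = r} C 0≤r kr (step {t} {D} {z} tr z-min) = ≤-trans contract
        (≤-resp refl (sym (*-assoc r (r ^ t) _)) (*-monoˡ-≤ 0≤r (greedy-bound C 0≤r kr tr)))
      where
      F = ∑ n D
      F′ = ∑ n (relax D z)
      0≤1-r : 0# ≤ 1# - r
      0≤1-r = *-cancelˡ-≤ (num≰0 k) (≤-resp (sym (zeroʳ _)) (sym kr) 0≤1)
      contract : F′ - num 2 * optimum ≤ r * (F - num 2 * optimum)
      contract = by (*-monoˡ-≤ 0≤1-r (greedy-step (Centres.0≤D (greedy-centres C tr)) z-min))
        (trans (+-congˡ (trans (solve 5 (λ r k F F′ f → (# 1 :- r) :* (k :* (F :- F′) :+ # 2 :* f) :=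
            (k :* (# 1 :- r)) :* (F :- F′) :+ (# 1 :- r) :* (# 2 :* f)) refl r (num k) F F′ optimum)
            (+-congʳ (trans (*-congʳ kr) (*-identityˡ _)))))
          (solve 4 (λ r F F′ f → (F′ :- # 2 :* f) :+ ((F :- F′) :+ (# 1 :- r) :* (# 2 :* f)) := r :*
              (F :- # 2 :* f) :+ (# 1 :- r) :* F) refl r F F′ optimum))

    -- The first phase contributes a factor `3 K`. The test uses the slightly larger `4 K`, a power
    -- of 2, which the exponential estimate can absorb.
    approximation : ∀ {D₀ i D r} → CoverTrace 4k D₀ → 0# ≤ r → num k * (1# - r) ≈ 1# → GreedyTrace D₀ i D →
                    num 4 * num K * r ^ i ≤ ε → ∑ n D ≤ (1# + 1# + ε) * optimum
    approximation {D₀} {i} {D} {r} cover 0≤r kr greedy e≤ε =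
      by (+-mono-≤ (greedy-bound (cover-centres cover) 0≤r kr greedy) (+-mono-≤ (*-monoˡ-≤ 0≤p (cover-bound cover))
          (+-mono-≤ (*-monoʳ-≤ 0≤optimum e≤ε) (*-nonNeg (*-nonNeg (+-nonneg (0≤num K) (0≤num 2)) 0≤p) 0≤optimum))))
        (solve 6 (λ F F₀ f p K e → F :+ (p :* (F₀ :- # 2 :* f) :+
            (p :* (# 3 :* K :* f) :+ (e :* f :+ (K :+ # 2) :* p :* f))) :=
            (# 1 :+ # 1 :+ e) :* f :+ ((F :- # 2 :* f) :+ (p :* F₀ :+ (# 4 :* K :* p :* f :+ # 0))) ) refl
          (∑ n D) (∑ n D₀) optimum (r ^ i) (num K) ε)
      where
      0≤p : 0# ≤ r ^ i
      0≤p = power i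
        where
        power : ∀ i → 0# ≤ r ^ i
        power zero    = 0≤1
        power (suc i) = *-nonNeg 0≤r (power i)
      +-nonneg : ∀ {u v} → 0# ≤ u → 0# ≤ v → 0# ≤ u + v
      +-nonneg 0≤u 0≤v = ≤-resp (+-identityʳ 0#) refl (+-mono-≤ 0≤u 0≤v)

-- Running time of the whole program

module TotalCost (em : ExcludedMiddle 0ℓ) (ℝ : Reals) (n d k : ℕ) .{{_ : NonZero n}} .{{_ : NonZero d}}
    .{{_ : NonZero k}}
                 (pt : ℕ → ℕ → KMeans.Carrier em ℝ) (ε : KMeans.Carrier em ℝ) where

  open KMeans em ℝ
  open OrderedField em ℝ
  open Algorithm em ℝ
  open Loops em ℝ n d k pt ε
  open Phases em ℝ n d k pt ε
  open Execution em ℝ n d k pt ε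

  w : ℕ
  w = n ℕ.* nd

  Result : ℕ → Mem → Set
  Result J m′ = ∃ λ D₀ → ∃ λ D → ∃ λ i → ∃ λ r → CoverTrace 4k D₀ × GreedyTrace D₀ i D × i ℕ.≤ J ×
    num k * (1# - r) ≈ 1# × num 4 * num K * r ^ i ≤ ε × Outputs-points m′ D

  -- `1122 = 988 + 134`: the `4 k` steps of the first phase at 247 each, and lower-order terms. A
  -- greedy step costs 247 plus 3 for the multiplication, the test and the jump.
  program-spec : ∀ {m} J → Start m →
    (∀ r i → num k * (1# - r) ≈ 1# → ¬ num 4 * num K * r ^ i ≤ ε → i ℕ.< J) →
    Spec program m (1122 ℕ.* (w ℕ.* k) ℕ.+ J ℕ.* (250 ℕ.* w)) (Result J)
  program-spec J s J-bound = spec-weaken bound (λ _ p → p)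
      (spec-seq (setup-spec s) λ m₁ ready →
       spec-seq (constants-spec ready) λ m₂ base₂ →
       spec-seq (initialise-spec base₂) λ m₃ (base₃ , D≈₃) →
       spec-seq (coverPhase-spec base₃ D≈₃) λ m₄ (base₄ , D₀ , cover , D≈₄) →
       spec-seq (greedyPhase-spec J base₄ D≈₄ (λ i → J-bound (real m₄ 5) i (Base.k⁻¹ base₄))) λ m₅
           (base₅ , i , i≤J , e≤ε , D , greedy , D≈₅) →
       spec-weaken ℕ.≤-refl (λ m₆ out → D₀ , D , i , real m₄ 5 , cover , greedy , i≤J , Base.k⁻¹ base₄ , e≤ε , out)
           (output-spec base₅ D≈₅))
    where
    open ℕ-Solver using () renaming (_:+_ to _:+′_; _:*_ to _:*′_; _:=_ to _:=′_; con to con′)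
    y = w ℕ.* k
    instance
      w≢0 : NonZero w
      w≢0 = ℕ.m*n≢0 n nd
      y≢0 : NonZero y
      y≢0 = ℕ.m*n≢0 w k
    w≤y : w ℕ.≤ y
    w≤y = ℕ.m≤m*n w k
    bound : setup-bound ℕ.+ (12 ℕ.+ (k ℕ.* 4 ℕ.+ 1 ℕ.+ 2) ℕ.+
        (25 ℕ.* nd ℕ.+ (1 ℕ.+ (4k ℕ.* (247 ℕ.* w ℕ.+ 1 ℕ.+ 2) ℕ.+ 1) ℕ.+
              (2 ℕ.+ (J ℕ.* (247 ℕ.* w ℕ.+ 1 ℕ.+ 2) ℕ.+ 1) ℕ.+ output-bound)))) ℕ.≤ 1122 ℕ.* y ℕ.+ J ℕ.* (250 ℕ.* w)
    bound = ℕ.≤-trans (ℕ.≤-reflexive (ℕ-Solver.solve 4 (λ n d k J →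
          con′ 4 :+′ (n :*′ con′ 4 :+′ con′ 1 :+′ (con′ 8 :+′
              (n :*′ d :*′ con′ 7 :+′ con′ 1 :+′ (con′ 2 :+′ (n :*′ con′ 6 :+′ con′ 1))))) :+′
          (con′ 12 :+′ (k :*′ con′ 4 :+′ con′ 1 :+′ con′ 2) :+′ (con′ 25 :*′ (n :*′ d) :+′
            (con′ 1 :+′ ((k :+′ k :+′ (k :+′ k)) :*′ (con′ 247 :*′ (n :*′ (n :*′ d)) :+′ con′ 1 :+′ con′ 2) :+′
                con′ 1) :+′
              (con′ 2 :+′ (J :*′ (con′ 247 :*′ (n :*′ (n :*′ d)) :+′ con′ 1 :+′ con′ 2) :+′ con′ 1) :+′
                (con′ 3 :+′ (n :*′ (con′ 21 :*′ d :+′ con′ 2) :+′ con′ 1 :+′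
                    (con′ 4 :+′ (n :*′ d :*′ con′ 7 :+′ con′ 1))))))))
          :=′ con′ 46 :*′ con′ 1 :+′ con′ 12 :*′ n :+′ con′ 60 :*′ (n :*′ d) :+′ con′ 16 :*′ k :+′ con′ 988 :*′
              (n :*′ (n :*′ d) :*′ k) :+′ J :*′ (con′ 247 :*′ (n :*′ (n :*′ d)) :+′ con′ 3 :*′ con′ 1))
          ≡.refl n d k J))
      (ℕ.≤-trans (ℕ.+-mono-≤ (ℕ.+-mono-≤ (ℕ.+-mono-≤
          (ℕ.+-mono-≤ (ℕ.+-mono-≤ (ℕ.*-monoʳ-≤ 46 (ℕ.>-nonZero⁻¹ y)) (ℕ.*-monoʳ-≤ 12 (ℕ.≤-trans (ℕ.m≤m*n n nd) w≤y)))
            (ℕ.*-monoʳ-≤ 60 (ℕ.≤-trans (ℕ.m≤n*m nd n) w≤y))) (ℕ.*-monoʳ-≤ 16 (ℕ.m≤n*m k w))) (ℕ.≤-refl {988 ℕ.* y}))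
            (ℕ.*-monoʳ-≤ J (ℕ.+-monoʳ-≤ (247 ℕ.* w) (ℕ.*-monoʳ-≤ 3 (ℕ.>-nonZero⁻¹ w)))))
        (ℕ.≤-reflexive (ℕ-Solver.solve 3 (λ y J w → con′ 46 :*′ y :+′ con′ 12 :*′ y :+′ con′ 60 :*′ y :+′ con′ 16
            :*′ y :+′ con′ 988 :*′ y :+′ J :*′ (con′ 247 :*′ w :+′ con′ 3 :*′ w)
          :=′ con′ 1122 :*′ y :+′ J :*′ (con′ 250 :*′ w)) ≡.refl y J w)))

-- The output set and the final constants

module Main (em : ExcludedMiddle 0ℓ) (ℝ : Reals) where

  open KMeans em ℝ
  open OrderedField em ℝ
  open Exponential em ℝ using (iterations-bound; num-^)
  open Clusters em ℝ hiding (W)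
  open Algorithm em ℝ
  open Solver using (solve; _:=_; _:+_; _:*_; _:-_; :-_)

  ceiling : ∀ B → 0# ≤ B → ∃ λ J → num J ≤ B + 1# × (∀ i → num i ≤ B → i ℕ.< J)
  ceiling B 0≤B = finish (search (suc (proj₁ arch)) large)
    where
    arch = archimedean B
    large : ¬ num (suc (proj₁ arch)) ≤ B
    large le = 1≰0 (by (+-mono-≤ le (proj₂ arch))
        (trans (solve 2 (λ B a → # 1 :+ (B :+ a) := # 0 :+ ((# 1 :+ a) :+ B)) refl B (num (proj₁ arch)))
      (+-congˡ (+-congʳ (sym (num-suc (proj₁ arch)))))))
    search : ∀ J → ¬ num J ≤ B → ∃ λ J → num J ≤ B + 1# × ¬ num J ≤ B
    search zero J≰B = 0 , contradiction (≤-trans (≤-reflexive num-0) 0≤B) J≰B , J≰B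
    search (suc J) J≰B with em {num J ≤ B}
    ... | yes J≤B = suc J , ≤-trans (≤-reflexive (trans (num-suc J) (+-comm _ _))) (+-monoˡ-≤ 1# J≤B) , J≰B
    ... | no  J≰B = search J J≰B
    finish : (∃ λ J → num J ≤ B + 1# × ¬ num J ≤ B) → ∃ λ J → num J ≤ B + 1# × (∀ i → num i ≤ B → i ℕ.< J)
    finish (J , J≤ , J≰B) = J , J≤ , λ i i≤B → ℕ.≰⇒> λ J≤i → J≰B (≤-trans (num-mono J≤i) i≤B)

  foldr-⊓≤ : ∀ {m} e (v : Vector Carrier m) → Vector.foldr _⊓_ e v ≤ e × (∀ j → Vector.foldr _⊓_ e v ≤ v j)
  foldr-⊓≤ {zero}  e v = ≤-refl , λ ()
  foldr-⊓≤ {suc m} e v with foldr-⊓≤ e (v ∘ Fin.suc)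
  ... | ≤e , ≤v = ≤-trans (x⊓y≤y (v Fin.zero) _) ≤e , λ where
    Fin.zero    → x⊓y≤x (v Fin.zero) _
    (Fin.suc j) → ≤-trans (x⊓y≤y (v Fin.zero) _) (≤v j)

  minimum≤ : ∀ {m} .{{_ : NonZero m}} (v : Vector Carrier m) j → minimum v ≤ v j
  minimum≤ {suc m} v Fin.zero    = proj₁ (foldr-⊓≤ (v Fin.zero) (v ∘ Fin.suc))
  minimum≤ {suc m} v (Fin.suc j) = proj₂ (foldr-⊓≤ (v Fin.zero) (v ∘ Fin.suc)) j

  foldr-⊓-attained : ∀ {m} e (v : Vector Carrier m) → e ≤ Vector.foldr _⊓_ e v ⊎ ∃ λ j → v j ≤ Vector.foldr _⊓_ e v
  foldr-⊓-attained {zero}  e v = inj₁ ≤-refl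
  foldr-⊓-attained {suc m} e v = pick (≤-total (v Fin.zero) rest) (foldr-⊓-attained e (v ∘ Fin.suc))
    where
    rest = Vector.foldr _⊓_ e (v ∘ Fin.suc)
    pick : v Fin.zero ≤ rest ⊎ rest ≤ v Fin.zero → e ≤ rest ⊎ (∃ λ j → v (Fin.suc j) ≤ rest) →
           e ≤ v Fin.zero ⊓ rest ⊎ ∃ λ j → v j ≤ v Fin.zero ⊓ rest
    pick (inj₁ v≤) _              = inj₂ (Fin.zero , ⊓-glb ≤-refl v≤)
    pick (inj₂ ≤v) (inj₁ e≤)      = inj₁ (≤-trans e≤ (⊓-glb ≤v ≤-refl))
    pick (inj₂ ≤v) (inj₂ (j , p)) = inj₂ (Fin.suc j , ≤-trans p (⊓-glb ≤v ≤-refl))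

  minimum-attained : ∀ {m} .{{_ : NonZero m}} (v : Vector Carrier m) → ∃ λ j → v j ≤ minimum v
  minimum-attained {suc m} v with foldr-⊓-attained (v Fin.zero) (v ∘ Fin.suc)
  ... | inj₁ p       = Fin.zero , p
  ... | inj₂ (j , p) = Fin.suc j , p

  concat-combine : ∀ {d m} (p : Fin m → Point d) i l → Vector.concat p (Fin.combine i l) ≡ p i l
  concat-combine {d} p i l = ≡.cong (λ (i , l) → p i l) (Fin.remQuot-combine i l)

  toℕ-combine′ : ∀ {m d} (i : Fin m) (l : Fin d) → toℕ (Fin.combine i l) ≡ toℕ i ℕ.* d ℕ.+ toℕ l
  toℕ-combine′ {d = d} i l = ≡.trans (Fin.toℕ-combine i l) (≡.cong (ℕ._+ toℕ l) (ℕ.*-comm d (toℕ i)))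

  module _ {d : ℕ} (k : ℕ) (X : PointSet d) (ε : Carrier) where

    pt : ℕ → ℕ → Carrier
    pt y l = R (input X k ε) (suc (y ℕ.* d ℕ.+ l))

    input-cell : ∀ a (a<nd : a ℕ.< card X ℕ.* d) → R (input X k ε) (suc a) ≡ Vector.concat (point X) (Fin.fromℕ< a<nd)
    input-cell a a<nd with a ℕ.<? card X ℕ.* d
    ... | yes _   = ≡.refl
    ... | no a≮nd = contradiction a<nd a≮nd

    pt≡point : ∀ i l → pt (toℕ i) (toℕ l) ≡ point X i l
    pt≡point i l = ≡.trans (input-cell (toℕ i ℕ.* d ℕ.+ toℕ l) a<nd)
        (≡.trans (≡.cong (Vector.concat (point X)) (Fin.toℕ-injective
            (≡.trans (Fin.toℕ-fromℕ< a<nd) (≡.sym (toℕ-combine′ i l))))) (concat-combine (point X) i l))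
      where
      a<nd : toℕ i ℕ.* d ℕ.+ toℕ l ℕ.< card X ℕ.* d
      a<nd = ≡.subst (ℕ._< card X ℕ.* d) (toℕ-combine′ i l) (Fin.toℕ<n (Fin.combine i l))

  module Outcome {d} (k : ℕ) .{{_ : NonZero d}} .{{_ : NonZero k}} (X S* : PointSet d) (S*≤k : card S* ℕ.≤ k)
      (ε ℓ : Carrier)
                 (0<ε : 0# < ε) (log : IsLog (ε ⁻¹) ℓ) where

    n = card X
    instance
      n≢0 : NonZero n
      n≢0 = PointSet.nonZero X
    open Loops em ℝ n d k (pt k X ε) ε using (q; nd)
    open Phases em ℝ n d k (pt k X ε) ε using (4k)
    open Execution em ℝ n d k (pt k X ε) ε using (Start; Selected)
    open TotalCost em ℝ n d k (pt k X ε) ε using (w; Result; program-spec)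
    open TraceAnalysis em ℝ n d k (pt k X ε) ε

    m₀ : Mem
    m₀ = mem (N (input X k ε)) (R (input X k ε))

    starts : Start m₀
    starts = record { n≡ = ≡.refl ; d≡ = ≡.refl ; k≡ = ≡.refl ; rest≡ = λ
        { (suc (suc (suc a))) _ → ≡.refl ; (suc (suc zero)) (s≤s (s≤s ())) ; (suc zero) (s≤s ()) }
                    ; ε≡ = ≡.refl ; cells = λ _ _ _ _ → ≡.refl }

    ℓ⁺ = 1# ⊔ ℓ
    1≤ℓ⁺ : 1# ≤ ℓ⁺
    1≤ℓ⁺ = x≤x⊔y 1# ℓ
    0≤ℓ⁺ : 0# ≤ ℓ⁺
    0≤ℓ⁺ = ≤-trans 0≤1 1≤ℓ⁺
    Goal : Set
    Goal = ∃[ S ] ∃[ t ] ∃[ c ]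
      compile 0 program ⊢ input X k ε ⇓[ t ] c
      × Outputs c S
      × fromℕ t ≤ fromℕ (10122 ℕ.* (card X ℕ.^ 2 ℕ.* d ℕ.* k)) * (1# ⊔ ℓ)
      × fromℕ (card S) ≤ fromℕ (10122 ℕ.* k) + fromℕ k * (1# ⊔ ℓ)
      × cost X S ≤ (1# + 1# + ε) * cost X S*

    conclude : ∀ J → num J ≤ num k * (num 34 + ℓ⁺) + 1# → Spec program m₀
        (1122 ℕ.* (w ℕ.* k) ℕ.+ J ℕ.* (250 ℕ.* w)) (Result J) → Goal
    conclude J J≤ (m′ , t , run-t , t≤ , D₀ , D , i , r , cover , greedy , i≤J , kr , e≤ε , c , g , c≡ , selected ,
        written) =
        S , t , at (size program) m′ , halts run-t , outputs , time , few , near-optimal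
      where
      open Selected selected
      centres = greedy-centres (cover-centres cover) greedy
      open Centres centres

      index : ∀ {y} → .(y ℕ.< n) → Fin n
      index y<n = Fin.fromℕ< y<n

      P≈point : ∀ {y} (y<n : y ℕ.< n) l → P y l ≈ point X (index y<n) l
      P≈point {y} y<n l = reflexive (≡.trans (≡.cong (λ y → pt k X ε y (toℕ l)) (≡.sym (Fin.toℕ-fromℕ< y<n)))
          (pt≡point k X ε (index y<n) l))

      same-point : ∀ {x y} → x ℕ.< n → y ℕ.< n → q x y ≤ 0# → x ≡ y
      same-point {x} {y} x<n y<n q≤0 = ≡.trans (≡.sym (Fin.toℕ-fromℕ< x<n))
          (≡.trans (≡.cong toℕ (PointSet.distinct X {index x<n} {index y<n} λ l →
          trans (sym (P≈point x<n l)) (trans (dist≈0 (P x) (P y)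
              (≤-antisym (≤-resp (q≈dist x y) refl q≤0) (0≤dist (P x) (P y))) l) (P≈point y<n l))))
              (Fin.toℕ-fromℕ< y<n))

      chosen : ∀ j → j ℕ.< i ℕ.+ suc 4k → ∃ λ j′ → j′ ℕ.< c × g j′ ≡ s j
      chosen j j< = complete (s j) (s<n j j<) (≤-trans (lower j (s j) j<) (≤-reflexive (q-refl (s j))))

      instance
        c≢0 : NonZero c
        c≢0 = ℕ.>-nonZero (ℕ.≤-<-trans z≤n (proj₁ (proj₂ (chosen 0 (ℕ.≤-<-trans z≤n (ℕ.m<m+n i (s≤s z≤n)))))))

      S : PointSet d
      S = record { card = c ; point = λ j → point X (index (bounded (toℕ j) (Fin.toℕ<n j)))
                 ; distinct = λ {j} {j′} eq → Fin.toℕ-injective (injective (toℕ j) (toℕ j′) (Fin.toℕ<n j) (Fin.toℕ<n j′)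
                     (≡.trans (≡.sym (Fin.toℕ-fromℕ< (bounded (toℕ j) (Fin.toℕ<n j))))
                         (≡.trans (≡.cong toℕ (PointSet.distinct X eq))
                         (Fin.toℕ-fromℕ< (bounded (toℕ j′) (Fin.toℕ<n j′)))))) }

      outputs : Outputs (at (size program) m′) S
      outputs = c≡ , λ a → at-index a (Fin.remQuot d a) (Fin.combine-remQuot {c} d a)
        where
        at-index : ∀ a ((j , l) : Fin c × Fin d) → Fin.combine j l ≡ a → real m′ (toℕ a) ≈ Vector.concat (point S) a
        at-index a (j , l) ≡.refl = reflexive (≡.trans (≡.cong (real m′) (toℕ-combine′ j l))
            (written (toℕ j) (toℕ l) (Fin.toℕ<n j) (Fin.toℕ<n l)))
          ⟨ trans ⟩ (P≈point (bounded (toℕ j) (Fin.toℕ<n j)) l ⟨ trans ⟩ reflexive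
              (≡.sym (concat-combine (point S) j l)))

      -- A selected point is at distance 0 from some opened centre and thus equal to it, the points
      -- of `X` being distinct. So selected points inject into openings: point 0, `4 k` cover steps
      -- and `i` greedy steps.
      size-bound : c ℕ.≤ i ℕ.+ suc 4k
      size-bound = Fin.injective⇒≤ {f = λ j → Fin.fromℕ< (proj₁ (proj₂ (nearest j)))} λ {j} {j′} eq →
          Fin.toℕ-injective (injective (toℕ j) (toℕ j′) (Fin.toℕ<n j) (Fin.toℕ<n j′)
            (≡.trans (≡.sym (proj₂ (proj₂ (nearest j)))) (≡.trans
                (≡.cong s (≡.trans (≡.sym (Fin.toℕ-fromℕ< _)) (≡.trans (≡.cong toℕ eq) (Fin.toℕ-fromℕ< _))))
                (proj₂ (proj₂ (nearest j′))))))
        where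
        nearest : ∀ (j : Fin c) → ∃ λ j′ → j′ ℕ.< i ℕ.+ suc 4k × s j′ ≡ g (toℕ j)
        nearest j with attained (g (toℕ j))
        ... | j′ , j′< , q≤D = j′ , j′< , same-point (s<n j′ j′<) (bounded (toℕ j) (Fin.toℕ<n j))
            (≤-trans q≤D (vanishing (toℕ j) (Fin.toℕ<n j)))

      cost≤ : cost X S ≤ ∑ n D
      cost≤ = ≤-trans (≤-reflexive (sum≈∑ n _ nearest (λ y → reflexive (nearest-toℕ y))))
          (∑-mono n λ y y<n → bound y y<n)
        where
        distance : Fin n → Carrier
        distance y = minimum {{PointSet.nonZero S}} λ j → ‖ point X y -ᵥ point S j ‖²
        nearest : ℕ → Carrier
        nearest y with y ℕ.<? n
        ... | yes y<n = distance (index y<n)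
        ... | no  _   = 0#
        nearest-toℕ : ∀ y → distance y ≡ nearest (toℕ y)
        nearest-toℕ y with toℕ y ℕ.<? n
        ... | yes y<n = ≡.cong distance (≡.sym (Fin.fromℕ<-toℕ y y<n))
        ... | no y≮n  = contradiction (Fin.toℕ<n y) y≮n
        bound : ∀ y → y ℕ.< n → nearest y ≤ D y
        bound y y<n with y ℕ.<? n
        ... | no y≮n = contradiction y<n y≮n
        ... | yes y<n′ with attained y
        ...   | j , j< , q≤D with chosen j j<
        ...     | j′ , j′<c , gj′≡ = ≤-trans (minimum≤ {{PointSet.nonZero S}}
            (λ j → ‖ point X (index y<n) -ᵥ point S j ‖²) (Fin.fromℕ< j′<c))
                  (≤-trans (≤-reflexive (trans (dist-cong {a = point X (index y<n)} {a′ = P y}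
                      {b = point S (Fin.fromℕ< j′<c)} {b′ = P (s j)} (λ l → sym (P≈point y<n l)) (λ l → centre l))
                    (trans (sym (q≈dist y (s j))) (q-sym y (s j))))) q≤D)
          where
          centre : ∀ l → point S (Fin.fromℕ< j′<c) l ≈ P (s j) l
          centre l = trans (sym (P≈point (bounded (toℕ (Fin.fromℕ< j′<c)) (Fin.toℕ<n (Fin.fromℕ< j′<c))) l))
            (reflexive (≡.cong (λ x → P x l) (≡.trans (≡.cong g (Fin.toℕ-fromℕ< j′<c)) gj′≡)))

      closest : Fin n → Fin (card S*)
      closest y = proj₁ (minimum-attained {{PointSet.nonZero S*}} λ j → ‖ point X y -ᵥ point S* j ‖²)

      optimal-centre : ℕ → Point d
      optimal-centre j with j ℕ.<? card S*
      ... | yes j< = point S* (Fin.fromℕ< j<)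
      ... | no  _  = λ _ → 0#

      optimal-centre-toℕ : ∀ j → optimal-centre (toℕ j) ≡ point S* j
      optimal-centre-toℕ j with toℕ j ℕ.<? card S*
      ... | yes j< = ≡.cong (point S*) (Fin.fromℕ<-toℕ j j<)
      ... | no j≮  = contradiction (Fin.toℕ<n j) j≮

      assigned : ℕ → ℕ
      assigned y with y ℕ.<? n
      ... | yes y<n = toℕ (closest (index y<n))
      ... | no  _   = 0

      assigned< : ∀ y → y ℕ.< n → assigned y ℕ.< card S*
      assigned< y y<n with y ℕ.<? n
      ... | yes y<n′ = Fin.toℕ<n (closest (index y<n′))
      ... | no y≮n   = contradiction y<n y≮n

      assigned-toℕ : ∀ y → assigned (toℕ y) ≡ toℕ (closest y)
      assigned-toℕ y with toℕ y ℕ.<? n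
      ... | yes y<n = ≡.cong (toℕ ∘ closest) (Fin.fromℕ<-toℕ y y<n)
      ... | no y≮n  = contradiction (Fin.toℕ<n y) y≮n

      -- For the analysis `S*` is just an assignment of every point to a closest one of at most `k`
      -- centres.
      open Compare (card S*) S*≤k optimal-centre assigned assigned<

      sum-mono : ∀ {m} (u v : Vector Carrier m) → (∀ j → u j ≤ v j) → sum u ≤ sum v
      sum-mono {zero}  u v u≤v = ≤-refl
      sum-mono {suc m} u v u≤v = +-mono-≤ (u≤v Fin.zero) (sum-mono (u ∘ Fin.suc) (v ∘ Fin.suc) (u≤v ∘ Fin.suc))

      optimum≤ : optimum ≤ cost X S*
      optimum≤ = ≤-trans (≤-reflexive (sym (sum≈∑ n (λ y → dist (P (toℕ y)) (optimal-centre (assigned (toℕ y)))) _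
          λ y → refl)))
          (sum-mono _ _ λ y → ≤-trans (≤-reflexive (dist-cong (λ l → reflexive (pt≡point k X ε y l))
              (λ l → reflexive (≡.cong (λ p → p l) (≡.trans (≡.cong optimal-centre (assigned-toℕ y))
                  (optimal-centre-toℕ (closest y)))))))
            (proj₂ (minimum-attained {{PointSet.nonZero S*}} λ j → ‖ point X y -ᵥ point S* j ‖²)))

      0≤r : 0# ≤ r
      0≤r = by (*-cancelˡ-≤ (num≰0 k) (≤-resp (sym kr) (sym (*-identityʳ _)) (1≤num k)))
          (solve 1 (λ r → # 0 :+ # 1 := r :+ (# 1 :- r)) refl r)

      near-optimal : cost X S ≤ (1# + 1# + ε) * cost X S*
      near-optimal = ≤-trans cost≤ (≤-trans (approximation cover 0≤r kr greedy e≤ε)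
          (*-monoˡ-≤ (≤-resp (trans (+-congʳ (+-identityʳ 0#)) (+-identityʳ 0#)) refl
              (+-mono-≤ (+-mono-≤ 0≤1 0≤1) (proj₁ 0<ε))) optimum≤))

      -- `c ≤ J + 4 k + 1 ≤ 40 k + k ℓ⁺`, and `10082 = 10122 - 40`; the constant itself is dictated
      -- by the running time.
      few′ : num c ≤ num (10122 ℕ.* k) + num k * ℓ⁺
      few′ = ≤-trans (num-mono (ℕ.≤-trans size-bound (ℕ.+-monoˡ-≤ (suc 4k) i≤J)))
          (by (+-mono-≤ J≤ (+-mono-≤ (+-mono-≤ (1≤num k) (1≤num k)) (*-nonNeg (0≤num 10082) (0≤num k))))
          (trans (+-congʳ (trans (num-+ J (suc 4k)) (+-congˡ
              (trans (num-suc 4k) (+-congˡ (trans (num-+ (k ℕ.+ k) (k ℕ.+ k)) (+-cong (num-+ k k) (num-+ k k))))))))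
          (trans (solve 3 (λ J k l → (J :+ (# 1 :+ (k :+ k :+ (k :+ k)))) :+
              ((k :* (# 34 :+ l) :+ # 1) :+ ((k :+ k) :+ # 10082 :* k)) :=
              (# 10122 :* k :+ k :* l) :+ (J :+ ((# 1 :+ # 1) :+ # 0))) refl (num J) (num k) ℓ⁺)
            (+-congʳ (+-congʳ (sym (num-* 10122 k)))))))

      few : fromℕ (card S) ≤ fromℕ (10122 ℕ.* k) + fromℕ k * ℓ⁺
      few rewrite ≡.sym (num≡fromℕ c) | ≡.sym (num≡fromℕ (10122 ℕ.* k)) | ≡.sym (num≡fromℕ k) = few′

      -- `10122 = 1122 + 250 · 34 + 250 + 250`, the last two summands coming from `ℓ⁺` in the number
      -- of steps and from rounding it up.
      time′ : num t ≤ num (10122 ℕ.* (n ℕ.^ 2 ℕ.* d ℕ.* k)) * ℓ⁺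
      time′ = ≤-trans (num-mono t≤) (≤-trans (≤-reflexive
          (trans (num-+ _ _) (+-cong (trans (num-* 1122 _) (*-congˡ (num-* w k)))
            (trans (num-* J _) (*-congˡ (num-* 250 w))))))
          (≤-trans (by (+-mono-≤ (*-monoˡ-≤ (*-nonNeg (0≤num 250) (0≤num w)) J≤)
              (+-mono-≤ (*-monoˡ-≤ (*-nonNeg (0≤num 9872) 0≤wk) 1≤ℓ⁺)
                (*-monoˡ-≤ (*-nonNeg (0≤num 250) (0≤num w)) (1≤num k))))
              (solve 4 (λ w k J l → (# 1122 :* (w :* k) :+ J :* (# 250 :* w)) :+
                  (# 250 :* w :* (k :* (# 34 :+ l) :+ # 1) :+
                   (# 9872 :* (w :* k) :* l :+ # 250 :* w :* k)) :=
                 # 10122 :* (w :* k) :* l :+ (# 250 :* w :* J :+ (# 9872 :* (w :* k) :* # 1 :+ # 250 :* w :* # 1))) refl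
                 (num w) (num k) (num J) ℓ⁺))
            (≤-reflexive (*-congʳ (trans (*-congˡ (sym (num-* w k))) (trans (sym (num-* 10122 (w ℕ.* k)))
              (reflexive (≡.cong (λ x → num (10122 ℕ.* x)) wk≡))))))))
        where
        0≤wk : 0# ≤ num w * num k
        0≤wk = *-nonNeg (0≤num w) (0≤num k)
        wk≡ : w ℕ.* k ≡ n ℕ.^ 2 ℕ.* d ℕ.* k
        wk≡ = ℕ-Solver.solve 3 (λ n d k → n ℕ-Solver.:* (n ℕ-Solver.:* d) ℕ-Solver.:* k ℕ-Solver.:= n ℕ-Solver.:*
            (n ℕ-Solver.:* ℕ-Solver.con 1) ℕ-Solver.:* d ℕ-Solver.:* k) ≡.refl n d k

      time : fromℕ t ≤ fromℕ (10122 ℕ.* (card X ℕ.^ 2 ℕ.* d ℕ.* k)) * ℓ⁺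
      time rewrite ≡.sym (num≡fromℕ t) | ≡.sym (num≡fromℕ (10122 ℕ.* (n ℕ.^ 2 ℕ.* d ℕ.* k))) = time′

    B = num k * (num 34 + ℓ⁺)
    0≤B : 0# ≤ B
    0≤B = *-nonNeg (0≤num k) (≤-resp (+-identityʳ 0#) refl (+-mono-≤ (0≤num 34) 0≤ℓ⁺))
    J = proj₁ (ceiling B 0≤B)
    J≤ : num J ≤ B + 1#
    J≤ = proj₁ (proj₂ (ceiling B 0≤B))

    4K≈2³⁴ : num 4 * num K ≈ num 2 ^ 34
    4K≈2³⁴ = trans (sym (num-* 4 4294967296)) (sym (num-^ 2 34))

    -- The machine keeps `r = 1 - 1/k`, whereas `iterations-bound` takes `1/k`; it is applied to
    -- `1 - r`.
    J-bound : ∀ r i → num k * (1# - r) ≈ 1# → ¬ num 4 * num K * r ^ i ≤ ε → i ℕ.< J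
    J-bound r i kr big = proj₂ (proj₂ (ceiling B 0≤B)) i (iterations-bound k 34 i 0<ε log kr λ small →
      big (≤-trans (≤-reflexive (*-cong 4K≈2³⁴ (power i))) small))
      where
      power : ∀ i → r ^ i ≈ (1# - (1# - r)) ^ i
      power zero    = refl
      power (suc i) = *-cong (solve 1 (λ r → r := # 1 :- (# 1 :- r)) refl r) (power i)

    solution : Goal
    solution = conclude J J≤ (program-spec J starts J-bound)

lemma3 : (em : ExcludedMiddle 0ℓ) (ℝ : Reals) → let open KMeans em ℝ in
    ∃[ P ] ∃[ C ] (∀ (d k : ℕ) → .{{_ : NonZero d}} → .{{_ : NonZero k}} →
    (X S* : PointSet d) → IsOptimal X k S* →
    (ε ℓ : Carrier) → 0# < ε → IsLog (ε ⁻¹) ℓ →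
    ∃[ S ] ∃[ t ] ∃[ c ]
    P ⊢ input X k ε ⇓[ t ] c
    × Outputs c S
    × fromℕ t ≤ fromℕ (C ℕ.* (card X ℕ.^ 2 ℕ.* d ℕ.* k)) * (1# ⊔ ℓ)
    × fromℕ (card S) ≤ fromℕ (C ℕ.* k) + fromℕ k * (1# ⊔ ℓ)
    × cost X S ≤ (1# + 1# + ε) * cost X S*)
lemma3 em ℝ = StructuredPrograms.compile em ℝ 0 (Algorithm.program em ℝ) , 10122 ,
  λ d k X S* (S*≤k , _) ε ℓ 0<ε log → Main.Outcome.solution em ℝ k X S* S*≤k ε ℓ 0<ε log
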